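{- Let $\lambda$ be a partition. Then $$G_\lambda(x;y)=\lim_{k\to\infty}G_\lambda(x_1,\dots,x_k\,|\,y),$$ where $G_\lambda(x;y)$ is the double stable Grothendieck polynomial (a power series in $x=(x_1,x_2,\dots)$ and $y=(y_1,y_2,\dots)$) of $\lambda$, $G_\lambda(x_1,\dots,x_k|y)$ is the factorial Grothendieck polynomial in the $k$ variables $x_1,\dots,x_k$ with second sequence of variables $y$, and the limit is taken coefficientwise (the coefficient of each fixed monomial is eventually constant).
   Context: $\beta$ is an indeterminate and $x\oplus y=x+y+\beta xy$. Factorial Grothendieck polynomials. A partition is identified with its Young diagram (box $(i,j)$ in row $i$ from the top, column $j$); the content of $\alpha=(i,j)$ is $c(\alpha)=j-i$; $|\lambda|$ is the number of boxes. A set-valued $\lambda$-tableau $T$ with entries in $[k]=\{1,\dots,k\}$ assigns to each box $\alpha$ a non-empty set $T(\alpha)\subset[k]$ such that $\max T(\alpha)\le\min T(\alpha')$ if $\alpha$ is immediately left of $\alpha'$, and $\max T(\alpha)<\min T(\alpha')$ if $\alpha$ is immediately above $\alpha'$; $|T|=\sum_\alpha|T(\alpha)|$. Then $$G_\lambda(x_1,\dots,x_k|y)=\sum_T\beta^{|T|-|\lambda|}\prod_{\alpha\in\lambda,\ r\in T(\alpha)}\bigl(x_r\oplus y_{r+c(\alpha)}\bigr),$$ the sum being over all set-valued $\lambda$-tableaux with entries in $[k]$ (only $y_i$ with $i\ge1$ occur). Double Grothendieck polynomials. For $w\in S_{N+1}$, with simple reflections $s_i=(i,i+1)$ and length $\ell(w)=\#\{i<j: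 w(i)>w(j)\}$, define $\mathcal{G}_w$ as follows. The isobaric divided difference operators act on polynomials $f$ in the $x$-variables by $$\pi_if=\frac{(1+\beta x_{i+1})f(\dots,x_i,x_{i+1},\dots)-(1+\beta x_i)f(\dots,x_{i+1},x_i,\dots)}{x_i-x_{i+1}}.$$ For the longest element $w_0=(N+1,N,\dots,1)$ of $S_{N+1}$ put $\mathcal{G}_{w_0}=\prod_{i+j\le N+1}(x_i\oplus y_j)$; for $w\ne w_0$ put $\mathcal{G}_w=\pi_i\mathcal{G}_{ws_i}$ for any $i$ with $\ell(ws_i)>\ell(w)$ (this is independent of the choice of $i$). For $w\in S_{N+1}$, $1^m\times w\in S_{m+N+1}$ is the permutation fixing $1,\dots,m$ and sending $i>m$ to $m+w(i-m)$. The double stable Grothendieck polynomial is the power series $G_w(x;y)=\lim_{m\to\infty}\mathcal{G}_{1^m\times w}$ (coefficientwise limit, which exists). For a partition $\lambda$ choose any $p\ge\ell(\lambda)$ (with $\lambda_k=0$ for $k>\ell(\lambda)$) and let $w(\lambda)$ be the permutation of the positive integers with $w(\lambda)(i)=i+\lambda_{p+1-i}$ for $1\le i\le p$ and $w(\lambda)(i)=i-\lambda'_{i-p}$ for $i>p$, where $\lambda'$ is the conjugate partition (it fixes all but finitely many integers). Define $G_\lambda(x;y)=G_{w(\lambda)}(x;y)$; this is independent of $p$. -}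

module Defs where

open import Data.Nat using (ℕ; zero; suc; _+_; _*_; _∸_; _≤_; _<_; _≥_; _>_; _≤?_; _<?_; _≟_)
open import Data.Integer as ℤ using (ℤ; 0ℤ; 1ℤ)
open import Data.Nat.Combinatorics using (_C_)
open import Data.Fin using (Fin; zero; suc; toℕ)
open import Data.Fin.Properties using (all?; ∀-cons)
open import Data.Fin.Subset using (Subset; Nonempty; ∣_∣; inside; outside)
open import Data.Fin.Subset.Properties using (_∈?_; nonempty?)
open import Data.Vec using ([]; _∷_)
open import Data.List
  using (List; []; _∷_; [_]; _++_; map; foldr; concatMap; cartesianProduct; cartesianProductWith;
         filter; length; head; upTo; allFin; lookup)
open import Data.Nat.ListAction using (sum)
open import Data.List.Extrema.Nat using (max; min)
open import Data.List.Relation.Unary.All as All using (All)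
open import Data.List.Relation.Unary.Linked using (Linked)
open import Data.Maybe using (maybe′)
open import Data.Product using (Σ; Σ-syntax; ∃-syntax; _×_; _,_; proj₁)
open import Function using (_∘_)
open import Relation.Binary.Definitions using (DecidableEquality)
open import Relation.Binary.PropositionalEquality using (_≡_; refl; cong)
open import Relation.Nullary using (Dec; yes; no; map′; _×-dec_; _→-dec_)

------------------------------------------------------------------------
-- Polynomials in the variables x₁, x₂, …, y₁, y₂, … over ℤ[β]

-- Index 0 is never used.
data Var : Set where
  x[_] y[_] : ℕ → Var

_≟ⱽ_ : DecidableEquality Var
x[ i ] ≟ⱽ x[ j ] = map′ (cong x[_]) (λ { refl → refl }) (i ≟ j)
x[ i ] ≟ⱽ y[ j ] = no λ ()
y[ i ] ≟ⱽ x[ j ] = no λ ()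
y[ i ] ≟ⱽ y[ j ] = map′ (cong y[_]) (λ { refl → refl }) (i ≟ j)

-- A monomial in the x's and y's is a word in the variables, read up to
-- reordering: only the exponents matter.
Mono : Set
Mono = List Var

exponent : Var → Mono → ℕ
exponent v m = length (filter (v ≟ⱽ_) m)

_≈ᴹ_ : Mono → Mono → Set
m ≈ᴹ m′ = All (λ v → exponent v m ≡ exponent v m′) (m ++ m′)

_≈ᴹ?_ : ∀ m m′ → Dec (m ≈ᴹ m′)
m ≈ᴹ? m′ = All.all? (λ v → exponent v m ≟ exponent v m′) (m ++ m′)

-- (c , b , m) stands for the term c β^b m.
Term : Set
Term = ℤ × ℕ × Mono

-- A formal sum of terms; like terms need not be collected, and polynomials
-- are only ever compared through their coefficients.
Poly : Set
Poly = List Term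

0ᵖ 1ᵖ : Poly
0ᵖ = []
1ᵖ = [ 1ℤ , 0 , [] ]

var : Var → Poly
var v = [ 1ℤ , 0 , [ v ] ]

X Y : ℕ → Poly
X = var ∘ x[_]
Y = var ∘ y[_]

β^ : ℕ → Poly
β^ b = [ 1ℤ , b , [] ]

β : Poly
β = β^ 1

infixl 6 _+ᵖ_ _-ᵖ_ _⊕_
infixl 7 _*ᵖ_

_+ᵖ_ _-ᵖ_ _*ᵖ_ _⊕_ : Poly → Poly → Poly
f +ᵖ g = f ++ g
f -ᵖ g = f ++ map (λ (c , b , m) → ℤ.- c , b , m) g
_*ᵖ_   = cartesianProductWith
           (λ (c , b , m) (c′ , b′ , m′) → c ℤ.* c′ , b + b′ , m ++ m′)
f ⊕ g  = f +ᵖ g +ᵖ β *ᵖ f *ᵖ g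

Σᵖ Πᵖ : {A : Set} → List A → (A → Poly) → Poly
Σᵖ as f = foldr (λ a → f a +ᵖ_) 0ᵖ as
Πᵖ as f = foldr (λ a → f a *ᵖ_) 1ᵖ as

-- coeff f m is the coefficient of m in f, an element of ℤ[β] given by the
-- sequence of its own coefficients.
coeff : Poly → Mono → ℕ → ℤ
coeff f m b = foldr ℤ._+_ 0ℤ (map proj₁
  (filter (λ (_ , b′ , m′) → (b′ ≟ b) ×-dec (m′ ≈ᴹ? m)) f))

Series : Set
Series = Mono → ℕ → ℤ

-- Coefficientwise limit over ℤ[β]: the bound K depends on the monomial in
-- the x's and y's, but not on the power of β.  Such a G automatically takes
-- equal values on words that are rearrangements of each other, and values
-- in ℤ[β] (sequences that vanish eventually).
_⟶_ : (ℕ → Poly) → Series → Set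
f ⟶ G = ∀ m → ∃[ K ] (∀ k → k ≥ K → ∀ b → coeff (f k) m b ≡ G m b)

------------------------------------------------------------------------
-- Permutations of the positive integers
--
-- They are given as functions on ℕ; the value at 0 is irrelevant.

⟦1…_⟧ : ℕ → List ℕ
⟦1… n ⟧ = map suc (upTo n)

s : ℕ → ℕ → ℕ
s i r with r ≟ i | r ≟ suc i
... | yes _ | _     = suc i
... | no _  | yes _ = i
... | no _  | no _  = r

-- Number of inversions, for w ∈ S_n.
ℓ : ℕ → (ℕ → ℕ) → ℕ
ℓ n w = length (filter (λ (i , j) → (i <? j) ×-dec (w j <? w i))
                       (cartesianProduct ⟦1… n ⟧ ⟦1… n ⟧))

1^_×ₛ_ : ℕ → (ℕ → ℕ) → ℕ → ℕ
(1^ m ×ₛ w) i with i ≤? m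
... | yes _ = i
... | no _  = m + w (i ∸ m)

------------------------------------------------------------------------
-- Double Grothendieck polynomials

swapVar : ℕ → Var → Var
swapVar i x[ r ] = x[ s i r ]
swapVar i y[ r ] = y[ r ]

swapX : ℕ → Poly → Poly
swapX i = map λ (c , b , m) → c , b , map (swapVar i) m

-- Quotient in the division by the polynomial xᵢ − xᵢ₊₁, monic in xᵢ; the
-- remainder is obtained by setting xᵢ = xᵢ₊₁.  On words it follows from
--   xᵢ m = (xᵢ − xᵢ₊₁) m + xᵢ₊₁ m,
-- and it is extended linearly.
quotᴹ : ℕ → Mono → List Mono
quotᴹ i [] = []
quotᴹ i (v ∷ m) with v ≟ⱽ x[ i ]
... | yes _ = m ∷ map (x[ suc i ] ∷_) (quotᴹ i m)
... | no _  = map (v ∷_) (quotᴹ i m)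

_/[x_-x₊₁] : Poly → ℕ → Poly
f /[x i -x₊₁] = concatMap (λ (c , b , m) → map (λ q → c , b , q) (quotᴹ i m)) f

-- The numerator vanishes at xᵢ = xᵢ₊₁, so this division is exact.
π : ℕ → Poly → Poly
π i f = ((1ᵖ +ᵖ β *ᵖ X (suc i)) *ᵖ f -ᵖ (1ᵖ +ᵖ β *ᵖ X i) *ᵖ swapX i f) /[x i -x₊₁]

𝒢₀ : ℕ → Poly
𝒢₀ N = Πᵖ (filter (λ (i , j) → i + j ≤? suc N)
                  (cartesianProduct ⟦1… suc N ⟧ ⟦1… suc N ⟧))
          (λ (i , j) → X i ⊕ Y j)

ascents : ℕ → (ℕ → ℕ) → List ℕ
ascents N w = filter (λ i → ℓ (suc N) w <? ℓ (suc N) (w ∘ s i)) ⟦1… N ⟧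

-- For d = ℓ(w₀) − ℓ(w); thus w = w₀ exactly when d = 0, and exactly when w
-- has no ascents.  Every choice of i gives the same polynomial; the smallest
-- one is used.
𝒢-rec : ℕ → ℕ → (ℕ → ℕ) → Poly
𝒢-rec N zero    w = 𝒢₀ N
𝒢-rec N (suc d) w =
  maybe′ (λ i → π i (𝒢-rec N d (w ∘ s i))) (𝒢₀ N) (head (ascents N w))

-- The double Grothendieck polynomial of w ∈ S_{N+1}; ℓ(w₀) = (N+1) C 2.
𝒢 : ℕ → (ℕ → ℕ) → Poly
𝒢 N w = 𝒢-rec N (suc N C 2 ∸ ℓ (suc N) w) w

-- G is the double stable Grothendieck series of w ∈ S_{N+1}.
IsStableGrothendieck : ℕ → (ℕ → ℕ) → Series → Set
IsStableGrothendieck N w G = (λ m → 𝒢 (m + N) (1^ m ×ₛ w)) ⟶ G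

------------------------------------------------------------------------
-- Partitions

record Partition : Set where
  field
    parts    : List ℕ
    sorted   : Linked _≥_ parts
    positive : All (_> 0) parts

open Partition public

-- The k-th part, counted from 1, and 0 beyond the last part.
part : List ℕ → ℕ → ℕ
part []       _             = 0
part _        zero          = 0
part (a ∷ _)  (suc zero)    = a
part (_ ∷ as) (suc (suc k)) = part as (suc k)

conjPart : List ℕ → ℕ → ℕ
conjPart μ j = length (filter (j ≤?_) μ)

permutation : List ℕ → ℕ → ℕ → ℕ
permutation μ p i with i ≤? p
... | yes _ = i + part μ (suc p ∸ i)
... | no _  = i ∸ conjPart μ (i ∸ p)

-- G is the double stable Grothendieck series of μ: it is that of the
-- associated permutation w, for every admissible p and every N with
-- w ∈ S_{N+1}.
IsStableGrothendieckOf : Partition → Series → Set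
IsStableGrothendieckOf μ G =
  ∀ p → p ≥ length (parts μ) →
  ∀ N → (∀ i → i > suc N → permutation (parts μ) p i ≡ i) →
  IsStableGrothendieck N (permutation (parts μ) p) G

------------------------------------------------------------------------
-- Factorial Grothendieck polynomials
--
-- Rows, columns and the elements of Fin k are counted from 0, so that
-- r : Fin k stands for the entry toℕ r + 1.

Box : List ℕ → Set
Box μ = Σ[ i ∈ Fin (length μ) ] Fin (lookup μ i)

boxes : ∀ μ → List (Box μ)
boxes μ = concatMap (λ i → map (i ,_) (allFin (lookup μ i))) (allFin (length μ))

Filling : ℕ → List ℕ → Set
Filling k μ = (i : Fin (length μ)) → Fin (lookup μ i) → Subset k

entries : ∀ {k} → Subset k → List ℕ
entries {k} S = map (suc ∘ toℕ) (filter (_∈? S) (allFin k))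

-- The defaults 0 and k do not affect the value on a non-empty subset of [k].
maxEntry minEntry : ∀ {k} → Subset k → ℕ
maxEntry S = max 0 (entries S)
minEntry {k} S = min k (entries S)

IsSetValuedTableau : ∀ {k} μ → Filling k μ → Set
IsSetValuedTableau μ T =
    (∀ i j → Nonempty (T i j))
  × (∀ i j j′ → toℕ j′ ≡ suc (toℕ j) → maxEntry (T i j) ≤ minEntry (T i j′))
  × (∀ i i′ j j′ → toℕ i′ ≡ suc (toℕ i) → toℕ j′ ≡ toℕ j →
       maxEntry (T i j) < minEntry (T i′ j′))

isSetValuedTableau? : ∀ {k} μ (T : Filling k μ) → Dec (IsSetValuedTableau μ T)
isSetValuedTableau? μ T =
        all? (λ i → all? λ j → nonempty? (T i j))
  ×-dec all? (λ i → all? λ j → all? λ j′ →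
          (toℕ j′ ≟ suc (toℕ j)) →-dec (maxEntry (T i j) ≤? minEntry (T i j′)))
  ×-dec all? (λ i → all? λ i′ → all? λ j → all? λ j′ →
          (toℕ i′ ≟ suc (toℕ i)) →-dec ((toℕ j′ ≟ toℕ j) →-dec
          (maxEntry (T i j) <? minEntry (T i′ j′))))

subsets : ∀ k → List (Subset k)
subsets zero    = [ [] ]
subsets (suc k) = cartesianProductWith _∷_ (outside ∷ inside ∷ []) (subsets k)

-- All f with f i among the elements of as i, each listed once if every
-- as i is free of repetitions.
choices : ∀ {n} {A : Fin n → Set} → (∀ i → List (A i)) → List (∀ i → A i)
choices {zero}          as = [ (λ ()) ]
choices {suc n} {A = A} as =
  cartesianProductWith (∀-cons {P = A}) (as zero) (choices (as ∘ suc))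

setValuedTableaux : ∀ k μ → List (Filling k μ)
setValuedTableaux k μ =
  filter (isSetValuedTableau? μ) (choices λ i → choices λ j → subsets k)

size : ∀ {k} μ → Filling k μ → ℕ
size μ T = sum (map (λ (i , j) → ∣ T i j ∣) (boxes μ))

-- In a tableau the entries in (0-based) row i exceed i, so the truncated
-- subtraction computes r + c(α) ≥ 1.
weight : ∀ {k} μ → Filling k μ → Poly
weight μ T = β^ (size μ T ∸ sum μ)
  *ᵖ Πᵖ (boxes μ) λ (i , j) →
       Πᵖ (entries (T i j)) λ r → X r ⊕ Y (r + toℕ j ∸ toℕ i)

-- G_μ(x₁, …, x_k | y)
factorialGrothendieck : Partition → ℕ → Poly
factorialGrothendieck μ k =
  Σᵖ (setValuedTableaux k (parts μ)) (weight (parts μ))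

{-# OPTIONS --safe #-}

-- Both sides are equal before the limit is taken: 𝒢 of the Grassmannian permutation of μ with
-- descent at k is the factorial Grothendieck polynomial in x₁, …, x_k.
--
-- Following first ascents, the recursion for 𝒢 first sorts w(1) < … < w(k) into decreasing order, which
-- applies the operator of the longest element of S_k, and it continues through dominant permutations v,
-- for which 𝒢 is ∏ᵢ [xᵢ|y]^{cᵢ(v)} with c the Lehmer code and [x|y]^a = (x ⊕ y₁) ⋯ (x ⊕ y_a).  Hence 𝒢 is
-- that operator applied to ∏ᵢ [xᵢ|y]^{μᵢ + k − i}.
--
-- Such a symmetrized product obeys the branching rule that removes the largest entry from a set-valued
-- tableau.  With z in place of x_k, the sum over the possible lengths of one row telescopes after
-- multiplication by x − z, to a difference of two terms; the second one always meets an equal factor in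
-- the next variable and is killed by the symmetrization.  Setting z = x_k at the end leaves
-- (1 + β x_k)^{k−1} times both sides of the rule.
--
-- The coefficients stabilize because, modulo the monomials containing a variable of large index, the
-- branching rule reduces to the term in which the new entry is not used.

module Submission where

-- The auxiliary z is forced: x_k is itself permuted by the symmetrization, so 1 + βx_k cannot be
-- moved through it, while 1 + βz is a constant for it. Rows are treated from the last to the first,
-- so that the next variable carries its full power when the second term of a row has to be killed.
-- The two sides obey the branching rule in different forms: tableaux branch over all rows of a
-- fixed grid, symmetrized products over fewer rows followed by one row filled completely. The forms
-- agree because no tableau with entries in [k] has more than k rows. Cancelling x_i - x_j and 1 +
-- βx_i is legitimate because neither divides zero; for formal lists of terms this is shown on the
-- dual side, by functionals. The tableau recursion is proved over an arbitrary commutative ring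
-- because it is used for polynomials and also for a quotient in which variables of large index
-- vanish. Passing from w to 1^m × w stays within the family: for the permutation of a partition it
-- replaces p by m + p.

-- Adjacent transpositions and their Coxeter relations.

module AdjacentTranspositions where

  open import Defs
  open import Data.Nat using (ℕ; suc; _<_; _≟_)
  open import Data.Nat.Properties using (<⇒≢; 1+n≢n; <-trans; n<1+n)
  open import Function using (_∘_)
  open import Relation.Nullary using (yes; no; contradiction)
  open import Relation.Binary.PropositionalEquality using (_≡_; _≢_; refl; sym; trans; cong)

  s-left : ∀ i → s i i ≡ suc i
  s-left i with i ≟ i
  ... | yes _ = refl
  ... | no ne = contradiction refl ne

  s-right : ∀ i → s i (suc i) ≡ i
  s-right i with suc i ≟ i | suc i ≟ suc i
  ... | yes e | _     = contradiction e 1+n≢n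
  ... | no _  | yes _ = refl
  ... | no _  | no ne = contradiction refl ne

  s-other : ∀ {i r} → r ≢ i → r ≢ suc i → s i r ≡ r
  s-other {i} {r} ne ne′ with r ≟ i | r ≟ suc i
  ... | yes e | _     = contradiction e ne
  ... | no _  | yes e = contradiction e ne′
  ... | no _  | no _  = refl

  s-below : ∀ {i r} → r < i → s i r ≡ r
  s-below r<i = s-other (<⇒≢ r<i) (<⇒≢ (<-trans r<i (n<1+n _)))

  s-above : ∀ {i r} → suc i < r → s i r ≡ r
  s-above i<r = s-other (<⇒≢ (<-trans (n<1+n _) i<r) ∘ sym) (<⇒≢ i<r ∘ sym)

  data Position (i : ℕ) : ℕ → Set where
    left  : Position i i
    right : Position i (suc i)
    other : ∀ {r} → r ≢ i → r ≢ suc i → Position i r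

  position : ∀ i r → Position i r
  position i r with r ≟ i | r ≟ suc i
  ... | yes refl | _        = left
  ... | no _     | yes refl = right
  ... | no ne    | no ne′   = other ne ne′

  s-involutive : ∀ i r → s i (s i r) ≡ r
  s-involutive i r with position i r
  ... | left         = trans (cong (s i) (s-left i)) (s-right i)
  ... | right        = trans (cong (s i) (s-right i)) (s-left i)
  ... | other ne ne′ = trans (cong (s i) (s-other ne ne′)) (s-other ne ne′)

  s-comm : ∀ {i j} → suc i < j → ∀ r → s i (s j r) ≡ s j (s i r)
  s-comm {i} {j} i<j r with position i r
  ... | left  rewrite s-left i  | s-below (<-trans (n<1+n i) i<j) | s-below i<j = s-left i
  ... | right rewrite s-right i | s-below (<-trans (n<1+n i) i<j) | s-below i<j = s-right i
  ... | other ne ne′ rewrite s-other ne ne′ with position j r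
  ...   | left  rewrite s-left j  = s-above (<-trans i<j (n<1+n j))
  ...   | right rewrite s-right j = s-above i<j
  ...   | other me me′ rewrite s-other me me′ = s-other ne ne′

  s-braid : ∀ i r → s i (s (suc i) (s i r)) ≡ s (suc i) (s i (s (suc i) r))
  s-braid i r with position i r
  ... | left
    rewrite s-left i | s-left (suc i) | s-above (n<1+n (suc i)) | s-below (n<1+n i) | s-left i
    = sym (s-left (suc i))
  ... | right
    rewrite s-right i | s-left (suc i) | s-above (n<1+n (suc i)) | s-below (n<1+n i) | s-left i
    = sym (s-right (suc i))
  ... | other ne ne′ with position (suc i) r
  ...   | left         = contradiction refl ne′
  ...   | right        = trans (cong (s i ∘ s (suc i)) (s-other ne ne′))
                        (trans (cong (s i) (s-right (suc i)))
                        (trans (s-right i)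
                        (sym (trans (cong (s (suc i) ∘ s i) (s-right (suc i)))
                        (trans (cong (s (suc i)) (s-right i)) (s-below (n<1+n i)))))))
  ...   | other _ ne″  = trans (cong (s i ∘ s (suc i)) (s-other ne ne′))
                        (trans (cong (s i) (s-other ne′ ne″))
                        (trans (s-other ne ne′)
                        (sym (trans (cong (s (suc i) ∘ s i) (s-other ne′ ne″))
                        (trans (cong (s (suc i)) (s-other ne ne′)) (s-other ne′ ne″))))))

-- Polynomials through linear functionals, and the quotient rings they define.

module Functionals where

  open import Defs
  open import Level using (0ℓ)
  open import Algebra.Bundles using (CommutativeRing)
  open import Data.Integer as ℤ using (ℤ; 0ℤ)
  import Data.Integer.Properties as ℤₚ
  open import Data.Integer.Tactic.RingSolver using (solve-∀)
  open import Data.List using ([]; _∷_; _++_; map)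
  import Data.List.Properties as Listₚ
  open import Data.List.Relation.Binary.Permutation.Propositional as Perm using (_↭_)
  import Data.List.Relation.Binary.Permutation.Propositional.Properties as Permₚ
  open import Data.Nat as ℕ using (ℕ)
  import Data.Nat.Properties as ℕₚ
  open import Data.Product using (_,_)
  open import Relation.Binary.PropositionalEquality using (_≡_; refl; sym; trans; cong; cong₂; module ≡-Reasoning)

  Functional : Set
  Functional = ℕ → Mono → ℤ

  -- Pairing with functions on the monomials β^b m; a polynomial is used only
  -- through these linear functionals.
  ⟪_⟫ : Poly → Functional → ℤ
  ⟪ [] ⟫              φ = 0ℤ
  ⟪ (c , b , m) ∷ f ⟫ φ = c ℤ.* φ b m ℤ.+ ⟪ f ⟫ φ

  ⟪⟫-++ : ∀ f g φ → ⟪ f ++ g ⟫ φ ≡ ⟪ f ⟫ φ ℤ.+ ⟪ g ⟫ φ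
  ⟪⟫-++ []                g φ = sym (ℤₚ.+-identityˡ _)
  ⟪⟫-++ ((c , b , m) ∷ f) g φ = trans (cong (ℤ._+_ (c ℤ.* φ b m)) (⟪⟫-++ f g φ))
                                      (sym (ℤₚ.+-assoc (c ℤ.* φ b m) (⟪ f ⟫ φ) (⟪ g ⟫ φ)))

  -ᵖ_ : Poly → Poly
  -ᵖ f = map (λ (c , b , m) → ℤ.- c , b , m) f

  ⟪⟫-neg : ∀ f φ → ⟪ -ᵖ f ⟫ φ ≡ ℤ.- ⟪ f ⟫ φ
  ⟪⟫-neg []                φ = refl
  ⟪⟫-neg ((c , b , m) ∷ f) φ = trans (cong (ℤ._+_ (ℤ.- c ℤ.* φ b m)) (⟪⟫-neg f φ))
                                     (lemma c (φ b m) (⟪ f ⟫ φ))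
    where
    lemma : ∀ c d e → ℤ.- c ℤ.* d ℤ.+ ℤ.- e ≡ ℤ.- (c ℤ.* d ℤ.+ e)
    lemma = solve-∀

  ⟪⟫-ext : ∀ f {φ ψ} → (∀ b m → φ b m ≡ ψ b m) → ⟪ f ⟫ φ ≡ ⟪ f ⟫ ψ
  ⟪⟫-ext []                eq = refl
  ⟪⟫-ext ((c , b , m) ∷ f) eq = cong₂ ℤ._+_ (cong (c ℤ.*_) (eq b m)) (⟪⟫-ext f eq)

  ⟪⟫-linear : ∀ f c φ ψ → ⟪ f ⟫ (λ b m → c ℤ.* φ b m ℤ.+ ψ b m) ≡ c ℤ.* ⟪ f ⟫ φ ℤ.+ ⟪ f ⟫ ψ
  ⟪⟫-linear []                 c φ ψ = lemma c
    where
    lemma : ∀ c → 0ℤ ≡ c ℤ.* 0ℤ ℤ.+ 0ℤ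
    lemma = solve-∀
  ⟪⟫-linear ((c′ , b , m) ∷ f) c φ ψ =
    trans (cong (ℤ._+_ (c′ ℤ.* (c ℤ.* φ b m ℤ.+ ψ b m))) (⟪⟫-linear f c φ ψ))
          (lemma c c′ (φ b m) (ψ b m) (⟪ f ⟫ φ) (⟪ f ⟫ ψ))
    where
    lemma : ∀ c c′ p q r t → c′ ℤ.* (c ℤ.* p ℤ.+ q) ℤ.+ (c ℤ.* r ℤ.+ t) ≡
                             c ℤ.* (c′ ℤ.* p ℤ.+ r) ℤ.+ (c′ ℤ.* q ℤ.+ t)
    lemma = solve-∀

  ⟪⟫-zero : ∀ f → ⟪ f ⟫ (λ _ _ → 0ℤ) ≡ 0ℤ
  ⟪⟫-zero []                = refl
  ⟪⟫-zero ((c , b , m) ∷ f) = trans (cong₂ ℤ._+_ (ℤₚ.*-zeroʳ c) (⟪⟫-zero f)) refl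

  ⟪⟫-swap : ∀ f g (φ : ℕ → Mono → Functional) →
    ⟪ f ⟫ (λ b m → ⟪ g ⟫ (λ b′ m′ → φ b m b′ m′)) ≡ ⟪ g ⟫ (λ b′ m′ → ⟪ f ⟫ (λ b m → φ b m b′ m′))
  ⟪⟫-swap []                g φ = sym (⟪⟫-zero g)
  ⟪⟫-swap ((c , b , m) ∷ f) g φ =
    trans (cong (ℤ._+_ (c ℤ.* ⟪ g ⟫ (φ b m))) (⟪⟫-swap f g φ))
          (sym (⟪⟫-linear g c (φ b m) (λ b′ m′ → ⟪ f ⟫ (λ b m → φ b m b′ m′))))

  -- The transpose of multiplication by the monomial β^b m.
  shift : ℕ → Mono → Functional → Functional
  shift b m φ b′ m′ = φ (b ℕ.+ b′) (m ++ m′)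

  ⟪⟫-term : ∀ c b m g φ →
    ⟪ map (λ (c′ , b′ , m′) → c ℤ.* c′ , b ℕ.+ b′ , m ++ m′) g ⟫ φ ≡ c ℤ.* ⟪ g ⟫ (shift b m φ)
  ⟪⟫-term c b m []                   φ = sym (ℤₚ.*-zeroʳ c)
  ⟪⟫-term c b m ((c′ , b′ , m′) ∷ g) φ =
    trans (cong (ℤ._+_ (c ℤ.* c′ ℤ.* shift b m φ b′ m′)) (⟪⟫-term c b m g φ))
          (lemma c c′ (shift b m φ b′ m′) (⟪ g ⟫ (shift b m φ)))
    where
    lemma : ∀ c c′ p q → c ℤ.* c′ ℤ.* p ℤ.+ c ℤ.* q ≡ c ℤ.* (c′ ℤ.* p ℤ.+ q)
    lemma = solve-∀

  ⟪⟫-* : ∀ f g φ → ⟪ f *ᵖ g ⟫ φ ≡ ⟪ f ⟫ (λ b m → ⟪ g ⟫ (shift b m φ))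
  ⟪⟫-* []                g φ = refl
  ⟪⟫-* ((c , b , m) ∷ f) g φ =
    trans (⟪⟫-++ (map (λ (c′ , b′ , m′) → c ℤ.* c′ , b ℕ.+ b′ , m ++ m′) g) (f *ᵖ g) φ)
          (cong₂ ℤ._+_ (⟪⟫-term c b m g φ) (⟪⟫-* f g φ))

  ren : (Var → Var) → Poly → Poly
  ren ρ = map λ (c , b , m) → c , b , map ρ m

  ⟪⟫-ren : ∀ ρ f φ → ⟪ ren ρ f ⟫ φ ≡ ⟪ f ⟫ (λ b m → φ b (map ρ m))
  ⟪⟫-ren ρ []                φ = refl
  ⟪⟫-ren ρ ((c , b , m) ∷ f) φ = cong (ℤ._+_ (c ℤ.* φ b (map ρ m))) (⟪⟫-ren ρ f φ)

  -- The ring of polynomials modulo the ideal spanned by the monomials in Big.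
  module Quotient (Big : Mono → Set) (big-++ : ∀ m {m′} → Big m′ → Big (m ++ m′)) where

    -- Functionals that descend to commuting variables modulo the ideal. Comparing polynomials by
    -- all of them, and not by coefficients alone, makes `*-cong` a formality: fixing one factor of
    -- a product yields a functional of the same kind in the other.
    record IsTest (φ : Functional) : Set where
      field
        resp  : ∀ b {m m′} → m ↭ m′ → φ b m ≡ φ b m′
        small : ∀ b {m} → Big m → φ b m ≡ 0ℤ
    open IsTest public

    infix 4 _≋_
    record _≋_ (f g : Poly) : Set where
      constructor mk
      field
        at : ∀ φ → IsTest φ → ⟪ f ⟫ φ ≡ ⟪ g ⟫ φ
    open _≋_ public

    shift-test : ∀ b m {φ} → IsTest φ → IsTest (shift b m φ)
    shift-test b m t .resp  b′ p   = resp t _ (Permₚ.++⁺ˡ m p)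
    shift-test b m t .small b′ big = small t _ (big-++ m big)

    pair-test : ∀ g {φ} → IsTest φ → IsTest (λ b m → ⟪ g ⟫ (shift b m φ))
    pair-test g t .resp  b p = ⟪⟫-ext g (λ b′ m′ → resp t _ (Permₚ.++⁺ʳ m′ p))
    pair-test g t .small b {m} big =
      -- `big-++` prepends a word, so the two words are exchanged first.
      trans (⟪⟫-ext g (λ b′ m′ → trans (resp t _ (Permₚ.++-comm m m′)) (small t _ (big-++ m′ big))))
            (⟪⟫-zero g)

    ≋-refl : ∀ {f} → f ≋ f
    ≋-refl .at φ t = refl

    +-cong : ∀ {f f′ g g′} → f ≋ f′ → g ≋ g′ → f +ᵖ g ≋ f′ +ᵖ g′
    +-cong {f} {f′} {g} {g′} p q .at φ t =
      trans (⟪⟫-++ f g φ) (trans (cong₂ ℤ._+_ (at p φ t) (at q φ t)) (sym (⟪⟫-++ f′ g′ φ)))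

    +-comm : ∀ f g → f +ᵖ g ≋ g +ᵖ f
    +-comm f g .at φ t = trans (⟪⟫-++ f g φ) (trans (ℤₚ.+-comm (⟪ f ⟫ φ) _) (sym (⟪⟫-++ g f φ)))

    neg-cong : ∀ {f g} → f ≋ g → -ᵖ f ≋ -ᵖ g
    neg-cong {f} {g} p .at φ t =
      trans (⟪⟫-neg f φ) (trans (cong ℤ.-_ (at p φ t)) (sym (⟪⟫-neg g φ)))

    neg-inverseʳ : ∀ f → f +ᵖ (-ᵖ f) ≋ 0ᵖ
    neg-inverseʳ f .at φ t =
      trans (⟪⟫-++ f (-ᵖ f) φ)
            (trans (cong (ℤ._+_ (⟪ f ⟫ φ)) (⟪⟫-neg f φ)) (ℤₚ.+-inverseʳ (⟪ f ⟫ φ)))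

    *-cong : ∀ {f f′ g g′} → f ≋ f′ → g ≋ g′ → f *ᵖ g ≋ f′ *ᵖ g′
    *-cong {f} {f′} {g} {g′} p q .at φ t = begin
      ⟪ f *ᵖ g ⟫ φ                         ≡⟨ ⟪⟫-* f g φ ⟩
      ⟪ f ⟫ (λ b m → ⟪ g ⟫ (shift b m φ))   ≡⟨ at p _ (pair-test g t) ⟩
      ⟪ f′ ⟫ (λ b m → ⟪ g ⟫ (shift b m φ))  ≡⟨ ⟪⟫-ext f′ (λ b m → at q _ (shift-test b m t)) ⟩
      ⟪ f′ ⟫ (λ b m → ⟪ g′ ⟫ (shift b m φ)) ≡⟨ ⟪⟫-* f′ g′ φ ⟨
      ⟪ f′ *ᵖ g′ ⟫ φ                       ∎
      where open ≡-Reasoning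

    *-assoc : ∀ f g h → (f *ᵖ g) *ᵖ h ≋ f *ᵖ (g *ᵖ h)
    *-assoc f g h .at φ t = begin
      ⟪ (f *ᵖ g) *ᵖ h ⟫ φ
        ≡⟨ ⟪⟫-* (f *ᵖ g) h φ ⟩
      ⟪ f *ᵖ g ⟫ (λ b m → ⟪ h ⟫ (shift b m φ))
        ≡⟨ ⟪⟫-* f g _ ⟩
      ⟪ f ⟫ (λ b m → ⟪ g ⟫ (λ b′ m′ → ⟪ h ⟫ (shift (b ℕ.+ b′) (m ++ m′) φ)))
        ≡⟨ ⟪⟫-ext f (λ b m → ⟪⟫-ext g (λ b′ m′ → ⟪⟫-ext h (λ b″ m″ →
             cong₂ φ (ℕₚ.+-assoc b b′ b″) (Listₚ.++-assoc m m′ m″)))) ⟩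
      ⟪ f ⟫ (λ b m → ⟪ g ⟫ (λ b′ m′ → ⟪ h ⟫ (shift b′ m′ (shift b m φ))))
        ≡⟨ ⟪⟫-ext f (λ b m → ⟪⟫-* g h (shift b m φ)) ⟨
      ⟪ f ⟫ (λ b m → ⟪ g *ᵖ h ⟫ (shift b m φ))
        ≡⟨ ⟪⟫-* f (g *ᵖ h) φ ⟨
      ⟪ f *ᵖ (g *ᵖ h) ⟫ φ ∎
      where open ≡-Reasoning

    *-comm : ∀ f g → f *ᵖ g ≋ g *ᵖ f
    *-comm f g .at φ t = begin
      ⟪ f *ᵖ g ⟫ φ
        ≡⟨ ⟪⟫-* f g φ ⟩
      ⟪ f ⟫ (λ b m → ⟪ g ⟫ (shift b m φ))
        ≡⟨ ⟪⟫-swap f g (λ b m → shift b m φ) ⟩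
      ⟪ g ⟫ (λ b′ m′ → ⟪ f ⟫ (λ b m → shift b m φ b′ m′))
        ≡⟨ ⟪⟫-ext g (λ b′ m′ → ⟪⟫-ext f (λ b m →
             trans (resp t _ (Permₚ.++-comm m m′)) (cong (λ b″ → φ b″ (m′ ++ m)) (ℕₚ.+-comm b b′)))) ⟩
      ⟪ g ⟫ (λ b′ m′ → ⟪ f ⟫ (shift b′ m′ φ))
        ≡⟨ ⟪⟫-* g f φ ⟨
      ⟪ g *ᵖ f ⟫ φ ∎
      where open ≡-Reasoning

    *-identityˡ : ∀ f → 1ᵖ *ᵖ f ≋ f
    *-identityˡ f .at φ t =
      trans (⟪⟫-* 1ᵖ f φ) (trans (ℤₚ.+-identityʳ _) (ℤₚ.*-identityˡ (⟪ f ⟫ φ)))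

    *-distribʳ : ∀ f g h → (g +ᵖ h) *ᵖ f ≋ g *ᵖ f +ᵖ h *ᵖ f
    *-distribʳ f g h .at φ t = cong (λ k → ⟪ k ⟫ φ) (Listₚ.cartesianProductWith-distribʳ-++ _ g h f)

    ≋-trans : ∀ {f g h} → f ≋ g → g ≋ h → f ≋ h
    ≋-trans p q .at φ t = trans (at p φ t) (at q φ t)

    commutativeRing : CommutativeRing 0ℓ 0ℓ
    commutativeRing = record
      { Carrier = Poly ; _≈_ = _≋_ ; _+_ = _+ᵖ_ ; _*_ = _*ᵖ_ ; -_ = -ᵖ_ ; 0# = 0ᵖ ; 1# = 1ᵖ
      ; isCommutativeRing = record
        { isRing = record
          { +-isAbelianGroup = record
            { isGroup = record
              { isMonoid = record
                { isSemigroup = record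
                  { isMagma = record
                    { isEquivalence = record
                      { refl  = ≋-refl
                      ; sym   = λ p → mk λ φ t → sym (at p φ t)
                      ; trans = ≋-trans
                      }
                    ; ∙-cong = +-cong
                    }
                  ; assoc = λ f g h → mk λ φ t → cong (λ k → ⟪ k ⟫ φ) (Listₚ.++-assoc f g h)
                  }
                ; identity = (λ f → ≋-refl) , λ f → mk λ φ t → cong (λ k → ⟪ k ⟫ φ) (Listₚ.++-identityʳ f)
                }
              ; inverse = (λ f → ≋-trans (+-comm (-ᵖ f) f) (neg-inverseʳ f)) , neg-inverseʳ
              ; ⁻¹-cong = neg-cong
              }
            ; comm = +-comm
            }
          ; *-cong = *-cong
          ; *-assoc = *-assoc
          ; *-identity = *-identityˡ , λ f → ≋-trans (*-comm f 1ᵖ) (*-identityˡ f)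
          ; distrib = (λ f g h → ≋-trans (*-comm f (g +ᵖ h)) (≋-trans (*-distribʳ f g h)
                                   (+-cong (*-comm g f) (*-comm h f))))
                    , *-distribʳ
          }
        ; *-comm = *-comm
        }
      }

-- The polynomial ring: coefficients, regular elements and division by xᵢ - xᵢ₊₁.

module PolynomialRing where

  open import Defs
  open Functionals
  open import Data.Empty using (⊥)
  open import Data.Bool using (true; false; if_then_else_)
  open import Data.Integer as ℤ using (ℤ; 0ℤ; 1ℤ)
  import Data.Integer.Properties as ℤₚ
  open import Data.Integer.Tactic.RingSolver using (solve-∀)
  open import Data.List using (List; []; _∷_; _++_; map; filter; length; replicate; foldr)
  import Data.List.Properties as Listₚ
  open import Data.List.Relation.Unary.All as All using (All; []; _∷_)
  import Data.List.Relation.Unary.All.Properties as Allₚ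
  open import Data.List.Relation.Unary.Any as Any using (Any; here; there)
  import Data.List.Relation.Unary.Any.Properties as Anyₚ
  open import Data.List.Membership.Propositional using (_∈_; find)
  open import Data.List.Relation.Binary.Permutation.Propositional as Perm using (_↭_; ↭-refl; ↭-sym; ↭-trans; prep; swap)
  import Data.List.Relation.Binary.Permutation.Propositional.Properties as Permₚ
  open import Data.Nat as ℕ using (ℕ; zero; suc)
  import Data.Nat.Properties as ℕₚ
  open import Data.Product using (_×_; _,_)
  open import Function using (_∘_; id)
  open import Relation.Nullary using (¬_; Dec; yes; no; does; _×-dec_; contradiction; ¬?)
  open import Relation.Nullary.Decidable using (does-⇔; dec-false)
  open import Function.Bundles using (mk⇔)
  open import Relation.Binary.PropositionalEquality using (_≡_; _≢_; refl; sym; trans; cong; cong₂; module ≡-Reasoning)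

  exponent-↭ : ∀ v {m m′} → m ↭ m′ → exponent v m ≡ exponent v m′
  exponent-↭ v p = Permₚ.↭-length (Permₚ.filter-↭ (v ≟ⱽ_) p)

  exponent-yes : ∀ v m → exponent v (v ∷ m) ≡ suc (exponent v m)
  exponent-yes v m = cong length (Listₚ.filter-accept (v ≟ⱽ_) refl)

  exponent-no : ∀ {v w} m → v ≢ w → exponent v (w ∷ m) ≡ exponent v m
  exponent-no {v} m v≢w = cong length (Listₚ.filter-reject (v ≟ⱽ_) v≢w)

  exponent-∈ : ∀ {v m} → v ∈ m → exponent v m ≢ 0
  exponent-∈ {v} {w ∷ m} (here refl) eq = contradiction (trans (sym (exponent-yes v m)) eq) λ ()
  exponent-∈ {v} {w ∷ m} (there p)   eq with v ≟ⱽ w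
  ... | yes refl = contradiction eq λ ()
  ... | no v≢w   = exponent-∈ p eq

  exponent-∉ : ∀ {v} m → exponent v m ≢ 0 → v ∈ m
  exponent-∉ []      ne = contradiction refl ne
  exponent-∉ {v} (w ∷ m) ne with v ≟ⱽ w
  ... | yes refl = here refl
  ... | no v≢w   = there (exponent-∉ m ne)

  -- `≈ᴹ` tests only the variables that occur in one of the words; every other variable has exponent
  -- 0 in both.
  ≈ᴹ⇒exponents : ∀ m m′ → m ≈ᴹ m′ → ∀ v → exponent v m ≡ exponent v m′
  ≈ᴹ⇒exponents m m′ p v with exponent v m ℕ.≟ 0 | exponent v m′ ℕ.≟ 0
  ... | yes e | yes e′ = trans e (sym e′)
  ... | no ne | _      = All.lookup (Allₚ.++⁻ˡ m p) (exponent-∉ m ne)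
  ... | _     | no ne  = All.lookup (Allₚ.++⁻ʳ m p) (exponent-∉ m′ ne)

  indicator : ℕ → Mono → Functional
  indicator b m b′ m′ = if does ((b′ ℕ.≟ b) ×-dec (m′ ≈ᴹ? m)) then 1ℤ else 0ℤ

  coeff-⟪⟫ : ∀ f m b → coeff f m b ≡ ⟪ f ⟫ (indicator b m)
  coeff-⟪⟫ []                  m b = refl
  coeff-⟪⟫ ((c , b′ , m′) ∷ f) m b with does ((b′ ℕ.≟ b) ×-dec (m′ ≈ᴹ? m))
  ... | true  = cong₂ ℤ._+_ (sym (ℤₚ.*-identityʳ c)) (coeff-⟪⟫ f m b)
  ... | false = trans (coeff-⟪⟫ f m b)
                      (trans (sym (ℤₚ.+-identityˡ _)) (cong (λ e → e ℤ.+ ⟪ f ⟫ (indicator b m)) (sym (ℤₚ.*-zeroʳ c))))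

  indicator-resp : ∀ b m b′ {m₁ m₂} → m₁ ↭ m₂ → indicator b m b′ m₁ ≡ indicator b m b′ m₂
  indicator-resp b m b′ {m₁} {m₂} p =
    cong (λ d → if d then 1ℤ else 0ℤ)
      (does-⇔ (mk⇔ (λ (e , q) → e , transport (↭-sym p) q) (λ (e , q) → e , transport p q))
              ((b′ ℕ.≟ b) ×-dec (m₁ ≈ᴹ? m)) ((b′ ℕ.≟ b) ×-dec (m₂ ≈ᴹ? m)))
    where
    transport : ∀ {m₁ m₂} → m₁ ↭ m₂ → m₂ ≈ᴹ m → m₁ ≈ᴹ m
    transport {m₁} {m₂} p q = All.universal (λ v → trans (exponent-↭ v p) (≈ᴹ⇒exponents m₂ m q v)) (m₁ ++ m)

  index : Var → ℕ
  index x[ i ] = i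
  index y[ i ] = i

  Exceeds : ℕ → Mono → Set
  Exceeds M = Any λ v → M ℕ.< index v

  -- A variable of index above M occurs in `m′` but not in `m`. Hence setting the variables of index
  -- above M to zero does not affect the coefficient of `m`.
  indicator-small : ∀ {M} b m b′ {m′} → All (λ v → index v ℕ.≤ M) m → Exceeds M m′ → indicator b m b′ m′ ≡ 0ℤ
  indicator-small b m b′ {m′} bound big =
    cong (λ d → if d then 1ℤ else 0ℤ) (dec-false ((b′ ℕ.≟ b) ×-dec (m′ ≈ᴹ? m)) differ)
    where
    differ : ¬ (b′ ≡ b × m′ ≈ᴹ m)
    differ (_ , q) with find big
    ... | v , v∈m′ , M<v = contradiction
      (All.lookup bound (exponent-∉ {v} m (λ e → exponent-∈ v∈m′ (trans (≈ᴹ⇒exponents m′ m q v) e)))) (ℕₚ.<⇒≱ M<v)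

  module Truncated (M : ℕ) where
    open Quotient (Exceeds M) (λ m → Anyₚ.++⁺ʳ m) public

    coeff-cong : ∀ {f g} m → All (λ v → index v ℕ.≤ M) m → f ≋ g → ∀ b → coeff f m b ≡ coeff g m b
    coeff-cong {f} {g} m bound p b =
      trans (coeff-⟪⟫ f m b)
            (trans (at p _ record { resp = indicator-resp b m ; small = λ b′ → indicator-small b m b′ bound })
                   (sym (coeff-⟪⟫ g m b)))

    var-small : ∀ v → M ℕ.< index v → var v ≋ 0ᵖ
    var-small v M<v .at φ t =
      trans (ℤₚ.+-identityʳ _) (trans (ℤₚ.*-identityˡ _) (small t 0 (here M<v)))

  -- No monomial is killed in this instance, so it is the polynomial ring itself.
  open Quotient (λ _ → ⊥) (λ _ ()) public

  test : ∀ {φ} → (∀ b {m m′} → m ↭ m′ → φ b m ≡ φ b m′) → IsTest φ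
  test r = record { resp = r ; small = λ _ () }

  coeff-≋ : ∀ {f g} → f ≋ g → ∀ m b → coeff f m b ≡ coeff g m b
  coeff-≋ {f} {g} p m b =
    trans (coeff-⟪⟫ f m b) (trans (at p _ (test (indicator-resp b m))) (sym (coeff-⟪⟫ g m b)))

  ren-cong : ∀ ρ {f g} → f ≋ g → ren ρ f ≋ ren ρ g
  ren-cong ρ {f} {g} p .at φ t =
    trans (⟪⟫-ren ρ f φ) (trans (at p _ (test λ b q → resp t b (Permₚ.map⁺ (ρ) q))) (sym (⟪⟫-ren ρ g φ)))

  ren-+ : ∀ ρ f g → ren ρ (f +ᵖ g) ≋ ren ρ f +ᵖ ren ρ g
  ren-+ ρ f g .at φ t = cong (λ h → ⟪ h ⟫ φ) (Listₚ.map-++ _ f g)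

  ren-* : ∀ ρ f g → ren ρ (f *ᵖ g) ≋ ren ρ f *ᵖ ren ρ g
  ren-* ρ f g .at φ t = begin
    ⟪ ren ρ (f *ᵖ g) ⟫ φ                                                     ≡⟨ ⟪⟫-ren ρ (f *ᵖ g) φ ⟩
    ⟪ f *ᵖ g ⟫ (λ b m → φ b (map ρ m))                                       ≡⟨ ⟪⟫-* f g _ ⟩
    ⟪ f ⟫ (λ b m → ⟪ g ⟫ (λ b′ m′ → φ (b ℕ.+ b′) (map ρ (m ++ m′))))
      ≡⟨ ⟪⟫-ext f (λ b m → ⟪⟫-ext g (λ b′ m′ → cong (φ (b ℕ.+ b′)) (Listₚ.map-++ ρ m m′))) ⟩
    ⟪ f ⟫ (λ b m → ⟪ g ⟫ (λ b′ m′ → φ (b ℕ.+ b′) (map ρ m ++ map ρ m′)))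
      ≡⟨ ⟪⟫-ext f (λ b m → ⟪⟫-ren ρ g _) ⟨
    ⟪ f ⟫ (λ b m → ⟪ ren ρ g ⟫ (shift b (map ρ m) φ))                         ≡⟨ ⟪⟫-ren ρ f _ ⟨
    ⟪ ren ρ f ⟫ (λ b m → ⟪ ren ρ g ⟫ (shift b m φ))                           ≡⟨ ⟪⟫-* (ren ρ f) (ren ρ g) φ ⟨
    ⟪ ren ρ f *ᵖ ren ρ g ⟫ φ                                                  ∎
    where open ≡-Reasoning

  ren-∘ : ∀ ρ σ f → ren ρ (ren σ f) ≋ ren (ρ ∘ σ) f
  ren-∘ ρ σ f .at φ t =
    trans (⟪⟫-ren ρ (ren σ f) φ) (trans (⟪⟫-ren σ f _) (trans
      (⟪⟫-ext f (λ b m → cong (φ b) (sym (Listₚ.map-∘ m)))) (sym (⟪⟫-ren (ρ ∘ σ) f φ))))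

  ren-ext : ∀ {ρ σ} → (∀ v → ρ v ≡ σ v) → ∀ f → ren ρ f ≋ ren σ f
  ren-ext {ρ} {σ} eq f .at φ t =
    trans (⟪⟫-ren ρ f φ) (trans (⟪⟫-ext f (λ b m → cong (φ b) (Listₚ.map-cong eq m))) (sym (⟪⟫-ren σ f φ)))

  ren-id : ∀ f → ren id f ≋ f
  ren-id f .at φ t = trans (⟪⟫-ren id f φ) (⟪⟫-ext f (λ b m → cong (φ b) (Listₚ.map-id m)))

  ⟪⟫-var : ∀ v f φ → ⟪ var v *ᵖ f ⟫ φ ≡ ⟪ f ⟫ (λ b m → φ b (v ∷ m))
  ⟪⟫-var v f φ = trans (⟪⟫-* (var v) f φ) (trans (ℤₚ.+-identityʳ _) (ℤₚ.*-identityˡ _))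

  -- Multiplication by x_i − x_j is injective because its transpose is
  -- surjective: a preimage of ψ is found by recursion on the exponent of x_i.
  module _ {v w : Var} (v≢w : v ≢ w) where

    private
      others? : ∀ u → Dec (v ≢ u × w ≢ u)
      others? u = ¬? (v ≟ⱽ u) ×-dec ¬? (w ≟ⱽ u)

      others : Mono → Mono
      others = filter others?

      split₂ : ∀ m → m ↭ replicate (exponent v m) v ++ (replicate (exponent w m) w ++ others m)
      split₂ [] = ↭-refl
      split₂ (u ∷ m) with v ≟ⱽ u | w ≟ⱽ u
      ... | yes refl | yes refl = contradiction refl v≢w
      ... | yes refl | no  w≢u  = prep v (split₂ m)
      ... | no  v≢u  | yes refl =
        ↭-trans (prep w (split₂ m)) (↭-sym (Permₚ.shift w (replicate (exponent v m) v) _))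
      ... | no  v≢u  | no  w≢u  =
        ↭-trans (prep u (split₂ m))
          (↭-trans (↭-sym (Permₚ.shift u (replicate (exponent v m) v) _))
                   (Permₚ.++⁺ˡ (replicate (exponent v m) v) (↭-sym (Permₚ.shift u (replicate (exponent w m) w) _))))

      -- `a` and `c` are the exponents of v and w. The value 0 at a = 0 is a free choice, and each
      -- step trades a v for a w.
      antidifference : Functional → ℕ → ℕ → ℕ → Mono → ℤ
      antidifference ψ b zero    c m = 0ℤ
      antidifference ψ b (suc a) c m =
        antidifference ψ b a (suc c) m ℤ.+ ψ b (replicate a v ++ (replicate c w ++ m))

      antidifference-resp : ∀ {ψ} → IsTest ψ → ∀ b a c {m m′} → m ↭ m′ →
                            antidifference ψ b a c m ≡ antidifference ψ b a c m′
      antidifference-resp t b zero    c p = refl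
      antidifference-resp t b (suc a) c p = cong₂ ℤ._+_ (antidifference-resp t b a (suc c) p)
        (resp t b (Permₚ.++⁺ˡ (replicate a v) (Permₚ.++⁺ˡ (replicate c w) p)))

    var-difference-cancel : ∀ f → (var v -ᵖ var w) *ᵖ f ≋ 0ᵖ → f ≋ 0ᵖ
    var-difference-cancel f p .at ψ t = begin
      ⟪ f ⟫ ψ                             ≡⟨ ⟪⟫-ext f solves ⟩
      ⟪ f ⟫ (λ b m → ℤ.- 1ℤ ℤ.* φ b (w ∷ m) ℤ.+ φ b (v ∷ m)) ≡⟨ ⟪⟫-linear f (ℤ.- 1ℤ) _ _ ⟩
      ℤ.- 1ℤ ℤ.* ⟪ f ⟫ (λ b m → φ b (w ∷ m)) ℤ.+ ⟪ f ⟫ (λ b m → φ b (v ∷ m))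
        ≡⟨ lemma (⟪ f ⟫ (λ b m → φ b (w ∷ m))) (⟪ f ⟫ (λ b m → φ b (v ∷ m))) ⟩
      1ℤ ℤ.* ⟪ f ⟫ (λ b m → φ b (v ∷ m)) ℤ.+ (ℤ.- 1ℤ ℤ.* ⟪ f ⟫ (λ b m → φ b (w ∷ m)) ℤ.+ 0ℤ)
        ≡⟨ ⟪⟫-* (var v -ᵖ var w) f φ ⟨
      ⟪ (var v -ᵖ var w) *ᵖ f ⟫ φ         ≡⟨ at p φ φ-test ⟩
      0ℤ                                  ∎
      where
      open ≡-Reasoning
      φ : Functional
      φ b m = antidifference ψ b (exponent v m) (exponent w m) (others m)
      φ-test : IsTest φ
      φ-test = test λ b {m} {m′} q → trans
        (cong₂ (λ a c → antidifference ψ b a c (others m)) (exponent-↭ v q) (exponent-↭ w q))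
        (antidifference-resp t b (exponent v m′) (exponent w m′) (Permₚ.filter-↭ others? q))
      lemma : ∀ p q → ℤ.- 1ℤ ℤ.* p ℤ.+ q ≡ 1ℤ ℤ.* q ℤ.+ (ℤ.- 1ℤ ℤ.* p ℤ.+ 0ℤ)
      lemma = solve-∀
      lemma₂ : ∀ p q → q ≡ ℤ.- 1ℤ ℤ.* p ℤ.+ (p ℤ.+ q)
      lemma₂ = solve-∀
      others-v : ∀ m → others (v ∷ m) ≡ others m
      others-v m = Listₚ.filter-reject others? (λ (n , _) → n refl)
      others-w : ∀ m → others (w ∷ m) ≡ others m
      others-w m = Listₚ.filter-reject others? (λ (_ , n) → n refl)
      φ-v : ∀ b m → φ b (v ∷ m) ≡ antidifference ψ b (suc (exponent v m)) (exponent w m) (others m)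
      φ-v b m rewrite exponent-yes v m | exponent-no m (v≢w ∘ sym) | others-v m = refl
      φ-w : ∀ b m → φ b (w ∷ m) ≡ antidifference ψ b (exponent v m) (suc (exponent w m)) (others m)
      φ-w b m rewrite exponent-yes w m | exponent-no m v≢w | others-w m = refl
      solves : ∀ b m → ψ b m ≡ ℤ.- 1ℤ ℤ.* φ b (w ∷ m) ℤ.+ φ b (v ∷ m)
      solves b m = begin
        ψ b m ≡⟨ resp t b (split₂ m) ⟩
        ψ b (replicate (exponent v m) v ++ (replicate (exponent w m) w ++ others m))
          ≡⟨ lemma₂ (antidifference ψ b (exponent v m) (suc (exponent w m)) (others m)) _ ⟩
        _ ≡⟨ cong₂ (λ p q → ℤ.- 1ℤ ℤ.* p ℤ.+ q) (φ-w b m) (φ-v b m) ⟨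
        ℤ.- 1ℤ ℤ.* φ b (w ∷ m) ℤ.+ φ b (v ∷ m) ∎

  -- The same for 1 + β v, with recursion on the exponent of β.
  module _ (v : Var) where

    private
      others? : ∀ u → Dec (v ≢ u)
      others? u = ¬? (v ≟ⱽ u)

      others : Mono → Mono
      others = filter others?

      split₁ : ∀ m → m ↭ replicate (exponent v m) v ++ others m
      split₁ [] = ↭-refl
      split₁ (u ∷ m) with v ≟ⱽ u
      ... | yes refl = prep v (split₁ m)
      ... | no  v≢u  =
        ↭-trans (prep u (split₁ m)) (↭-sym (Permₚ.shift u (replicate (exponent v m) v) _))

      -- `b` and `a` are the exponents of β and v. The value on monomials not divisible by β v is a
      -- free choice, here 0.
      antisum : Functional → ℕ → ℕ → Mono → ℤ
      antisum ψ zero    a       m = 0ℤ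
      antisum ψ (suc b) zero    m = 0ℤ
      antisum ψ (suc b) (suc a) m = ψ b (replicate a v ++ m) ℤ.- antisum ψ b a m

      antisum-resp : ∀ {ψ} → IsTest ψ → ∀ b a {m m′} → m ↭ m′ → antisum ψ b a m ≡ antisum ψ b a m′
      antisum-resp t zero    a       p = refl
      antisum-resp t (suc b) zero    p = refl
      antisum-resp t (suc b) (suc a) p =
        cong₂ ℤ._-_ (resp t b (Permₚ.++⁺ˡ (replicate a v) p)) (antisum-resp t b a p)

    1+β-cancel : ∀ f → (1ᵖ +ᵖ β *ᵖ var v) *ᵖ f ≋ 0ᵖ → f ≋ 0ᵖ
    1+β-cancel f p .at ψ t = begin
      ⟪ f ⟫ ψ                             ≡⟨ ⟪⟫-ext f solves ⟩
      ⟪ f ⟫ (λ b m → 1ℤ ℤ.* φ b m ℤ.+ φ (suc b) (v ∷ m)) ≡⟨ ⟪⟫-linear f 1ℤ _ _ ⟩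
      1ℤ ℤ.* ⟪ f ⟫ φ ℤ.+ ⟪ f ⟫ (λ b m → φ (suc b) (v ∷ m))
        ≡⟨ lemma (⟪ f ⟫ φ) (⟪ f ⟫ (λ b m → φ (suc b) (v ∷ m))) ⟩
      1ℤ ℤ.* ⟪ f ⟫ φ ℤ.+ (1ℤ ℤ.* ⟪ f ⟫ (λ b m → φ (suc b) (v ∷ m)) ℤ.+ 0ℤ)
        ≡⟨ ⟪⟫-* (1ᵖ +ᵖ β *ᵖ var v) f φ ⟨
      ⟪ (1ᵖ +ᵖ β *ᵖ var v) *ᵖ f ⟫ φ       ≡⟨ at p φ φ-test ⟩
      0ℤ                                  ∎
      where
      open ≡-Reasoning
      φ : Functional
      φ b m = antisum ψ b (exponent v m) (others m)
      φ-test : IsTest φ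
      φ-test = test λ b {m} {m′} q → trans
        (cong (λ a → antisum ψ b a (others m)) (exponent-↭ v q))
        (antisum-resp t b (exponent v m′) (Permₚ.filter-↭ others? q))
      lemma : ∀ p q → 1ℤ ℤ.* p ℤ.+ q ≡ 1ℤ ℤ.* p ℤ.+ (1ℤ ℤ.* q ℤ.+ 0ℤ)
      lemma = solve-∀
      lemma₂ : ∀ p q → q ≡ 1ℤ ℤ.* p ℤ.+ (q ℤ.- p)
      lemma₂ = solve-∀
      φ-v : ∀ b m → φ (suc b) (v ∷ m) ≡ ψ b (replicate (exponent v m) v ++ others m) ℤ.- φ b m
      φ-v b m rewrite exponent-yes v m | Listₚ.filter-reject others? {v} {m} (λ n → n refl) = refl
      solves : ∀ b m → ψ b m ≡ 1ℤ ℤ.* φ b m ℤ.+ φ (suc b) (v ∷ m)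
      solves b m = begin
        ψ b m ≡⟨ resp t b (split₁ m) ⟩
        ψ b (replicate (exponent v m) v ++ others m)
          ≡⟨ lemma₂ (φ b m) _ ⟩
        _ ≡⟨ cong (λ q → 1ℤ ℤ.* φ b m ℤ.+ q) (φ-v b m) ⟨
        1ℤ ℤ.* φ b m ℤ.+ φ (suc b) (v ∷ m) ∎

  merge : ℕ → Var → Var
  merge i v with v ≟ⱽ x[ i ]
  ... | yes _ = x[ suc i ]
  ... | no _  = v

  Σᴹ : List Mono → (Mono → ℤ) → ℤ
  Σᴹ ms φ = foldr (λ m → ℤ._+_ (φ m)) 0ℤ ms

  ⟪⟫-quotient : ∀ f i φ → ⟪ f /[x i -x₊₁] ⟫ φ ≡ ⟪ f ⟫ (λ b m → Σᴹ (quotᴹ i m) (φ b))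
  ⟪⟫-quotient []                i φ = refl
  ⟪⟫-quotient ((c , b , m) ∷ f) i φ =
    trans (⟪⟫-++ (map (λ q → c , b , q) (quotᴹ i m)) _ φ) (cong₂ ℤ._+_ (terms (quotᴹ i m)) (⟪⟫-quotient f i φ))
    where
    terms : ∀ qs → ⟪ map (λ q → c , b , q) qs ⟫ φ ≡ c ℤ.* Σᴹ qs (φ b)
    terms []       = sym (ℤₚ.*-zeroʳ c)
    terms (q ∷ qs) = trans (cong (ℤ._+_ (c ℤ.* φ b q)) (terms qs)) (sym (ℤₚ.*-distribˡ-+ c (φ b q) _))

  Σᴹ-map : ∀ (g : Mono → Mono) ms φ → Σᴹ (map g ms) φ ≡ Σᴹ ms (φ ∘ g)
  Σᴹ-map g []       φ = refl
  Σᴹ-map g (m ∷ ms) φ = cong (ℤ._+_ (φ (g m))) (Σᴹ-map g ms φ)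

  Σᴹ-ext : ∀ ms {φ ψ} → (∀ m → φ m ≡ ψ m) → Σᴹ ms φ ≡ Σᴹ ms ψ
  Σᴹ-ext []       eq = refl
  Σᴹ-ext (m ∷ ms) eq = cong₂ ℤ._+_ (eq m) (Σᴹ-ext ms eq)

  -- The division identity for words, read through a functional. The induction runs over all φ,
  -- because each letter is absorbed into φ before the hypothesis is applied to the rest of the
  -- word.
  quotᴹ-telescopes : ∀ i m (φ : Mono → ℤ) → (∀ {m m′} → m ↭ m′ → φ m ≡ φ m′) →
    Σᴹ (quotᴹ i m) (λ q → φ (x[ i ] ∷ q)) ≡
    Σᴹ (quotᴹ i m) (λ q → φ (x[ suc i ] ∷ q)) ℤ.+ (φ m ℤ.- φ (map (merge i) m))
  quotᴹ-telescopes i []      φ r = lemma (φ [])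
    where
    lemma : ∀ p → 0ℤ ≡ 0ℤ ℤ.+ (p ℤ.- p)
    lemma = solve-∀
  quotᴹ-telescopes i (v ∷ m) φ r with v ≟ⱽ x[ i ]
  ... | yes refl
    rewrite Σᴹ-map (x[ suc i ] ∷_) (quotᴹ i m) (λ q → φ (x[ i ] ∷ q))
          | Σᴹ-map (x[ suc i ] ∷_) (quotᴹ i m) (λ q → φ (x[ suc i ] ∷ q))
          | Σᴹ-ext (quotᴹ i m) {λ q → φ (x[ i ] ∷ x[ suc i ] ∷ q)} {λ q → φ (x[ suc i ] ∷ x[ i ] ∷ q)}
                   (λ q → r (swap _ _ ↭-refl))
          | quotᴹ-telescopes i m (λ q → φ (x[ suc i ] ∷ q)) (λ p → r (prep _ p))
    = lemma (φ (x[ i ] ∷ m)) (Σᴹ (quotᴹ i m) (λ q → φ (x[ suc i ] ∷ x[ suc i ] ∷ q)))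
            (φ (x[ suc i ] ∷ m)) (φ (x[ suc i ] ∷ map (merge i) m))
    where
    lemma : ∀ p q r t → p ℤ.+ (q ℤ.+ (r ℤ.- t)) ≡ (r ℤ.+ q) ℤ.+ (p ℤ.- t)
    lemma = solve-∀
  ... | no _
    rewrite Σᴹ-map (v ∷_) (quotᴹ i m) (λ q → φ (x[ i ] ∷ q))
          | Σᴹ-map (v ∷_) (quotᴹ i m) (λ q → φ (x[ suc i ] ∷ q))
          | Σᴹ-ext (quotᴹ i m) {λ q → φ (x[ i ] ∷ v ∷ q)} {λ q → φ (v ∷ x[ i ] ∷ q)} (λ q → r (swap _ _ ↭-refl))
          | Σᴹ-ext (quotᴹ i m) {λ q → φ (x[ suc i ] ∷ v ∷ q)} {λ q → φ (v ∷ x[ suc i ] ∷ q)} (λ q → r (swap _ _ ↭-refl))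
    = quotᴹ-telescopes i m (λ q → φ (v ∷ q)) (λ p → r (prep _ p))

  quotient-spec : ∀ i f → X i *ᵖ (f /[x i -x₊₁]) ≋ X (suc i) *ᵖ (f /[x i -x₊₁]) +ᵖ (f -ᵖ ren (merge i) f)
  quotient-spec i f .at φ t = begin
    ⟪ X i *ᵖ Q ⟫ φ                                              ≡⟨ ⟪⟫-var x[ i ] Q φ ⟩
    ⟪ Q ⟫ (λ b m → φ b (x[ i ] ∷ m))                            ≡⟨ ⟪⟫-quotient f i _ ⟩
    ⟪ f ⟫ (λ b m → Σᴹ (quotᴹ i m) (λ q → φ b (x[ i ] ∷ q)))
      ≡⟨ ⟪⟫-ext f (λ b m → trans (quotᴹ-telescopes i m (φ b) (resp t b)) (lemma (S b m) (φ b m) (φ b (map (merge i) m)))) ⟩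
    ⟪ f ⟫ (λ b m → 1ℤ ℤ.* S b m ℤ.+ (ℤ.- 1ℤ ℤ.* φ b (map (merge i) m) ℤ.+ φ b m))
      ≡⟨ trans (⟪⟫-linear f 1ℤ _ _) (cong (ℤ._+_ (1ℤ ℤ.* ⟪ f ⟫ S)) (⟪⟫-linear f (ℤ.- 1ℤ) _ _)) ⟩
    1ℤ ℤ.* ⟪ f ⟫ S ℤ.+ (ℤ.- 1ℤ ℤ.* ⟪ f ⟫ (λ b m → φ b (map (merge i) m)) ℤ.+ ⟪ f ⟫ φ)
      ≡⟨ lemma (⟪ f ⟫ S) (⟪ f ⟫ φ) _ ⟨
    ⟪ f ⟫ S ℤ.+ (⟪ f ⟫ φ ℤ.+ ℤ.- ⟪ f ⟫ (λ b m → φ b (map (merge i) m)))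
      ≡⟨ cong₂ ℤ._+_ (trans (⟪⟫-var x[ suc i ] Q φ) (⟪⟫-quotient f i _))
                     (trans (⟪⟫-++ f (-ᵖ ren (merge i) f) φ)
                       (cong (ℤ._+_ (⟪ f ⟫ φ)) (trans (⟪⟫-neg (ren (merge i) f) φ) (cong ℤ.-_ (⟪⟫-ren (merge i) f φ))))) ⟨
    ⟪ X (suc i) *ᵖ Q ⟫ φ ℤ.+ ⟪ f -ᵖ ren (merge i) f ⟫ φ          ≡⟨ ⟪⟫-++ (X (suc i) *ᵖ Q) _ φ ⟨
    ⟪ X (suc i) *ᵖ Q +ᵖ (f -ᵖ ren (merge i) f) ⟫ φ               ∎
    where
    open ≡-Reasoning
    Q = f /[x i -x₊₁]
    S : Functional
    S b m = Σᴹ (quotᴹ i m) (λ q → φ b (x[ suc i ] ∷ q))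
    lemma : ∀ p q r → p ℤ.+ (q ℤ.- r) ≡ 1ℤ ℤ.* p ℤ.+ (ℤ.- 1ℤ ℤ.* r ℤ.+ q)
    lemma = solve-∀

-- A ring solver with integer coefficients over any commutative ring.

module IntegerCoefficients where

  open import Level using (0ℓ)
  open import Algebra.Bundles using (CommutativeRing; RawRing)
  import Algebra.Solver.Ring as RingSolver
  open import Algebra.Solver.Ring.AlmostCommutativeRing using (fromCommutativeRing; _-Raw-AlmostCommutative⟶_)
  import Data.Integer.Properties as ℤₚ
  open import Data.Integer as ℤ using (ℤ; +_; -[1+_]; _⊖_)
  open import Data.Maybe using (Maybe; just; nothing)
  open import Data.Nat as ℕ using (ℕ; zero; suc)
  import Data.Nat.Properties as ℕₚ
  open import Relation.Nullary using (yes; no)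
  open import Relation.Binary.PropositionalEquality as ≡ using (_≡_)

  ℤ-raw : RawRing 0ℓ 0ℓ
  ℤ-raw = CommutativeRing.rawRing ℤₚ.+-*-commutativeRing

  -- Equality in R is not decidable here, but equality of integers is; taking the constants from ℤ
  -- lets the solver recognize that coefficients cancel.
  module Solver (R : CommutativeRing 0ℓ 0ℓ) where
    open CommutativeRing R hiding (zero)
    open import Algebra.Properties.Semiring.Mult.TCOptimised semiring using (_×_; 1+×; ×-homo-+; ×1-homo-*)
    open import Algebra.Properties.Ring ring using (-0#≈0#; -‿+-comm; -‿distribˡ-*; -‿distribʳ-*; -‿involutive)
    open import Relation.Binary.Reasoning.Setoid setoid

    private
      nat : ℕ → Carrier
      nat n = n × 1#

      int : ℤ → Carrier
      int (+ n)    = nat n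
      int -[1+ n ] = - nat (suc n)

      int-⊖ : ∀ m n → int (m ⊖ n) ≈ nat m - nat n
      int-⊖ m       zero    = sym (trans (+-congˡ -0#≈0#) (+-identityʳ _))
      int-⊖ zero    (suc n) = sym (+-identityˡ _)
      int-⊖ (suc m) (suc n) = begin
        int (suc m ⊖ suc n)             ≡⟨ ≡.cong int (ℤₚ.[1+m]⊖[1+n]≡m⊖n m n) ⟩
        int (m ⊖ n)                     ≈⟨ int-⊖ m n ⟩
        nat m - nat n                   ≈⟨ +-identityˡ _ ⟨
        0# + (nat m - nat n)            ≈⟨ +-congʳ (-‿inverseʳ 1#) ⟨
        (1# - 1#) + (nat m - nat n)     ≈⟨ +-assoc _ _ _ ⟩
        1# + (- 1# + (nat m - nat n))   ≈⟨ +-congˡ (trans (sym (+-assoc _ _ _))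
                                             (trans (+-congʳ (+-comm _ _)) (+-assoc _ _ _))) ⟩
        1# + (nat m + (- 1# - nat n))   ≈⟨ +-assoc _ _ _ ⟨
        (1# + nat m) + (- 1# - nat n)   ≈⟨ +-cong (1+× m 1#) (trans (-‿cong (1+× n 1#)) (sym (-‿+-comm 1# (nat n)))) ⟨
        nat (suc m) - nat (suc n)       ∎

      int-+ : ∀ i j → int (i ℤ.+ j) ≈ int i + int j
      int-+ (+ m)    (+ n)    = ×-homo-+ 1# m n
      int-+ (+ m)    -[1+ n ] = int-⊖ m (suc n)
      int-+ -[1+ m ] (+ n)    = trans (int-⊖ n (suc m)) (+-comm _ _)
      int-+ -[1+ m ] -[1+ n ] = begin
        - nat (suc (suc (m ℕ.+ n)))     ≡⟨ ≡.cong (λ k → - nat (suc k)) (ℕₚ.+-suc m n) ⟨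
        - nat (suc m ℕ.+ suc n)         ≈⟨ -‿cong (×-homo-+ 1# (suc m) (suc n)) ⟩
        - (nat (suc m) + nat (suc n))   ≈⟨ -‿+-comm _ _ ⟨
        - nat (suc m) - nat (suc n)     ∎

      int-neg : ∀ i → int (ℤ.- i) ≈ - int i
      int-neg (+ zero)  = sym -0#≈0#
      int-neg (+ suc n) = refl
      int-neg -[1+ n ]  = sym (-‿involutive _)

      int-*⁺ : ∀ m j → int (+ m ℤ.* j) ≈ nat m * int j
      int-*⁺ m (+ n)    = trans (reflexive (≡.cong int (≡.sym (ℤₚ.pos-* m n)))) (×1-homo-* m n)
      int-*⁺ m -[1+ n ] = begin
        int (+ m ℤ.* ℤ.- + suc n)       ≡⟨ ≡.cong int (ℤₚ.neg-distribʳ-* (+ m) (+ suc n)) ⟨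
        int (ℤ.- (+ m ℤ.* + suc n))     ≈⟨ int-neg (+ m ℤ.* + suc n) ⟩
        - int (+ m ℤ.* + suc n)         ≈⟨ -‿cong (int-*⁺ m (+ suc n)) ⟩
        - (nat m * nat (suc n))         ≈⟨ -‿distribʳ-* _ _ ⟩
        nat m * - nat (suc n)           ∎

      int-* : ∀ i j → int (i ℤ.* j) ≈ int i * int j
      int-* (+ m)    j = int-*⁺ m j
      int-* -[1+ m ] j = begin
        int (ℤ.- + suc m ℤ.* j)         ≡⟨ ≡.cong int (ℤₚ.neg-distribˡ-* (+ suc m) j) ⟨
        int (ℤ.- (+ suc m ℤ.* j))       ≈⟨ int-neg (+ suc m ℤ.* j) ⟩
        - int (+ suc m ℤ.* j)           ≈⟨ -‿cong (int-*⁺ (suc m) j) ⟩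
        - (nat (suc m) * int j)         ≈⟨ -‿distribˡ-* _ _ ⟩
        - nat (suc m) * int j           ∎

      integers : ℤ-raw -Raw-AlmostCommutative⟶ fromCommutativeRing R
      integers = record
        { ⟦_⟧ = int ; +-homo = int-+ ; *-homo = int-* ; -‿homo = int-neg ; 0-homo = refl ; 1-homo = refl }

      equal? : ∀ a b → Maybe (int a ≈ int b)
      equal? a b with a ℤ.≟ b
      ... | yes e = just (reflexive (≡.cong int e))
      ... | no _  = nothing

    open RingSolver ℤ-raw (fromCommutativeRing R) integers equal? public
      using (solve; _:=_; _:+_; _:*_; _:-_; :-_; con)

  module Division (R : CommutativeRing 0ℓ 0ℓ) where
    open CommutativeRing R hiding (zero)
    open Solver R
    open import Relation.Binary.Reasoning.Setoid setoid

    exact-quotient : ∀ {a b q n r} → a * q ≈ b * q + (n - r) → r ≈ 0# → (a - b) * q ≈ n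
    exact-quotient {a} {b} {q} {n} {r} e e′ = begin
      (a - b) * q                   ≈⟨ solve 3 (λ a b q → (a :- b) :* q := a :* q :- b :* q) refl a b q ⟩
      a * q - b * q                 ≈⟨ +-congʳ e ⟩
      b * q + (n - r) - b * q       ≈⟨ solve 3 (λ c n r → c :+ (n :- r) :- c := n :- r) refl _ n r ⟩
      n - r                         ≈⟨ +-congˡ (-‿cong e′) ⟩
      n - 0#                        ≈⟨ solve 1 (λ n → n :- con (+ 0) := n) refl n ⟩
      n                             ∎

-- Weighted sums over interlacing partitions.

module StripSums where

  open IntegerCoefficients
  open import Level using (0ℓ)
  open import Algebra.Bundles using (CommutativeRing)
  import Data.Integer as ℤ
  open import Data.Nat as ℕ using (ℕ; zero; suc; _∸_; _≤_; _<_; z≤n; s≤s; z<s)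
  import Data.Nat.Properties as ℕₚ
  open import Function using (_∘_)
  open import Relation.Binary.PropositionalEquality as ≡ using (_≡_)

  infixr 5 _◂_
  _◂_ : {A : Set} → A → (ℕ → A) → ℕ → A
  (c ◂ μ) zero    = c
  (c ◂ μ) (suc i) = μ i

  Decreasing : (ℕ → ℕ) → Set
  Decreasing λs = ∀ i → λs (suc i) ≤ λs i

  record Interlaces (r : ℕ) (λs μ : ℕ → ℕ) : Set where
    constructor interlacing
    field
      lower : ∀ i → i < r → λs (suc i) ≤ μ i
      upper : ∀ i → i < r → μ i ≤ λs i
      null  : ∀ i → r ≤ i → μ i ≡ 0

  interlaces-◂ : ∀ {r λs μ c} → λs 1 ≤ c → c ≤ λs 0 → Interlaces r (λs ∘ suc) μ → Interlaces (suc r) λs (c ◂ μ)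
  interlaces-◂ l u (interlacing lower upper null) = interlacing
    (λ { zero _ → l ; (suc i) (s≤s p) → lower i p })
    (λ { zero _ → u ; (suc i) (s≤s p) → upper i p })
    (λ { (suc i) (s≤s p) → null i p })

  module Strips (R : CommutativeRing 0ℓ 0ℓ) (β : CommutativeRing.Carrier R) where

    open CommutativeRing R hiding (zero)
    open Solver R public
    open import Relation.Binary.Reasoning.Setoid setoid

    ∏ : ℕ → (ℕ → Carrier) → Carrier
    ∏ zero    f = 1#
    ∏ (suc k) f = f 0 * ∏ k (f ∘ suc)

    ∏-cong : ∀ k {f g} → (∀ i → i < k → f i ≈ g i) → ∏ k f ≈ ∏ k g
    ∏-cong zero    eq = refl
    ∏-cong (suc k) eq = *-cong (eq 0 z<s) (∏-cong k (λ i p → eq (suc i) (s≤s p)))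

    ∏-snoc : ∀ k f → ∏ (suc k) f ≈ ∏ k f * f k
    ∏-snoc zero    f = *-comm _ _
    ∏-snoc (suc k) f = trans (*-congˡ (∏-snoc k (f ∘ suc))) (sym (*-assoc _ _ _))

    ∏-* : ∀ k f g → ∏ k f * ∏ k g ≈ ∏ k (λ i → f i * g i)
    ∏-* zero    f g = *-identityˡ 1#
    ∏-* (suc k) f g = trans
      (solve 4 (λ a b c d → (a :* b) :* (c :* d) := (a :* c) :* (b :* d)) refl _ _ _ _)
      (*-congˡ (∏-* k (f ∘ suc) (g ∘ suc)))

    -- Sum of F c over l ≤ c ≤ l + d, each term with the weight of a row of length l + d over a row of
    -- length l in which the last variable fills the boxes c, …, l + d − 1 and possibly joins box c − 1
    -- when c > l; u j is the factor of that variable in box j.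
    Row : ℕ → ℕ → (ℕ → Carrier) → (ℕ → Carrier) → Carrier
    Row zero    zero    u F = F 0
    Row zero    (suc d) u F = (F 0 + F 1 * β) * ∏ (suc d) u + Row 0 d (u ∘ suc) (F ∘ suc)
    Row (suc l) d       u F = Row l d (u ∘ suc) (F ∘ suc)

    Row-cong : ∀ l d {u u′ F F′} → (∀ j → u j ≈ u′ j) → (∀ c → l ≤ c → c ≤ l ℕ.+ d → F c ≈ F′ c) →
               Row l d u F ≈ Row l d u′ F′
    Row-cong zero    zero    eu eF = eF 0 z≤n z≤n
    Row-cong zero    (suc d) eu eF = +-cong
      (*-cong (+-cong (eF 0 z≤n z≤n) (*-congʳ (eF 1 z≤n (s≤s z≤n)))) (∏-cong (suc d) (λ i _ → eu i)))
      (Row-cong zero d (eu ∘ suc) (λ c _ p → eF (suc c) z≤n (s≤s p)))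
    Row-cong (suc l) d       eu eF = Row-cong l d (eu ∘ suc) (λ c p q → eF (suc c) (s≤s p) (s≤s q))

    module _ (Ψ : Carrier → Carrier) (Ψ-cong : ∀ {f g} → f ≈ g → Ψ f ≈ Ψ g)
             (Ψ-+ : ∀ f g → Ψ (f + g) ≈ Ψ f + Ψ g) (Ψ-β : ∀ f → Ψ (f * β) ≈ Ψ f * β) where

      ∏-map : ∀ k {u u′ : ℕ → Carrier} → (∀ j f → Ψ (f * u j) ≈ Ψ f * u′ j) → ∀ f → Ψ (f * ∏ k u) ≈ Ψ f * ∏ k u′
      ∏-map zero    h f = trans (Ψ-cong (*-identityʳ f)) (sym (*-identityʳ _))
      ∏-map (suc k) {u} h f = trans (Ψ-cong (sym (*-assoc f (u 0) _)))
        (trans (∏-map k (h ∘ suc) (f * u 0)) (trans (*-congʳ (h 0 f)) (*-assoc _ _ _)))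

      -- Serves for multiplication by a constant, for a renaming of variables, where `u` turns into
      -- `u′`, and for linear operators over which the `u j` are scalars.
      Row-map : ∀ l d {u u′ : ℕ → Carrier} → (∀ j f → Ψ (f * u j) ≈ Ψ f * u′ j) →
                ∀ F → Ψ (Row l d u F) ≈ Row l d u′ (Ψ ∘ F)
      Row-map zero    zero    h F = refl
      Row-map zero    (suc d) {u} h F = trans (Ψ-+ _ _) (+-cong
        (trans (∏-map (suc d) h (F 0 + F 1 * β)) (*-congʳ (trans (Ψ-+ _ _) (+-congˡ (Ψ-β (F 1))))))
        (Row-map zero d (h ∘ suc) (F ∘ suc)))
      Row-map (suc l) d       h F = Row-map l d (h ∘ suc) (F ∘ suc)

    Row-scale : ∀ l d u F a → Row l d u F * a ≈ Row l d u (λ c → F c * a)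
    Row-scale l d u F a = Row-map (_* a) *-congʳ (λ f g → distribʳ a f g) (λ f → swap f β)
                                  l d (λ j f → swap f (u j)) F
      where
      swap : ∀ f b → (f * b) * a ≈ (f * a) * b
      swap f b = solve 3 (λ f b a → (f :* b) :* a := (f :* a) :* b) refl f b a

    Row-zero : ∀ l d {u F} → (∀ c → l ≤ c → F c ≈ 0#) → Row l d u F ≈ 0#
    Row-zero l d {u} {F} h = begin
      Row l d u F                  ≈⟨ Row-cong l d (λ _ → refl) (λ c p _ → trans (h c p) (sym (zeroʳ 0#))) ⟩
      Row l d u (λ _ → 0# * 0#)    ≈⟨ Row-scale l d u (λ _ → 0#) 0# ⟨
      Row l d u (λ _ → 0#) * 0#    ≈⟨ zeroʳ _ ⟩
      0#                           ∎

    Row-head : ∀ d {u F} → (∀ c → F (suc c) ≈ 0#) → Row 0 d u F ≈ F 0 * ∏ d u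
    Row-head zero    h = sym (*-identityʳ _)
    Row-head (suc d) {u} {F} h = begin
      (F 0 + F 1 * β) * ∏ (suc d) u + Row 0 d (u ∘ suc) (F ∘ suc)
        ≈⟨ +-cong (*-congʳ (+-congˡ (*-congʳ (h 0)))) (Row-zero 0 d (λ c _ → h c)) ⟩
      (F 0 + 0# * β) * ∏ (suc d) u + 0#
        ≈⟨ solve 3 (λ f b w → (f :+ con ℤ.0ℤ :* b) :* w :+ con ℤ.0ℤ := f :* w) refl _ _ _ ⟩
      F 0 * ∏ (suc d) u ∎

    Row-small : ∀ l d {u} F → (∀ j → u j ≈ 0#) → Row l d u F ≈ F (l ℕ.+ d)
    Row-small zero    zero    F h = refl
    Row-small zero    (suc d) {u} F h = begin
      (F 0 + F 1 * β) * (u 0 * ∏ d (u ∘ suc)) + Row 0 d (u ∘ suc) (F ∘ suc)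
        ≈⟨ +-cong (*-congˡ (*-congʳ (h 0))) (Row-small 0 d (F ∘ suc) (h ∘ suc)) ⟩
      (F 0 + F 1 * β) * (0# * ∏ d (u ∘ suc)) + F (suc d)
        ≈⟨ solve 3 (λ f w g → f :* (con ℤ.0ℤ :* w) :+ g := g) refl _ _ _ ⟩
      F (suc d) ∎
    Row-small (suc l) d       F h = Row-small l d (F ∘ suc) (h ∘ suc)

    -- Sum over the μ interlacing with λs whose parts beyond the first r vanish.
    Strip : ℕ → (ℕ → ℕ) → (ℕ → ℕ → Carrier) → ((ℕ → ℕ) → Carrier) → Carrier
    Strip zero    λs u F = F (λ _ → 0)
    Strip (suc r) λs u F =
      Row (λs 1) (λs 0 ∸ λs 1) (u 0) (λ c → Strip r (λs ∘ suc) (u ∘ suc) (F ∘ (c ◂_)))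

    Strip-cong : ∀ r {λs u u′ F F′} → Decreasing λs → (∀ i j → i < r → u i j ≈ u′ i j) →
                 (∀ μ → Interlaces r λs μ → F μ ≈ F′ μ) → Strip r λs u F ≈ Strip r λs u′ F′
    Strip-cong zero    dec eu eF = eF _ (interlacing (λ _ ()) (λ _ ()) (λ _ _ → ≡.refl))
    Strip-cong (suc r) {λs} dec eu eF = Row-cong (λs 1) (λs 0 ∸ λs 1) (λ j → eu 0 j z<s) λ c p q →
      Strip-cong r (dec ∘ suc) (λ i j i<r → eu (suc i) j (s≤s i<r)) λ μ int →
      eF (c ◂ μ) (interlaces-◂ p (ℕₚ.≤-trans q (ℕₚ.≤-reflexive (ℕₚ.m+[n∸m]≡n (dec 0)))) int)

    Strip-zero : ∀ r {λs u} → Strip r λs u (λ _ → 0#) ≈ 0#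
    Strip-zero zero    = refl
    Strip-zero (suc r) {λs} = Row-zero (λs 1) (λs 0 ∸ λs 1) (λ c _ → Strip-zero r)

    Extensional : ((ℕ → ℕ) → Carrier) → Set
    Extensional F = ∀ {μ μ′} → (∀ i → μ i ≡ μ′ i) → F μ ≈ F μ′

    ◂-cong : ∀ {c c′ : ℕ} {μ μ′ : ℕ → ℕ} → c ≡ c′ → (∀ i → μ i ≡ μ′ i) → ∀ i → (c ◂ μ) i ≡ (c′ ◂ μ′) i
    ◂-cong e es zero    = e
    ◂-cong e es (suc i) = es i

    -- Every term in which the new variable occurs has some `u i j` as a factor; only μ = λs leaves
    -- no box to that variable alone and lets it join none.
    Strip-small : ∀ r {λs u F} → Decreasing λs → Extensional F → (∀ i j → i < r → u i j ≈ 0#) →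
                  (∀ i → r ≤ i → λs i ≡ 0) → Strip r λs u F ≈ F λs
    Strip-small zero    dec ext h null = ext (λ i → ≡.sym (null i z≤n))
    Strip-small (suc r) {λs} {u} {F} dec ext h null = trans
      (Row-small (λs 1) (λs 0 ∸ λs 1) _ (λ j → h 0 j z<s))
      (trans (Strip-small r (dec ∘ suc) (λ e → ext (◂-cong ≡.refl e)) (λ i j p → h (suc i) j (s≤s p))
                          (λ i p → null (suc i) (s≤s p)))
             (ext λ { zero → ℕₚ.m+[n∸m]≡n (dec 0) ; (suc i) → ≡.refl }))

    Strip-null : ∀ r {λs u F} → Extensional F → (∀ i → λs i ≡ 0) → Strip r λs u F ≈ F (λ _ → 0)
    Strip-null zero    ext null = refl
    Strip-null (suc r) {λs} ext null rewrite null 0 | null 1 =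
      trans (Strip-null r (λ e → ext (◂-cong ≡.refl e)) (null ∘ suc)) (ext λ { zero → ≡.refl ; (suc i) → ≡.refl })

    -- Since F kills every μ with `μ k` positive, the new variable has to fill row `k` completely,
    -- which gives the product; below that row all parts are zero. If n ≤ k, then `λs k` is 0 and
    -- the product is empty.
    Strip-last : ∀ n k {λs u F} → Decreasing λs → Extensional F →
      (∀ i → n ≤ i → λs i ≡ 0) → (∀ i → suc k ≤ i → λs i ≡ 0) → (∀ μ → 0 < μ k → F μ ≈ 0#) →
      Strip n λs u F ≈ Strip k λs u F * ∏ (λs k) (u k)
    Strip-last zero k {λs} dec ext null null′ vanish rewrite null k z≤n =
      trans (sym (Strip-null k ext (λ i → null i z≤n))) (sym (*-identityʳ _))
    Strip-last (suc n) zero {λs} {u} {F} dec ext null null′ vanish rewrite null′ 1 ℕₚ.≤-refl = begin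
      Row 0 (λs 0) (u 0) (λ c → Strip n (λs ∘ suc) (u ∘ suc) (F ∘ (c ◂_)))
        ≈⟨ Row-cong 0 (λs 0) (λ _ → refl) (λ c _ _ →
             Strip-null n (λ e → ext (◂-cong ≡.refl e)) (λ i → null′ (suc i) (s≤s z≤n))) ⟩
      Row 0 (λs 0) (u 0) (λ c → F (c ◂ λ _ → 0))
        ≈⟨ Row-head (λs 0) (λ c → vanish _ z<s) ⟩
      F (0 ◂ λ _ → 0) * ∏ (λs 0) (u 0)
        ≈⟨ *-congʳ (ext λ { zero → ≡.refl ; (suc i) → ≡.refl }) ⟩
      F (λ _ → 0) * ∏ (λs 0) (u 0) ∎
    Strip-last (suc n) (suc k) {λs} {u} {F} dec ext null null′ vanish = begin
      Row (λs 1) (λs 0 ∸ λs 1) (u 0) (λ c → Strip n (λs ∘ suc) (u ∘ suc) (F ∘ (c ◂_)))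
        ≈⟨ Row-cong (λs 1) (λs 0 ∸ λs 1) (λ _ → refl) (λ c _ _ →
             Strip-last n k (dec ∘ suc) (λ e → ext (◂-cong ≡.refl e)) (λ i p → null (suc i) (s≤s p))
               (λ i p → null′ (suc i) (s≤s p)) (λ μ p → vanish (c ◂ μ) p)) ⟩
      Row (λs 1) (λs 0 ∸ λs 1) (u 0)
          (λ c → Strip k (λs ∘ suc) (u ∘ suc) (F ∘ (c ◂_)) * ∏ (λs (suc k)) (u (suc k)))
        ≈⟨ Row-scale (λs 1) (λs 0 ∸ λs 1) (u 0) _ _ ⟨
      Strip (suc k) λs u F * ∏ (λs (suc k)) (u (suc k)) ∎

    module _ (Ψ : Carrier → Carrier) (Ψ-cong : ∀ {f g} → f ≈ g → Ψ f ≈ Ψ g)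
             (Ψ-+ : ∀ f g → Ψ (f + g) ≈ Ψ f + Ψ g) (Ψ-β : ∀ f → Ψ (f * β) ≈ Ψ f * β) where

      -- Ψ is linear over β and the `u i j`, so the row sums are multiplied out one at a time; `h`
      -- collects the factors already chosen in the rows above.
      Strip-expand : ∀ n {λs u} → Decreasing λs → (∀ i j f → Ψ (f * u i j) ≈ Ψ f * u i j) → ∀ h (g : ℕ → ℕ → Carrier) →
        Ψ (h * ∏ n (λ i → Row (λs (suc i)) (λs i ∸ λs (suc i)) (u i) (g i))) ≈
        Strip n λs u (λ μ → Ψ (h * ∏ n (λ i → g i (μ i))))
      Strip-expand zero    dec Ψ-u h g = refl
      Strip-expand (suc n) {λs} {u} dec Ψ-u h g = begin
        Ψ (h * (Row l d (u 0) (g 0) * P))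
          ≈⟨ Row-map (λ f → Ψ (h * (f * P))) (λ e → Ψ-cong (*-congˡ (*-congʳ e)))
               (λ f f′ → trans (Ψ-cong (trans (*-congˡ (distribʳ P f f′)) (distribˡ h _ _))) (Ψ-+ _ _))
               (λ f → pull Ψ-β f) l d (λ j f → pull (Ψ-u 0 j) f) (g 0) ⟩
        Row l d (u 0) (λ c → Ψ (h * (g 0 c * P)))
          ≈⟨ Row-cong l d (λ _ → refl) (λ c _ _ → trans (Ψ-cong (sym (*-assoc _ _ _)))
               (trans (Strip-expand n (dec ∘ suc) (Ψ-u ∘ suc) (h * g 0 c) (g ∘ suc))
                      (Strip-cong n (dec ∘ suc) (λ _ _ _ → refl) (λ μ _ → Ψ-cong (*-assoc _ _ _))))) ⟩
        Strip (suc n) λs u (λ μ → Ψ (h * ∏ (suc n) (λ i → g i (μ i)))) ∎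
        where
        l = λs 1
        d = λs 0 ∸ λs 1
        P = ∏ n (λ i → Row (λs (suc (suc i))) (λs (suc i) ∸ λs (suc (suc i))) (u (suc i)) (g (suc i)))
        pull : ∀ {b} → (∀ f → Ψ (f * b) ≈ Ψ f * b) → ∀ f → Ψ (h * ((f * b) * P)) ≈ Ψ (h * (f * P)) * b
        pull {b} Ψ-b f = trans
          (Ψ-cong (solve 4 (λ h f b P → h :* ((f :* b) :* P) := (h :* (f :* P)) :* b) refl h f b P)) (Ψ-b _)

-- Isobaric divided differences and the braid relations.

module DividedDifferences where

  open import Defs using (Var; x[_]; y[_]; s; swapVar)
  open AdjacentTranspositions
  open StripSums
  open import Level using (0ℓ)
  open import Algebra.Bundles using (CommutativeRing)
  import Data.Integer as ℤ
  open import Data.Nat as ℕ using (ℕ; zero; suc; _<_)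
  import Data.Nat.Properties as ℕₚ
  open import Function using (_∘_; id)
  open import Relation.Binary.PropositionalEquality as ≡ using (_≡_; _≢_)

  -- What the argument uses of the polynomial ring: renaming of variables, π through its equation
  -- with the denominator cleared, and two kinds of regular elements. Working from these axioms
  -- keeps the lists of terms from unfolding.
  record GrothendieckAlgebra (R : CommutativeRing 0ℓ 0ℓ) : Set where
    open CommutativeRing R hiding (zero)
    field
      var          : Var → Carrier
      β            : Carrier
      ren          : (Var → Var) → Carrier → Carrier
      ren-cong     : ∀ ρ {f g} → f ≈ g → ren ρ f ≈ ren ρ g
      ren-+        : ∀ ρ f g → ren ρ (f + g) ≈ ren ρ f + ren ρ g
      ren-*        : ∀ ρ f g → ren ρ (f * g) ≈ ren ρ f * ren ρ g
      ren-neg      : ∀ ρ f → ren ρ (- f) ≈ - ren ρ f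
      ren-1        : ∀ ρ → ren ρ 1# ≈ 1#
      ren-β        : ∀ ρ → ren ρ β ≈ β
      ren-var      : ∀ ρ v → ren ρ (var v) ≈ var (ρ v)
      ren-∘        : ∀ ρ τ f → ren ρ (ren τ f) ≈ ren (ρ ∘ τ) f
      ren-ext      : ∀ {ρ τ} → (∀ v → ρ v ≡ τ v) → ∀ f → ren ρ f ≈ ren τ f
      ren-id       : ∀ f → ren id f ≈ f
      π            : ℕ → Carrier → Carrier
      π-spec       : ∀ i f → (var x[ i ] - var x[ suc i ]) * π i f ≈
                       (1# + β * var x[ suc i ]) * f - (1# + β * var x[ i ]) * ren (swapVar i) f
      var-difference-cancel : ∀ {v w} → v ≢ w → ∀ f → (var v - var w) * f ≈ 0# → f ≈ 0#
      1+β-cancel   : ∀ v f → (1# + β * var v) * f ≈ 0# → f ≈ 0#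

  swapVar-involutive : ∀ i v → swapVar i (swapVar i v) ≡ v
  swapVar-involutive i x[ r ] = ≡.cong x[_] (s-involutive i r)
  swapVar-involutive i y[ r ] = ≡.refl

  -- Specializes y₀, which is free to serve as a spare variable.
  plug : Var → Var → Var
  plug v x[ i ]     = x[ i ]
  plug v y[ zero ]  = v
  plug v y[ suc j ] = y[ suc j ]

  plug-swapVar : ∀ i v w → plug (swapVar i v) (swapVar i w) ≡ swapVar i (plug v w)
  plug-swapVar i v x[ r ]     = ≡.refl
  plug-swapVar i v y[ zero ]  = ≡.refl
  plug-swapVar i v y[ suc j ] = ≡.refl

  module Operators (R : CommutativeRing 0ℓ 0ℓ) (A : GrothendieckAlgebra R) where
    open CommutativeRing R hiding (zero)
    open GrothendieckAlgebra A
    open Strips R β public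
    open import Relation.Binary.Reasoning.Setoid setoid

    x y : ℕ → Carrier
    x i = var x[ i ]
    y j = var y[ j ]

    infixl 6 _⊕_
    _⊕_ : Carrier → Carrier → Carrier
    f ⊕ g = f + g + β * f * g

    ε : ℕ → Carrier
    ε i = 1# + β * x i

    σ : ℕ → Carrier → Carrier
    σ i = ren (swapVar i)

    ren-- : ∀ ρ f g → ren ρ (f - g) ≈ ren ρ f - ren ρ g
    ren-- ρ f g = trans (ren-+ ρ f (- g)) (+-congˡ (ren-neg ρ g))

    ren-1+β : ∀ ρ f → ren ρ (1# + β * f) ≈ 1# + β * ren ρ f
    ren-1+β ρ f = trans (ren-+ ρ _ _) (+-cong (ren-1 ρ) (trans (ren-* ρ _ _) (*-congʳ (ren-β ρ))))

    ren-⊕ : ∀ ρ f g → ren ρ (f ⊕ g) ≈ ren ρ f ⊕ ren ρ g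
    ren-⊕ ρ f g = trans (ren-+ ρ _ _) (+-cong (ren-+ ρ _ _)
      (trans (ren-* ρ _ _) (*-congʳ (trans (ren-* ρ _ _) (*-congʳ (ren-β ρ))))))

    ⊕-cong : ∀ {f f′ g g′} → f ≈ f′ → g ≈ g′ → f ⊕ g ≈ f′ ⊕ g′
    ⊕-cong p q = +-cong (+-cong p q) (*-cong (*-congˡ p) q)

    ren-∏ : ∀ ρ k f → ren ρ (∏ k f) ≈ ∏ k (ren ρ ∘ f)
    ren-∏ ρ zero    f = ren-1 ρ
    ren-∏ ρ (suc k) f = trans (ren-* ρ _ _) (*-congˡ (ren-∏ ρ k (f ∘ suc)))

    ren-Row : ∀ ρ l d u F → ren ρ (Row l d u F) ≈ Row l d (ren ρ ∘ u) (ren ρ ∘ F)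
    ren-Row ρ l d u F = Row-map (ren ρ) (ren-cong ρ) (ren-+ ρ)
      (λ f → trans (ren-* ρ f β) (*-congˡ (ren-β ρ))) l d (λ j f → ren-* ρ f (u j)) F

    σ-involutive : ∀ i f → σ i (σ i f) ≈ f
    σ-involutive i f = trans (ren-∘ _ _ f) (trans (ren-ext (swapVar-involutive i) f) (ren-id f))

    σ-x : ∀ {i r t} → s i r ≡ t → σ i (x r) ≈ x t
    σ-x e = trans (ren-var _ _) (reflexive (≡.cong x e))

    σ-y : ∀ i j → σ i (y j) ≈ y j
    σ-y i j = ren-var _ _

    σ-ε : ∀ {i r t} → s i r ≡ t → σ i (ε r) ≈ ε t
    σ-ε e = trans (ren-1+β _ _) (+-congˡ (*-congˡ (σ-x e)))

    σ-difference : ∀ {i a b c d} → s i a ≡ c → s i b ≡ d → σ i (x a - x b) ≈ x c - x d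
    σ-difference e e′ = trans (ren-- _ _ _) (+-cong (σ-x e) (-‿cong (σ-x e′)))

    difference⇒≈ : ∀ {f g} → f - g ≈ 0# → f ≈ g
    difference⇒≈ {f} {g} e = begin
      f            ≈⟨ solve 2 (λ f g → f := (f :- g) :+ g) refl f g ⟩
      (f - g) + g  ≈⟨ +-congʳ e ⟩
      0# + g       ≈⟨ +-identityˡ g ⟩
      g            ∎

    regular : ∀ {a} → (∀ f → a * f ≈ 0# → f ≈ 0#) → ∀ {f g} → a * f ≈ a * g → f ≈ g
    regular {a} reg {f} {g} e = difference⇒≈ (reg (f - g) (begin
      a * (f - g)    ≈⟨ solve 3 (λ a f g → a :* (f :- g) := a :* f :- a :* g) refl a f g ⟩
      a * f - a * g  ≈⟨ +-congʳ e ⟩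
      a * g - a * g  ≈⟨ -‿inverseʳ _ ⟩
      0#             ∎))

    x≢x : ∀ {i j} → i ≢ j → x[ i ] ≢ x[ j ]
    x≢x ne ≡.refl = ne ≡.refl

    x-difference-regular : ∀ {i j} → i ≢ j → ∀ {f g} → (x i - x j) * f ≈ (x i - x j) * g → f ≈ g
    x-difference-regular ne = regular (var-difference-cancel (x≢x ne))

    -- Isobaric divided differences

    i≢1+i : ∀ {i} → i ≢ suc i
    i≢1+i e = ℕₚ.1+n≢n (≡.sym e)

    -- Because xᵢ - xᵢ₊₁ is regular, the cleared equation determines `π i f`. The identities for π
    -- below are obtained by checking this equation.
    π-unique : ∀ i {f g} → (x i - x (suc i)) * g ≈ ε (suc i) * f - ε i * σ i f → g ≈ π i f
    π-unique i {f} e = x-difference-regular i≢1+i (trans e (sym (π-spec i f)))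

    π-cong : ∀ i {f g} → f ≈ g → π i f ≈ π i g
    π-cong i {f} e = π-unique i (trans (π-spec i f)
      (+-cong (*-congˡ e) (-‿cong (*-congˡ (ren-cong _ e)))))

    π-+ : ∀ i f g → π i (f + g) ≈ π i f + π i g
    π-+ i f g = sym (π-unique i (begin
      (x i - x (suc i)) * (π i f + π i g)
        ≈⟨ distribˡ _ _ _ ⟩
      (x i - x (suc i)) * π i f + (x i - x (suc i)) * π i g
        ≈⟨ +-cong (π-spec i f) (π-spec i g) ⟩
      (ε (suc i) * f - ε i * σ i f) + (ε (suc i) * g - ε i * σ i g)
        ≈⟨ solve 6 (λ a b f g f′ g′ → (a :* f :- b :* f′) :+ (a :* g :- b :* g′) :=
                      a :* (f :+ g) :- b :* (f′ :+ g′)) refl _ _ _ _ _ _ ⟩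
      ε (suc i) * (f + g) - ε i * (σ i f + σ i g)
        ≈⟨ +-congˡ (-‿cong (*-congˡ (ren-+ _ f g))) ⟨
      ε (suc i) * (f + g) - ε i * σ i (f + g) ∎))

    π-scale : ∀ i {a} → σ i a ≈ a → ∀ f → π i (a * f) ≈ a * π i f
    π-scale i {a} fixed f = sym (π-unique i (begin
      (x i - x (suc i)) * (a * π i f)
        ≈⟨ solve 3 (λ d a f → d :* (a :* f) := a :* (d :* f)) refl _ _ _ ⟩
      a * ((x i - x (suc i)) * π i f)
        ≈⟨ *-congˡ (π-spec i f) ⟩
      a * (ε (suc i) * f - ε i * σ i f)
        ≈⟨ solve 5 (λ a b c f g → a :* (b :* f :- c :* g) := b :* (a :* f) :- c :* (a :* g)) refl _ _ _ _ _ ⟩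
      ε (suc i) * (a * f) - ε i * (a * σ i f)
        ≈⟨ +-congˡ (-‿cong (*-congˡ (trans (ren-* _ a f) (*-congʳ fixed)))) ⟨
      ε (suc i) * (a * f) - ε i * σ i (a * f) ∎))

    π-zero : ∀ i → π i 0# ≈ 0#
    π-zero i = sym (π-unique i (begin
      (x i - x (suc i)) * 0#
        ≈⟨ solve 3 (λ d a b → d :* con ℤ.0ℤ := a :* con ℤ.0ℤ :- b :* con ℤ.0ℤ) refl _ (ε (suc i)) (ε i) ⟩
      ε (suc i) * 0# - ε i * 0#
        ≈⟨ +-congˡ (-‿cong (*-congˡ σ0)) ⟨
      ε (suc i) * 0# - ε i * σ i 0# ∎))
      where
      σ0 : σ i 0# ≈ 0#
      σ0 = trans (ren-cong _ (sym (-‿inverseʳ 1#))) (trans (ren-- _ 1# 1#) (-‿inverseʳ _))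

    ren-equation : ∀ ρ {a b c f g h a′ b′ c′} → ren ρ a ≈ a′ → ren ρ b ≈ b′ → ren ρ c ≈ c′ →
      a * g ≈ b * f - c * h → a′ * ren ρ g ≈ b′ * ren ρ f - c′ * ren ρ h
    ren-equation ρ {a} {b} {c} {f} {g} {h} {a′} {b′} {c′} ea eb ec e = begin
      a′ * ren ρ g                  ≈⟨ *-congʳ ea ⟨
      ren ρ a * ren ρ g             ≈⟨ ren-* ρ a g ⟨
      ren ρ (a * g)                 ≈⟨ ren-cong ρ e ⟩
      ren ρ (b * f - c * h)         ≈⟨ ren-- ρ _ _ ⟩
      ren ρ (b * f) - ren ρ (c * h) ≈⟨ +-cong (trans (ren-* ρ b f) (*-congʳ eb)) (-‿cong (trans (ren-* ρ c h) (*-congʳ ec))) ⟩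
      b′ * ren ρ f - c′ * ren ρ h   ∎

    σ-π : ∀ i f → σ i (π i f) ≈ π i f
    σ-π i f = π-unique i (begin
      (x i - x (suc i)) * σ i (π i f)
        ≈⟨ solve 3 (λ a b p → (a :- b) :* p := :- ((b :- a) :* p)) refl _ _ _ ⟩
      - ((x (suc i) - x i) * σ i (π i f))
        ≈⟨ -‿cong (ren-equation _ (σ-difference (s-left i) (s-right i)) (σ-ε (s-right i)) (σ-ε (s-left i)) (π-spec i f)) ⟩
      - (ε i * σ i f - ε (suc i) * σ i (σ i f))
        ≈⟨ -‿cong (+-congˡ (-‿cong (*-congˡ (σ-involutive i f)))) ⟩
      - (ε i * σ i f - ε (suc i) * f)
        ≈⟨ solve 4 (λ a b f g → :- (a :* g :- b :* f) := b :* f :- a :* g) refl _ _ _ _ ⟩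
      ε (suc i) * f - ε i * σ i f ∎)

    -- Applied both to a distant transposition, which yields `π-comm`, and to the specialization of
    -- y₀.
    π-ren : ∀ i ρ → ρ x[ i ] ≡ x[ i ] → ρ x[ suc i ] ≡ x[ suc i ] →
            (∀ v → ρ (swapVar i v) ≡ swapVar i (ρ v)) → ∀ f → ren ρ (π i f) ≈ π i (ren ρ f)
    π-ren i ρ e e′ comm f = π-unique i (begin
      (x i - x (suc i)) * ren ρ (π i f)
        ≈⟨ ren-equation ρ (trans (ren-- ρ _ _) (+-cong (fixed e) (-‿cong (fixed e′)))) (fixed-ε e′) (fixed-ε e) (π-spec i f) ⟩
      ε (suc i) * ren ρ f - ε i * ren ρ (σ i f)
        ≈⟨ +-congˡ (-‿cong (*-congˡ (trans (ren-∘ _ _ f) (trans (ren-ext comm f) (sym (ren-∘ _ _ f)))))) ⟩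
      ε (suc i) * ren ρ f - ε i * σ i (ren ρ f) ∎)
      where
      fixed : ∀ {v} → ρ v ≡ v → ren ρ (var v) ≈ var v
      fixed p = trans (ren-var ρ _) (reflexive (≡.cong var p))
      fixed-ε : ∀ {r} → ρ x[ r ] ≡ x[ r ] → ren ρ (ε r) ≈ ε r
      fixed-ε p = trans (ren-1+β ρ _) (+-congˡ (*-congˡ (fixed p)))

    π-σ-comm : ∀ {i j} → suc i < j → ∀ f → σ j (π i f) ≈ π i (σ j f)
    π-σ-comm {i} {j} i<j = π-ren i (swapVar j)
      (≡.cong x[_] (s-below (ℕₚ.<-trans (ℕₚ.n<1+n i) i<j))) (≡.cong x[_] (s-below i<j))
      λ { x[ r ] → ≡.cong x[_] (≡.sym (s-comm i<j r)) ; y[ r ] → ≡.refl }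

    π-comm : ∀ {i j} → suc i < j → ∀ f → π i (π j f) ≈ π j (π i f)
    π-comm {i} {j} i<j f = π-unique j (begin
      (x j - x (suc j)) * π i (π j f)
        ≈⟨ π-scale i (σ-difference (s-above i<j) (s-above i<j+1)) _ ⟨
      π i ((x j - x (suc j)) * π j f)
        ≈⟨ π-cong i (trans (π-spec j f) (solve 4 (λ a b f g → a :* f :- b :* g := a :* f :+ :- b :* g) refl _ _ _ _)) ⟩
      π i (ε (suc j) * f + - ε j * σ j f)
        ≈⟨ π-+ i _ _ ⟩
      π i (ε (suc j) * f) + π i (- ε j * σ j f)
        ≈⟨ +-cong (π-scale i (σ-ε (s-above i<j+1)) f)
                  (π-scale i (trans (ren-neg _ _) (-‿cong (σ-ε (s-above i<j)))) _) ⟩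
      ε (suc j) * π i f + - ε j * π i (σ j f)
        ≈⟨ +-congˡ (*-congˡ (π-σ-comm i<j f)) ⟨
      ε (suc j) * π i f + - ε j * σ j (π i f)
        ≈⟨ solve 4 (λ a b f g → a :* f :- b :* g := a :* f :+ :- b :* g) refl _ _ _ _ ⟨
      ε (suc j) * π i f - ε j * σ j (π i f) ∎)
      where
      i<j+1 = ℕₚ.<-trans i<j (ℕₚ.n<1+n j)

    σ-braid : ∀ i f → σ i (σ (suc i) (σ i f)) ≈ σ (suc i) (σ i (σ (suc i) f))
    σ-braid i f = begin
      σ i (σ (suc i) (σ i f))
        ≈⟨ trans (ren-cong _ (ren-∘ _ _ f)) (ren-∘ _ _ f) ⟩
      ren (swapVar i ∘ (swapVar (suc i) ∘ swapVar i)) f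
        ≈⟨ ren-ext (λ { x[ r ] → ≡.cong x[_] (s-braid i r) ; y[ r ] → ≡.refl }) f ⟩
      ren (swapVar (suc i) ∘ (swapVar i ∘ swapVar (suc i))) f
        ≈⟨ trans (ren-cong _ (ren-∘ _ _ f)) (ren-∘ _ _ f) ⟨
      σ (suc i) (σ i (σ (suc i) f)) ∎

    -- Both sides, multiplied by the Vandermonde product, antisymmetrize ε₂ ε₃² f.
    π-braid : ∀ i f → π i (π (suc i) (π i f)) ≈ π (suc i) (π i (π (suc i) f))
    π-braid i f = x-difference-regular i≢1+i (x-difference-regular i≢1+i (x-difference-regular i≢2+i
      (trans left-side (sym right-side))))
      where
      j = suc i
      k = suc j
      i≢2+i : i ≢ k
      i≢2+i = ℕₚ.m≢1+n+m i {1}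
      s12 = s-left i
      s21 = s-right i
      s13 = s-above (ℕₚ.n<1+n j)
      s23 = s-left j
      s32 = s-right j
      s31 = s-below (ℕₚ.n<1+n i)

      P = σ i (σ j (σ i f))
      Q = ε k * ε k * (ε j * f - ε i * σ i f) - ε j * ε j * (ε k * σ j f - ε i * σ j (σ i f))
            + ε i * ε i * (ε k * σ i (σ j f) - ε j * P)

      left-side : (x i - x k) * ((x j - x k) * ((x i - x j) * π i (π j (π i f)))) ≈ Q
      left-side = begin
        D₃ * (D₂ * (D₁ * π i h))
          ≈⟨ *-congˡ (*-congˡ (π-spec i h)) ⟩
        D₃ * (D₂ * (ε j * h - ε i * σ i h))
          ≈⟨ solve 6 (λ c b e e′ h h′ → c :* (b :* (e :* h :- e′ :* h′)) := e :* c :* (b :* h) :- e′ :* b :* (c :* h′))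
                   refl _ _ _ _ _ _ ⟩
        ε j * D₃ * (D₂ * h) - ε i * D₂ * (D₃ * σ i h)
          ≈⟨ +-cong (*-congˡ (π-spec j g)) (-‿cong (*-congˡ (trans
               (ren-equation _ (σ-difference s21 s13) (σ-ε s13) (σ-ε s21) (π-spec j g))
               (+-congʳ (*-congˡ (σ-π i f)))))) ⟩
        ε j * D₃ * (ε k * g - ε j * σ j g) - ε i * D₂ * (ε k * g - ε i * σ i (σ j g))
          -- The ε are expanded here, unlike on the other side, because the terms in `g` combine
          -- through ε₂(x₁ - x₃) - ε₁(x₂ - x₃) = ε₃(x₁ - x₂).
          ≈⟨ solve 7 (λ b x₁ x₂ x₃ g g₂ g₁₂ →
               let e₁ = con ℤ.1ℤ :+ b :* x₁ ; e₂ = con ℤ.1ℤ :+ b :* x₂ ; e₃ = con ℤ.1ℤ :+ b :* x₃ in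
               e₂ :* (x₁ :- x₃) :* (e₃ :* g :- e₂ :* g₂) :- e₁ :* (x₂ :- x₃) :* (e₃ :* g :- e₁ :* g₁₂) :=
               e₃ :* e₃ :* ((x₁ :- x₂) :* g) :- e₂ :* e₂ :* ((x₁ :- x₃) :* g₂) :+ e₁ :* e₁ :* ((x₂ :- x₃) :* g₁₂))
               refl β (x i) (x j) (x k) g (σ j g) (σ i (σ j g)) ⟩
        ε k * ε k * (D₁ * g) - ε j * ε j * (D₃ * σ j g) + ε i * ε i * (D₂ * σ i (σ j g))
          ≈⟨ +-cong (+-cong (*-congˡ (π-spec i f)) (-‿cong (*-congˡ eq₂))) (*-congˡ
               (ren-equation _ (σ-difference s12 s13) (σ-ε s13) (σ-ε s12) eq₂)) ⟩
        Q ∎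
        where
        D₁ = x i - x j
        D₂ = x j - x k
        D₃ = x i - x k
        g = π i f
        h = π j g
        eq₂ : D₃ * σ j g ≈ ε k * σ j f - ε i * σ j (σ i f)
        eq₂ = ren-equation _ (σ-difference s31 s23) (σ-ε s23) (σ-ε s31) (π-spec i f)

      right-side : (x i - x k) * ((x j - x k) * ((x i - x j) * π j (π i (π j f)))) ≈ Q
      right-side = begin
        D₃ * (D₂ * (D₁ * π j h))
          ≈⟨ solve 4 (λ a b c p → c :* (b :* (a :* p)) := c :* (a :* (b :* p))) refl D₁ D₂ D₃ _ ⟩
        D₃ * (D₁ * (D₂ * π j h))
          ≈⟨ *-congˡ (*-congˡ (π-spec j h)) ⟩
        D₃ * (D₁ * (ε k * h - ε j * σ j h))
          ≈⟨ solve 6 (λ c b e e′ h h′ → c :* (b :* (e :* h :- e′ :* h′)) := e :* c :* (b :* h) :- e′ :* b :* (c :* h′))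
                   refl _ _ _ _ _ _ ⟩
        ε k * D₃ * (D₁ * h) - ε j * D₁ * (D₃ * σ j h)
          ≈⟨ +-cong (*-congˡ (π-spec i g)) (-‿cong (*-congˡ (trans
               (ren-equation _ (σ-difference s31 s23) (σ-ε s23) (σ-ε s31) (π-spec i g))
               (+-congʳ (*-congˡ (σ-π j f)))))) ⟩
        ε k * D₃ * (ε j * g - ε i * σ i g) - ε j * D₁ * (ε k * g - ε i * σ j (σ i g))
          ≈⟨ solve 9 (λ x₁ x₂ x₃ e₁ e₂ e₃ g g₁ g₂₁ →
               e₃ :* (x₁ :- x₃) :* (e₂ :* g :- e₁ :* g₁) :- e₂ :* (x₁ :- x₂) :* (e₃ :* g :- e₁ :* g₂₁) :=
               e₂ :* e₃ :* ((x₂ :- x₃) :* g) :- e₁ :* e₃ :* ((x₁ :- x₃) :* g₁) :+ e₁ :* e₂ :* ((x₁ :- x₂) :* g₂₁))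
               refl (x i) (x j) (x k) (ε i) (ε j) (ε k) g (σ i g) (σ j (σ i g)) ⟩
        ε j * ε k * (D₂ * g) - ε i * ε k * (D₃ * σ i g) + ε i * ε j * (D₁ * σ j (σ i g))
          ≈⟨ +-cong (+-cong (*-congˡ (π-spec j f)) (-‿cong (*-congˡ eq₂))) (*-congˡ (trans
               (ren-equation _ (σ-difference s31 s32) (σ-ε s32) (σ-ε s31) eq₂)
               (+-congˡ (-‿cong (*-congˡ (sym (σ-braid i f))))))) ⟩
        ε j * ε k * (ε k * f - ε j * σ j f) - ε i * ε k * (ε k * σ i f - ε i * σ i (σ j f))
          + ε i * ε j * (ε j * σ j (σ i f) - ε i * P)
          ≈⟨ solve 9 (λ e₁ e₂ e₃ f f₁ f₂ f₁₂ f₂₁ p →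
               e₂ :* e₃ :* (e₃ :* f :- e₂ :* f₂) :- e₁ :* e₃ :* (e₃ :* f₁ :- e₁ :* f₁₂) :+ e₁ :* e₂ :* (e₂ :* f₂₁ :- e₁ :* p) :=
               e₃ :* e₃ :* (e₂ :* f :- e₁ :* f₁) :- e₂ :* e₂ :* (e₃ :* f₂ :- e₁ :* f₂₁) :+ e₁ :* e₁ :* (e₃ :* f₁₂ :- e₂ :* p))
               refl (ε i) (ε j) (ε k) f (σ i f) (σ j f) (σ i (σ j f)) (σ j (σ i f)) P ⟩
        Q ∎
        where
        D₁ = x i - x j
        D₂ = x j - x k
        D₃ = x i - x k
        g = π j f
        h = π i g
        eq₂ : D₃ * σ i g ≈ ε k * σ i f - ε i * σ i (σ j f)
        eq₂ = ren-equation _ (σ-difference s21 s13) (σ-ε s13) (σ-ε s21) (π-spec j f)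

-- The operator of the longest element, factorial powers, and evaluation at z = xₙ₊₁.

module Symmetrizers where

  open import Defs using (x[_]; s; swapVar)
  open AdjacentTranspositions
  open DividedDifferences
  open import Level using (0ℓ)
  open import Algebra.Bundles using (CommutativeRing)
  import Data.Integer as ℤ
  open import Data.Nat as ℕ using (ℕ; zero; suc; _≤_; _<_; z≤n; s≤s; s≤s⁻¹)
  import Data.Nat.Properties as ℕₚ
  open import Data.Product using (∃-syntax; _,_)
  open import Data.Sum using (inj₁; inj₂)
  open import Function using (_∘_)
  open import Relation.Binary.PropositionalEquality as ≡ using (_≡_)

  module Symmetrization (R : CommutativeRing 0ℓ 0ℓ) (A : GrothendieckAlgebra R) where
    open CommutativeRing R hiding (zero)
    open GrothendieckAlgebra A
    open Operators R A public
    open import Relation.Binary.Reasoning.Setoid setoid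

    -- As compositions, `climb n` is π_n ⋯ π_1 and `sweep n` is π_1 ⋯ π_n. `symmetrize k` is the
    -- operator of the longest element of S_k for the reduced word (1)(2 1) ⋯ (k-1 ⋯ 1).
    climb sweep symmetrize : ℕ → Carrier → Carrier
    climb zero    f = f
    climb (suc n) f = π (suc n) (climb n f)
    sweep zero    f = f
    sweep (suc n) f = sweep n (π (suc n) f)
    symmetrize zero    f = f
    symmetrize (suc k) f = symmetrize k (climb k f)

    Invariant : ℕ → Carrier → Set
    Invariant k a = ∀ i → 1 ≤ i → i < k → σ i a ≈ a

    invariant-≤ : ∀ {k l a} → k ≤ l → Invariant l a → Invariant k a
    invariant-≤ k≤l inv i p q = inv i p (ℕₚ.<-≤-trans q k≤l)

    invariant-* : ∀ {k a b} → Invariant k a → Invariant k b → Invariant k (a * b)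
    invariant-* p q i l u = trans (ren-* _ _ _) (*-cong (p i l u) (q i l u))

    invariant-pred : ∀ {k a} → Invariant (suc k) a → Invariant k a
    invariant-pred = invariant-≤ (ℕₚ.n≤1+n _)

    climb-cong : ∀ n {f g} → f ≈ g → climb n f ≈ climb n g
    climb-cong zero    e = e
    climb-cong (suc n) e = π-cong (suc n) (climb-cong n e)

    sweep-cong : ∀ n {f g} → f ≈ g → sweep n f ≈ sweep n g
    sweep-cong zero    e = e
    sweep-cong (suc n) e = sweep-cong n (π-cong (suc n) e)

    symmetrize-cong : ∀ k {f g} → f ≈ g → symmetrize k f ≈ symmetrize k g
    symmetrize-cong zero    e = e
    symmetrize-cong (suc k) e = symmetrize-cong k (climb-cong k e)

    climb-+ : ∀ n f g → climb n (f + g) ≈ climb n f + climb n g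
    climb-+ zero    f g = refl
    climb-+ (suc n) f g = trans (π-cong (suc n) (climb-+ n f g)) (π-+ (suc n) _ _)

    symmetrize-+ : ∀ k f g → symmetrize k (f + g) ≈ symmetrize k f + symmetrize k g
    symmetrize-+ zero    f g = refl
    symmetrize-+ (suc k) f g = trans (symmetrize-cong k (climb-+ k f g)) (symmetrize-+ k _ _)

    climb-zero : ∀ n → climb n 0# ≈ 0#
    climb-zero zero    = refl
    climb-zero (suc n) = trans (π-cong (suc n) (climb-zero n)) (π-zero (suc n))

    sweep-zero : ∀ n → sweep n 0# ≈ 0#
    sweep-zero zero    = refl
    sweep-zero (suc n) = trans (sweep-cong n (π-zero (suc n))) (sweep-zero n)

    climb-scale : ∀ n {a} → Invariant (suc n) a → ∀ f → climb n (a * f) ≈ a * climb n f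
    climb-scale zero    inv f = refl
    climb-scale (suc n) inv f = trans (π-cong (suc n) (climb-scale n (invariant-pred inv) f))
                                      (π-scale (suc n) (inv (suc n) (s≤s z≤n) ℕₚ.≤-refl) _)

    sweep-scale : ∀ n {a} → Invariant (suc n) a → ∀ f → sweep n (a * f) ≈ a * sweep n f
    sweep-scale zero    inv f = refl
    sweep-scale (suc n) inv f = trans (sweep-cong n (π-scale (suc n) (inv (suc n) (s≤s z≤n) ℕₚ.≤-refl) f))
                                      (sweep-scale n (invariant-pred inv) _)

    symmetrize-scale : ∀ k {a} → Invariant k a → ∀ f → symmetrize k (a * f) ≈ a * symmetrize k f
    symmetrize-scale zero    inv f = refl
    symmetrize-scale (suc k) inv f = trans (symmetrize-cong k (climb-scale k inv f))
                                           (symmetrize-scale k (invariant-pred inv) _)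

    Commutes : (Carrier → Carrier) → ℕ → Set
    Commutes Ψ k = ∀ i → 1 ≤ i → i < k → ∀ f → Ψ (π i f) ≈ π i (Ψ f)

    module _ {Ψ : Carrier → Carrier} (Ψ-cong : ∀ {f g} → f ≈ g → Ψ f ≈ Ψ g) where

      climb-comm : ∀ n → Commutes Ψ (suc n) → ∀ f → Ψ (climb n f) ≈ climb n (Ψ f)
      climb-comm zero    comm f = refl
      climb-comm (suc n) comm f = trans (comm (suc n) (s≤s z≤n) ℕₚ.≤-refl _)
        (π-cong (suc n) (climb-comm n (λ i p q → comm i p (ℕₚ.m<n⇒m<1+n q)) f))

      sweep-comm : ∀ n → Commutes Ψ (suc n) → ∀ f → Ψ (sweep n f) ≈ sweep n (Ψ f)
      sweep-comm zero    comm f = refl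
      sweep-comm (suc n) comm f = trans (sweep-comm n (λ i p q → comm i p (ℕₚ.m<n⇒m<1+n q)) _)
        (sweep-cong n (comm (suc n) (s≤s z≤n) ℕₚ.≤-refl f))

      symmetrize-comm : ∀ k → Commutes Ψ k → ∀ f → Ψ (symmetrize k f) ≈ symmetrize k (Ψ f)
      symmetrize-comm zero    comm f = refl
      symmetrize-comm (suc k) comm f = trans (symmetrize-comm k (λ i p q → comm i p (ℕₚ.m<n⇒m<1+n q)) _)
        (symmetrize-cong k (climb-comm k comm f))

    π-comm-< : ∀ {k j} → k < j → Commutes (π j) k
    π-comm-< k<j i p q f = sym (π-comm (ℕₚ.<-≤-trans (s≤s q) k<j) f)

    -- Only commuting generators are needed to pass between the two reduced words.
    symmetrize-sweep : ∀ n f → symmetrize (suc n) f ≈ sweep n (symmetrize n f)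
    symmetrize-sweep zero    f = refl
    symmetrize-sweep (suc n) f = begin
      symmetrize (suc n) (π (suc n) (climb n f))        ≈⟨ symmetrize-sweep n _ ⟩
      sweep n (symmetrize n (π (suc n) (climb n f)))
        ≈⟨ sweep-cong n (symmetrize-comm (π-cong (suc n)) n (π-comm-< (ℕₚ.n<1+n n)) _) ⟨
      sweep n (π (suc n) (symmetrize n (climb n f)))    ∎

    -- One braid move at the right end; the generator, whose index has risen by one, then commutes
    -- with all that remains to its left.
    sweep-π : ∀ n f → sweep (2 ℕ.+ n) (π (1 ℕ.+ n) f) ≈ π (2 ℕ.+ n) (sweep (2 ℕ.+ n) f)
    sweep-π n f = trans (sweep-cong n (π-braid (suc n) f))
      (sym (sweep-comm (π-cong (2 ℕ.+ n)) n (π-comm-< ℕₚ.≤-refl) _))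

    climb-π : ∀ n f → climb (2 ℕ.+ n) (π (2 ℕ.+ n) f) ≈ π (1 ℕ.+ n) (climb (2 ℕ.+ n) f)
    climb-π n f = trans
      (π-cong (2 ℕ.+ n) (π-cong (1 ℕ.+ n) (sym (climb-comm (π-cong (2 ℕ.+ n)) n (π-comm-< ℕₚ.≤-refl) f))))
      (sym (π-braid (suc n) _))

    -- Every generator can be brought to the left end of the word. A generator of S_k is there by
    -- induction; the new one is obtained from the preceding one, which `sweep-π` carries to the
    -- left with its index raised.
    symmetrize-image : ∀ k i → 1 ≤ i → i < k → ∀ f → ∃[ g ] symmetrize k f ≈ π i g
    symmetrize-image (suc k) i p q f with ℕₚ.m≤n⇒m<n∨m≡n (s≤s⁻¹ q)
    ... | inj₁ i<k = symmetrize-image k i p i<k (climb k f)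
    symmetrize-image (suc .1) 1 p q f | inj₂ ≡.refl = f , refl
    symmetrize-image (suc .(2 ℕ.+ n)) (suc (suc n)) p q f | inj₂ ≡.refl
      with symmetrize-image (2 ℕ.+ n) (suc n) (s≤s z≤n) ℕₚ.≤-refl f
    ... | g , e = sweep (2 ℕ.+ n) g ,
      trans (symmetrize-sweep (2 ℕ.+ n) f) (trans (sweep-cong (2 ℕ.+ n) e) (sweep-π n g))

    symmetrize-invariant : ∀ k f → Invariant k (symmetrize k f)
    symmetrize-invariant k f i p q with symmetrize-image k i p q f
    ... | g , e = trans (ren-cong _ e) (trans (σ-π i g) (sym e))

    -- The mirror image of `symmetrize-image`: every generator can also be brought to the right end
    -- of the word, where it acts first.
    symmetrize-kills : ∀ k i → 1 ≤ i → i < k → ∀ f → π i f ≈ 0# → symmetrize k f ≈ 0#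
    symmetrize-kills (suc k) i p q f e with ℕₚ.m≤n⇒m<n∨m≡n (s≤s⁻¹ q)
    ... | inj₁ i<k = trans (symmetrize-sweep k f)
                           (trans (sweep-cong k (symmetrize-kills k i p i<k f e)) (sweep-zero k))
    symmetrize-kills (suc .1) 1 p q f e | inj₂ ≡.refl = e
    symmetrize-kills (suc .(2 ℕ.+ n)) (suc (suc n)) p q f e | inj₂ ≡.refl =
      symmetrize-kills (2 ℕ.+ n) (suc n) (s≤s z≤n) ℕₚ.≤-refl _
        (trans (sym (climb-π n f)) (trans (climb-cong (2 ℕ.+ n) e) (climb-zero (2 ℕ.+ n))))

    π-kills : ∀ i {f} → σ i f ≈ f → π i (ε i * f) ≈ 0#
    π-kills i {f} fixed = sym (π-unique i (begin
      (x i - x (suc i)) * 0#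
        ≈⟨ solve 4 (λ d a b f → d :* con ℤ.0ℤ := a :* (b :* f) :- b :* (a :* f)) refl _ (ε (suc i)) (ε i) f ⟩
      ε (suc i) * (ε i * f) - ε i * (ε (suc i) * f)
        ≈⟨ +-congˡ (-‿cong (*-congˡ (trans (ren-* _ _ _) (*-cong (σ-ε (s-left i)) fixed)))) ⟨
      ε (suc i) * (ε i * f) - ε i * σ i (ε i * f) ∎))

    -- Factorial powers

    pw : ℕ → Carrier → Carrier
    pw a t = ∏ a (λ j → t ⊕ y (suc j))

    -- The sum telescopes by (a - z)(1 + β(a ⊕ Y)) = (1 + βa)((a ⊕ Y) - (z ⊕ Y)), and it ends with a
    -- - z = (1 + βz)(a ⊕ Y) - (1 + βa)(z ⊕ Y). In the application t is the staircase exponent that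
    -- `Φ n` adds to the part of this row.
    Row-pw : ∀ l d t a z →
      (a - z) * Row l d (λ j → z ⊕ y (suc (suc (t ℕ.+ j)))) (λ c → pw (c ℕ.+ t) a) ≈
      (1# + β * z) * pw (suc (l ℕ.+ d ℕ.+ t)) a
        - (1# + β * a) * (pw (l ℕ.+ t) a * ∏ (suc d) (λ j → z ⊕ y (suc (l ℕ.+ t ℕ.+ j))))
    Row-pw zero zero t a z rewrite ℕₚ.+-identityʳ t = begin
      (a - z) * pw t a
        ≈⟨ solve 5 (λ b a z Y p →
             let plus = λ u v → u :+ v :+ b :* u :* v ; one = con ℤ.1ℤ in
             (a :- z) :* p := (one :+ b :* z) :* (p :* plus a Y) :- (one :+ b :* a) :* (p :* (plus z Y :* one)))
             refl β a z (y (suc t)) (pw t a) ⟩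
      (1# + β * z) * (pw t a * (a ⊕ y (suc t))) - (1# + β * a) * (pw t a * ((z ⊕ y (suc t)) * 1#))
        ≈⟨ +-congʳ (*-congˡ (∏-snoc t _)) ⟨
      (1# + β * z) * pw (suc t) a - (1# + β * a) * (pw t a * ((z ⊕ y (suc t)) * 1#)) ∎
    Row-pw zero (suc d) t a z = begin
      (a - z) * ((pw t a + pw (suc t) a * β) * ∏ (suc d) u + Row 0 d (u ∘ suc) (λ c → pw (suc c ℕ.+ t) a))
        ≈⟨ *-congˡ (+-cong (*-cong (+-congˡ (*-congʳ (∏-snoc t _))) refl)
             (Row-cong 0 d (λ j → reflexive (≡.cong (λ k → z ⊕ y (suc (suc k))) (ℕₚ.+-suc t j)))
                           (λ c _ _ → reflexive (≡.cong (λ k → pw k a) (≡.sym (ℕₚ.+-suc c t)))))) ⟩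
      (a - z) * ((p + p * (a ⊕ y (suc t)) * β) * W + S)
        ≈⟨ solve 5 (λ d b q w S → d :* ((b :+ q) :* w :+ S) := d :* (b :+ q) :* w :+ d :* S) refl _ _ _ _ _ ⟩
      (a - z) * (p + p * (a ⊕ y (suc t)) * β) * W + (a - z) * S
        ≈⟨ +-congˡ (Row-pw zero d (suc t) a z) ⟩
      (a - z) * (p + p * (a ⊕ y (suc t)) * β) * W + ((1# + β * z) * pw (suc (d ℕ.+ suc t)) a
        - (1# + β * a) * (pw (suc t) a * W))
        ≈⟨ +-congˡ (+-congˡ (-‿cong (*-congˡ (*-congʳ (∏-snoc t _))))) ⟩
      (a - z) * (p + p * (a ⊕ y (suc t)) * β) * W + ((1# + β * z) * pw (suc (d ℕ.+ suc t)) a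
        - (1# + β * a) * (p * (a ⊕ y (suc t)) * W))
        ≈⟨ solve 7 (λ b a z Y p W q →
             let plus = λ u v → u :+ v :+ b :* u :* v ; one = con ℤ.1ℤ in
             (a :- z) :* (p :+ p :* plus a Y :* b) :* W :+
               ((one :+ b :* z) :* q :- (one :+ b :* a) :* (p :* plus a Y :* W)) :=
             (one :+ b :* z) :* q :- (one :+ b :* a) :* (p :* (plus z Y :* W)))
             refl β a z (y (suc t)) p W (pw (suc (d ℕ.+ suc t)) a) ⟩
      (1# + β * z) * pw (suc (d ℕ.+ suc t)) a - (1# + β * a) * (p * ((z ⊕ y (suc t)) * W))
        ≈⟨ +-cong (*-congˡ (reflexive (≡.cong (λ k → pw (suc k) a) (ℕₚ.+-suc d t))))
             (-‿cong (*-congˡ (*-congˡ (*-cong (reflexive (≡.cong (λ k → z ⊕ y (suc k)) (≡.sym (ℕₚ.+-identityʳ t))))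
               (∏-cong (suc d) λ j _ → reflexive (≡.cong (λ k → z ⊕ y (suc k)) (≡.sym (ℕₚ.+-suc t j)))))))) ⟩
      (1# + β * z) * pw (suc (suc d ℕ.+ t)) a
        - (1# + β * a) * (p * ∏ (suc (suc d)) (λ j → z ⊕ y (suc (t ℕ.+ j)))) ∎
      where
      u : ℕ → Carrier
      u j = z ⊕ y (suc (suc (t ℕ.+ j)))
      p = pw t a
      W = ∏ (suc d) u
      S = Row 0 d (λ j → z ⊕ y (suc (suc (suc t ℕ.+ j)))) (λ c → pw (c ℕ.+ suc t) a)
    Row-pw (suc l) d t a z = begin
      (a - z) * Row l d (λ j → z ⊕ y (suc (suc (t ℕ.+ suc j)))) (λ c → pw (suc c ℕ.+ t) a)
        ≈⟨ *-congˡ (Row-cong l d (λ j → reflexive (≡.cong (λ k → z ⊕ y (suc (suc k))) (ℕₚ.+-suc t j)))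
                                 (λ c _ _ → reflexive (≡.cong (λ k → pw k a) (≡.sym (ℕₚ.+-suc c t))))) ⟩
      (a - z) * Row l d (λ j → z ⊕ y (suc (suc (suc t ℕ.+ j)))) (λ c → pw (c ℕ.+ suc t) a)
        ≈⟨ Row-pw l d (suc t) a z ⟩
      (1# + β * z) * pw (suc (l ℕ.+ d ℕ.+ suc t)) a
        - (1# + β * a) * (pw (l ℕ.+ suc t) a * ∏ (suc d) (λ j → z ⊕ y (suc (l ℕ.+ suc t ℕ.+ j))))
        ≡⟨ ≡.cong₂ (λ k k′ → (1# + β * z) * pw (suc k) a
             - (1# + β * a) * (pw k′ a * ∏ (suc d) (λ j → z ⊕ y (suc (k′ ℕ.+ j)))))
             (ℕₚ.+-suc (l ℕ.+ d) t) (ℕₚ.+-suc l t) ⟩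
      (1# + β * z) * pw (suc (suc l ℕ.+ d ℕ.+ t)) a
        - (1# + β * a) * (pw (suc l ℕ.+ t) a * ∏ (suc d) (λ j → z ⊕ y (suc (suc l ℕ.+ t ℕ.+ j)))) ∎

    -- Branching

    private
      -- y₀ occurs in none of the polynomials of interest, so it can serve as a further variable.
      z : Carrier
      z = y 0

    Eval : ℕ → Carrier → Carrier
    Eval n = ren (plug x[ suc n ])

    Eval-π : ∀ n → Commutes (Eval n) n
    Eval-π n i p q f = π-ren i (plug x[ suc n ]) ≡.refl ≡.refl
      (λ v → ≡.trans (≡.cong (λ r → plug x[ r ] (swapVar i v)) (≡.sym (s-above (s≤s q))))
                     (plug-swapVar i x[ suc n ] v)) f

    invariant-Eval : ∀ {n k} → k ≤ n → ∀ {a} → Invariant k a → Invariant k (Eval n a)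
    invariant-Eval {n} k≤n {a} inv i p q = trans (ren-∘ _ _ a)
      (trans (ren-ext (λ v → ≡.trans (≡.sym (plug-swapVar i x[ suc n ] v))
                         (≡.cong (λ r → plug x[ r ] (swapVar i v)) (s-above (s≤s (ℕₚ.<-≤-trans q k≤n))))) a)
      (trans (sym (ren-∘ _ _ a)) (ren-cong _ (inv i p q))))

    -- With a = z this supplies the multiplier x - z of every row at once. It is symmetric in x₁,
    -- ..., xₙ, so it passes through `symmetrize n`.
    Vanishing : ℕ → Carrier → Carrier
    Vanishing n a = ∏ n (λ i → x (suc i) - a)

    Vanishing-snoc : ∀ n a → Vanishing (suc n) a ≈ Vanishing n a * (x (suc n) - a)
    Vanishing-snoc n a = ∏-snoc n (λ i → x (suc i) - a)

    Vanishing-invariant : ∀ n {a} → Invariant n a → Invariant n (Vanishing n a)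
    Vanishing-invariant (suc n) {a} inv i p q with ℕₚ.m≤n⇒m<n∨m≡n (s≤s⁻¹ q)
    ... | inj₁ i<n = begin
      σ i (Vanishing (suc n) a)                         ≈⟨ ren-cong _ (∏-snoc n _) ⟩
      σ i (Vanishing n a * (x (suc n) - a))             ≈⟨ ren-* _ _ _ ⟩
      σ i (Vanishing n a) * σ i (x (suc n) - a)
        ≈⟨ *-cong (Vanishing-invariant n (invariant-pred inv) i p i<n)
                  (trans (ren-- _ _ _) (+-cong (σ-x (s-above (s≤s i<n))) (-‿cong (inv i p q)))) ⟩
      Vanishing n a * (x (suc n) - a)                   ≈⟨ ∏-snoc n _ ⟨
      Vanishing (suc n) a                               ∎
    Vanishing-invariant (suc .(suc m)) {a} inv (suc m) p q | inj₂ ≡.refl = begin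
      σ i (Vanishing (suc (suc m)) a)                   ≈⟨ ren-cong _ (trans (Vanishing-snoc (suc m) a) (*-congʳ (Vanishing-snoc m a))) ⟩
      σ i (Vanishing m a * (x i - a) * (x (suc i) - a))
        ≈⟨ trans (ren-* _ _ _) (*-cong (ren-* _ _ _) (factor (s-right i))) ⟩
      σ i (Vanishing m a) * σ i (x i - a) * (x i - a)
        ≈⟨ *-congʳ (*-cong (trans (ren-∏ _ m _) (∏-cong m (λ j j<m → factor (s-below (s≤s j<m))))) (factor (s-left i))) ⟩
      Vanishing m a * (x (suc i) - a) * (x i - a)
        ≈⟨ solve 3 (λ a b c → a :* b :* c := a :* c :* b) refl _ _ _ ⟩
      Vanishing m a * (x i - a) * (x (suc i) - a)       ≈⟨ trans (Vanishing-snoc (suc m) a) (*-congʳ (Vanishing-snoc m a)) ⟨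
      Vanishing (suc (suc m)) a                         ∎
      where
      i = suc m
      factor : ∀ {r t} → s i r ≡ t → σ i (x r - a) ≈ x t - a
      factor e = trans (ren-- _ _ _) (+-cong (σ-x e) (-‿cong (inv i p q)))

    -- Each operator of the sweep consumes the last remaining factor, by π_i (x_i - a) = 1 + βa; the
    -- other factors are free of x_i and x_{i+1}.
    sweep-Vanishing : ∀ m {a} → Invariant (suc m) a → sweep m (Vanishing m a) ≈ ∏ m (λ _ → 1# + β * a)
    sweep-Vanishing zero    inv = refl
    sweep-Vanishing (suc m) {a} inv = begin
      sweep m (π i (Vanishing (suc m) a))
        ≈⟨ sweep-cong m (π-cong i (∏-snoc m _)) ⟩
      sweep m (π i (Vanishing m a * (x i - a)))
        ≈⟨ sweep-cong m (π-scale i (trans (ren-∏ _ m _)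
             (∏-cong m (λ j j<m → factor (s-below (s≤s j<m))))) _) ⟩
      sweep m (Vanishing m a * π i (x i - a))
        ≈⟨ sweep-cong m (trans (*-congˡ linear) (*-comm _ _)) ⟩
      sweep m ((1# + β * a) * Vanishing m a)
        ≈⟨ sweep-scale m (λ j p q → trans (ren-1+β _ _) (+-congˡ (*-congˡ (invariant-pred inv j p q)))) _ ⟩
      (1# + β * a) * sweep m (Vanishing m a)
        ≈⟨ *-congˡ (sweep-Vanishing m (invariant-pred inv)) ⟩
      ∏ (suc m) (λ _ → 1# + β * a) ∎
      where
      i = suc m
      fixed = inv i (s≤s z≤n) ℕₚ.≤-refl
      factor : ∀ {r t} → s i r ≡ t → σ i (x r - a) ≈ x t - a
      factor e = trans (ren-- _ _ _) (+-cong (σ-x e) (-‿cong fixed))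
      linear : π i (x i - a) ≈ 1# + β * a
      linear = sym (π-unique i (begin
        (x i - x (suc i)) * (1# + β * a)
          ≈⟨ solve 4 (λ b x₁ x₂ a → let one = con ℤ.1ℤ in
               (x₁ :- x₂) :* (one :+ b :* a) :=
               (one :+ b :* x₂) :* (x₁ :- a) :- (one :+ b :* x₁) :* (x₂ :- a)) refl β (x i) (x (suc i)) a ⟩
        ε (suc i) * (x i - a) - ε i * (x (suc i) - a)
          ≈⟨ +-congˡ (-‿cong (*-congˡ (factor (s-left i)))) ⟨
        ε (suc i) * (x i - a) - ε i * σ i (x i - a) ∎))

    -- In the first operator only the unswapped term survives at z = xₙ₊₁, because the swap turns xₙ
    -- - z into xₙ₊₁ - z. The unswapped term contains xₙ - xₙ₊₁, which cancels the denominator;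
    -- `sweep-Vanishing` treats the operators that remain.
    Eval-sweep : ∀ n {Q} → Invariant n Q → Eval n (sweep n (Vanishing n z * Q)) ≈ ∏ n (λ _ → ε (suc n)) * Eval n Q
    Eval-sweep zero    {Q} inv = trans (ren-* _ _ _) (*-congʳ (ren-1 _))
    Eval-sweep (suc m) {Q} inv = begin
      Eval N (sweep m (π N (Vanishing N z * Q)))
        ≈⟨ sweep-comm (ren-cong _) m (Eval-π N) _ ⟩
      sweep m (Eval N (π N (Vanishing N z * Q)))
        ≈⟨ sweep-cong m (x-difference-regular i≢1+i quotient) ⟩
      sweep m ((ε (suc N) * Eval N Q) * Vanishing m (x (suc N)))
        ≈⟨ sweep-scale m (invariant-* (λ i p q → σ-ε (s-above (s≤s q)))
                                      (invariant-Eval ℕₚ.≤-refl inv)) _ ⟩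
      (ε (suc N) * Eval N Q) * sweep m (Vanishing m (x (suc N)))
        ≈⟨ *-congˡ (sweep-Vanishing m (λ i p q → σ-x (s-above (s≤s q)))) ⟩
      (ε (suc N) * Eval N Q) * ∏ m (λ _ → ε (suc N))
        ≈⟨ solve 3 (λ a b c → (a :* b) :* c := (a :* c) :* b) refl _ _ _ ⟩
      ∏ N (λ _ → ε (suc N)) * Eval N Q ∎
      where
      N = suc m
      Eval-factor : ∀ i → Eval N (x i - z) ≈ x i - x (suc N)
      Eval-factor i = trans (ren-- _ _ _) (+-cong (ren-var _ _) (-‿cong (ren-var _ _)))
      Eval-ε : ∀ i → Eval N (ε i) ≈ ε i
      Eval-ε i = trans (ren-1+β _ _) (+-congˡ (*-congˡ (ren-var _ _)))
      L = Vanishing N z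
      swapped : Eval N (σ N (L * Q)) ≈ 0#
      swapped = begin
        Eval N (σ N (L * Q))
          ≈⟨ ren-cong _ (trans (ren-* _ _ _) (*-congʳ (trans (ren-cong _ (∏-snoc m _)) (ren-* _ _ _)))) ⟩
        Eval N (σ N (Vanishing m z) * σ N (x N - z) * σ N Q)
          ≈⟨ ren-cong _ (*-congʳ (*-congˡ (trans (ren-- _ _ _) (+-cong (σ-x (s-left N)) (-‿cong (σ-y N 0)))))) ⟩
        Eval N (σ N (Vanishing m z) * (x (suc N) - z) * σ N Q)
          ≈⟨ trans (ren-* _ _ _) (*-congʳ (trans (ren-* _ _ _) (*-congˡ (trans (Eval-factor (suc N)) (-‿inverseʳ _))))) ⟩
        Eval N (σ N (Vanishing m z)) * 0# * Eval N (σ N Q)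
          ≈⟨ solve 2 (λ a b → a :* con ℤ.0ℤ :* b := con ℤ.0ℤ) refl _ _ ⟩
        0# ∎
      quotient : (x N - x (suc N)) * Eval N (π N (L * Q)) ≈
                 (x N - x (suc N)) * ((ε (suc N) * Eval N Q) * Vanishing m (x (suc N)))
      quotient = begin
        (x N - x (suc N)) * Eval N (π N (L * Q))
          ≈⟨ ren-equation _ (trans (ren-- _ _ _) (+-cong (ren-var _ _) (-‿cong (ren-var _ _))))
               (Eval-ε (suc N)) (Eval-ε N) (π-spec N (L * Q)) ⟩
        ε (suc N) * Eval N (L * Q) - ε N * Eval N (σ N (L * Q))
          ≈⟨ +-cong (*-congˡ (trans (ren-* _ _ _) (*-congʳ (trans (ren-cong _ (∏-snoc m _)) (trans (ren-* _ _ _)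
                (*-cong (trans (ren-∏ _ m _) (∏-cong m (λ i _ → Eval-factor (suc i)))) (Eval-factor N)))))))
                (-‿cong (*-congˡ swapped)) ⟩
        ε (suc N) * (Vanishing m (x (suc N)) * (x N - x (suc N)) * Eval N Q) - ε N * 0#
          ≈⟨ solve 5 (λ e v d q e′ → e :* (v :* d :* q) :- e′ :* con ℤ.0ℤ := d :* ((e :* q) :* v)) refl _ _ _ _ _ ⟩
        (x N - x (suc N)) * ((ε (suc N) * Eval N Q) * Vanishing m (x (suc N))) ∎

    -- Setting z = x_{n+1} leaves only the terms of symmetrize (n + 1) in which x_{n+1} stays last.
    Eval-symmetrize : ∀ n {q} h → Invariant n q →
      Eval n (symmetrize (suc n) (Vanishing n z * (q * h))) ≈
      ∏ n (λ _ → ε (suc n)) * (Eval n q * symmetrize n (Eval n h))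
    Eval-symmetrize n {q} h inv = begin
      Eval n (symmetrize (suc n) (Vanishing n z * (q * h)))
        ≈⟨ ren-cong _ (symmetrize-sweep n _) ⟩
      Eval n (sweep n (symmetrize n (Vanishing n z * (q * h))))
        ≈⟨ ren-cong _ (sweep-cong n (trans
             (symmetrize-scale n (Vanishing-invariant n (λ i _ _ → σ-y i 0)) _)
             (*-congˡ (symmetrize-scale n inv h)))) ⟩
      Eval n (sweep n (Vanishing n z * (q * symmetrize n h)))
        ≈⟨ Eval-sweep n (invariant-* inv (symmetrize-invariant n h)) ⟩
      ∏ n (λ _ → ε (suc n)) * Eval n (q * symmetrize n h)
        ≈⟨ *-congˡ (trans (ren-* _ _ _) (*-congˡ
             (symmetrize-comm (ren-cong _) n (Eval-π n) h))) ⟩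
      ∏ n (λ _ → ε (suc n)) * (Eval n q * symmetrize n (Eval n h)) ∎

-- The branching rule for symmetrized products.

module BranchingRule where

  open import Defs using (x[_]; y[_]; s; swapVar)
  open AdjacentTranspositions
  open StripSums
  open DividedDifferences
  open Symmetrizers
  open import Level using (0ℓ)
  open import Algebra.Bundles using (CommutativeRing)
  open import Data.Nat as ℕ using (ℕ; zero; suc; _∸_; _≤_; _<_; z≤n; s≤s)
  import Data.Nat.Properties as ℕₚ
  open import Data.Nat.Tactic.RingSolver using (solve-∀)
  open import Function using (_∘_)
  open import Relation.Binary.PropositionalEquality as ≡ using (_≡_)

  module Branching (R : CommutativeRing 0ℓ 0ℓ) (A : GrothendieckAlgebra R) where
    open CommutativeRing R hiding (zero)
    open GrothendieckAlgebra A
    open Symmetrization R A public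
    open import Relation.Binary.Reasoning.Setoid setoid

    private
      z : Carrier
      z = y 0

    ren-pw : ∀ {ρ} → (∀ j → ρ y[ suc j ] ≡ y[ suc j ]) → ∀ a t → ren ρ (pw a t) ≈ pw a (ren ρ t)
    ren-pw {ρ} fixes a t = trans (ren-∏ ρ a _) (∏-cong a (λ j _ → trans (ren-⊕ ρ _ _)
      (⊕-cong refl (trans (ren-var ρ _) (reflexive (≡.cong var (fixes j)))))))

    pw-cong : ∀ a {t t′} → t ≈ t′ → pw a t ≈ pw a t′
    pw-cong a e = ∏-cong a (λ j _ → ⊕-cong e refl)

    σ-pw : ∀ {i r t} → s i r ≡ t → ∀ a → σ i (pw a (x r)) ≈ pw a (x t)
    σ-pw e a = trans (ren-pw (λ _ → ≡.refl) a _) (pw-cong a (σ-x e))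

    -- Freeness from y₀. All v are taken together because moving `plug v` past `swapVar i` changes
    -- v.
    Plugless : Carrier → Set
    Plugless f = ∀ v → ren (plug v) f ≈ f

    plugless-π : ∀ i {f} → Plugless f → Plugless (π i f)
    plugless-π i {f} pl v = x-difference-regular i≢1+i (begin
      (x i - x (suc i)) * ren (plug v) (π i f)
        ≈⟨ ren-equation _ (trans (ren-- _ _ _) (+-cong (ren-var _ _) (-‿cong (ren-var _ _))))
             (trans (ren-1+β _ _) (+-congˡ (*-congˡ (ren-var _ _))))
             (trans (ren-1+β _ _) (+-congˡ (*-congˡ (ren-var _ _)))) (π-spec i f) ⟩
      ε (suc i) * ren (plug v) f - ε i * ren (plug v) (σ i f)
        ≈⟨ +-cong (*-congˡ (pl v)) (-‿cong (*-congˡ (begin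
             ren (plug v) (σ i f)                ≈⟨ ren-∘ _ _ f ⟩
             ren (plug v ∘ swapVar i) f
               ≈⟨ ren-ext (λ w → ≡.trans (≡.cong (λ v → plug v (swapVar i w)) (≡.sym (swapVar-involutive i v)))
                                         (plug-swapVar i (swapVar i v) w)) f ⟩
             ren (swapVar i ∘ plug (swapVar i v)) f ≈⟨ ren-∘ _ _ f ⟨
             σ i (ren (plug (swapVar i v)) f)    ≈⟨ ren-cong _ (pl _) ⟩
             σ i f                               ∎))) ⟩
      ε (suc i) * f - ε i * σ i f
        ≈⟨ π-spec i f ⟨
      (x i - x (suc i)) * π i f ∎)

    plugless-climb : ∀ n {f} → Plugless f → Plugless (climb n f)
    plugless-climb zero    pl = pl
    plugless-climb (suc n) pl = plugless-π (suc n) (plugless-climb n pl)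

    plugless-symmetrize : ∀ k {f} → Plugless f → Plugless (symmetrize k f)
    plugless-symmetrize zero    pl = pl
    plugless-symmetrize (suc k) pl = plugless-symmetrize k (plugless-climb k pl)

    -- The double Grothendieck polynomial of the Grassmannian permutation of μ with descent at k.
    Φ : ℕ → (ℕ → ℕ) → Carrier
    Φ k μ = symmetrize k (∏ k (λ i → pw (μ i ℕ.+ (k ∸ suc i)) (x (suc i))))

    plugless-Φ : ∀ k μ → Plugless (Φ k μ)
    plugless-Φ k μ = plugless-symmetrize k (λ v → trans (ren-∏ _ k _)
      (∏-cong k (λ i _ → trans (ren-pw (λ _ → ≡.refl) (μ i ℕ.+ (k ∸ suc i)) _)
                               (pw-cong (μ i ℕ.+ (k ∸ suc i)) (ren-var _ _)))))

    ∏-ε-cancel : ∀ n v {f g} → ∏ n (λ _ → 1# + β * var v) * f ≈ ∏ n (λ _ → 1# + β * var v) * g → f ≈ g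
    ∏-ε-cancel zero    v e = trans (sym (*-identityˡ _)) (trans e (*-identityˡ _))
    ∏-ε-cancel (suc n) v e = ∏-ε-cancel n v (regular (1+β-cancel v)
      (trans (sym (*-assoc _ _ _)) (trans e (*-assoc _ _ _))))

    module _ (n : ℕ) (λs : ℕ → ℕ) (dec : Decreasing λs) where
      private
        expo : ℕ → ℕ
        expo i = λs i ℕ.+ (n ∸ i)

        p : ℕ → Carrier
        p i = pw (expo i) (x (suc i))

        l d : ℕ → ℕ
        l i = λs (suc i)
        d i = λs i ∸ λs (suc i)

        -- `V i` is the sum over row i of the strip, combined with the factor of `Φ n` that depends
        -- on this row. `Row-pw` turns (x_{i+1} - z) V i into `factor i`, whose second term carries
        -- `expo (suc i)`, the exponent of the next variable in `Φ (suc n)`.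
        U V : ℕ → Carrier → Carrier
        U i a = ∏ (suc (d i)) (λ j → a ⊕ y (suc (expo (suc i) ℕ.+ j)))
        V i a = Row (l i) (d i) (λ j → a ⊕ y (suc n ℕ.+ j ∸ i)) (λ c → pw (c ℕ.+ (n ∸ suc i)) (x (suc i)))

        factor : ℕ → Carrier
        factor i = (1# + β * z) * p i - (1# + β * x (suc i)) * (pw (expo (suc i)) (x (suc i)) * U i z)

        index-eq : ∀ i j → i < n → suc n ℕ.+ j ∸ i ≡ suc (suc (n ∸ suc i ℕ.+ j))
        index-eq i j i<n = ≡.trans (≡.cong (λ m → suc m ℕ.+ j ∸ i) (≡.sym (ℕₚ.m+[n∸m]≡n i<n)))
          (≡.trans (≡.cong (_∸ i) (lemma i (n ∸ suc i) j)) (ℕₚ.m+n∸m≡n i _))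
          where
          lemma : ∀ i t j → suc (suc i ℕ.+ t) ℕ.+ j ≡ i ℕ.+ suc (suc (t ℕ.+ j))
          lemma = solve-∀

        expo-eq : ∀ i → i < n → suc (l i ℕ.+ d i ℕ.+ (n ∸ suc i)) ≡ expo i
        expo-eq i i<n = ≡.trans (≡.cong (λ m → suc (m ℕ.+ (n ∸ suc i))) (ℕₚ.m+[n∸m]≡n (dec i)))
          (≡.trans (≡.sym (ℕₚ.+-suc (λs i) _)) (≡.cong (λs i ℕ.+_) (≡.sym (ℕₚ.+-∸-assoc 1 i<n))))

        V-spec : ∀ i → i < n → (x (suc i) - z) * V i z ≈ factor i
        V-spec i i<n = begin
          (x (suc i) - z) * V i z
            ≈⟨ *-congˡ (Row-cong (l i) (d i) (λ j → reflexive (≡.cong (λ k → z ⊕ y k) (index-eq i j i<n)))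
                                             (λ _ _ _ → refl)) ⟩
          _ ≈⟨ Row-pw (l i) (d i) (n ∸ suc i) (x (suc i)) z ⟩
          _ ≈⟨ +-congʳ (*-congˡ (reflexive (≡.cong (λ k → pw k (x (suc i))) (expo-eq i i<n)))) ⟩
          factor i ∎

        σ-U : ∀ k i → σ k (U i z) ≈ U i z
        σ-U k i = trans (ren-∏ _ (suc (d i)) (λ j → z ⊕ y (suc (expo (suc i) ℕ.+ j)))) (∏-cong (suc (d i))
          (λ j _ → trans (ren-⊕ _ _ _) (⊕-cong (σ-y k 0) (σ-y k (suc (expo (suc i) ℕ.+ j))))))

        σ-factor : ∀ k i → suc i < k → σ k (factor i) ≈ factor i
        σ-factor k i i<k = trans (ren-- _ _ _) (+-cong
          (trans (ren-* _ _ _) (*-cong (trans (ren-1+β _ _) (+-congˡ (*-congˡ (σ-y k 0)))) (σ-pw (s-below i<k) (expo i))))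
          (-‿cong (trans (ren-* _ _ _) (*-cong (σ-ε (s-below i<k)) (trans (ren-* _ _ _)
            (*-cong (σ-pw (s-below i<k) (expo (suc i))) (σ-U k i)))))))

        -- In the last factor the second term pairs with p (suc j) to a multiple of ε times a
        -- symmetric element, which symmetrize kills.
        peel : ∀ j → j ≤ n → ∀ {T} → Invariant (suc j) T →
          symmetrize (suc n) (∏ j factor * (p j * T)) ≈
          ∏ j (λ _ → 1# + β * z) * symmetrize (suc n) (∏ j p * (p j * T))
        peel zero    j≤n {T} inv = sym (*-identityˡ _)
        peel (suc j) j<n {T} inv = begin
          symmetrize (suc n) (∏ (suc j) factor * (q * T))
            ≈⟨ symmetrize-cong (suc n) (*-congʳ (∏-snoc j factor)) ⟩
          symmetrize (suc n) ((F * factor j) * (q * T))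
            -- Adding `K`, which is killed, cancels the second term of `factor j`.
            ≈⟨ trans (sym (+-identityʳ _)) (+-congˡ (sym killed)) ⟩
          symmetrize (suc n) ((F * factor j) * (q * T)) + symmetrize (suc n) K
            ≈⟨ symmetrize-+ (suc n) _ _ ⟨
          symmetrize (suc n) ((F * factor j) * (q * T) + K)
            ≈⟨ symmetrize-cong (suc n) (solve 8 (λ F c P e r u q T →
                 (F :* (c :* P :- e :* (r :* u))) :* (q :* T) :+ e :* ((F :* (T :* u)) :* (r :* q)) :=
                 c :* (F :* (P :* (q :* T)))) refl F _ (p j) _ r (U j z) q T) ⟩
          symmetrize (suc n) ((1# + β * z) * (F * (p j * (q * T))))
            ≈⟨ symmetrize-scale (suc n) (λ i _ _ → trans (ren-1+β _ _) (+-congˡ (*-congˡ (σ-y i 0)))) _ ⟩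
          (1# + β * z) * symmetrize (suc n) (F * (p j * (q * T)))
            -- `q` involves only x_{j+2} among the x's, so it can join T, which must be symmetric in
            -- x₁, ..., x_{j+1} for the next row.
            ≈⟨ *-congˡ (peel j (ℕₚ.<⇒≤ j<n) (invariant-* (λ i _ i<j → σ-pw (s-above (s≤s i<j)) (expo (suc j)))
                                                         (invariant-pred inv))) ⟩
          (1# + β * z) * (∏ j (λ _ → 1# + β * z) * symmetrize (suc n) (∏ j p * (p j * (q * T))))
            ≈⟨ sym (*-assoc _ _ _) ⟩
          ∏ (suc j) (λ _ → 1# + β * z) * symmetrize (suc n) (∏ j p * (p j * (q * T)))
            ≈⟨ *-congˡ (symmetrize-cong (suc n) (trans (sym (*-assoc _ _ _)) (*-congʳ (sym (∏-snoc j p))))) ⟩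
          ∏ (suc j) (λ _ → 1# + β * z) * symmetrize (suc n) (∏ (suc j) p * (q * T)) ∎
          where
          F = ∏ j factor
          q = p (suc j)
          r = pw (expo (suc j)) (x (suc j))
          K = ε (suc j) * ((F * (T * U j z)) * (r * q))
          symmetric : σ (suc j) ((F * (T * U j z)) * (r * q)) ≈ (F * (T * U j z)) * (r * q)
          symmetric = trans (ren-* _ _ _) (*-cong
            (trans (ren-* _ _ _) (*-cong
              (trans (ren-∏ _ j _) (∏-cong j (λ i i<j → σ-factor (suc j) i (s≤s i<j))))
              (trans (ren-* _ _ _) (*-cong (inv (suc j) (s≤s z≤n) ℕₚ.≤-refl)
                (σ-U (suc j) j)))))
            (trans (ren-* _ _ _) (trans (*-cong (σ-pw (s-left (suc j)) (expo (suc j)))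
                                                (σ-pw (s-right (suc j)) (expo (suc j)))) (*-comm _ _))))
          killed : symmetrize (suc n) K ≈ 0#
          killed = symmetrize-kills (suc n) (suc j) (s≤s z≤n) (s≤s j<n) K (π-kills (suc j) symmetric)

        Eval-V : ∀ i → i < n → Eval n (V i z) ≈ V i (x (suc n))
        Eval-V i i<n = trans (ren-Row _ (l i) (d i) _ _) (Row-cong (l i) (d i)
          (λ j → trans (ren-⊕ _ _ _) (⊕-cong (ren-var _ _) (Eval-y j)))
          (λ c _ _ → trans (ren-pw (λ _ → ≡.refl) (c ℕ.+ (n ∸ suc i)) _) (pw-cong (c ℕ.+ (n ∸ suc i)) (ren-var _ _))))
          where
          Eval-y : ∀ j → Eval n (y (suc n ℕ.+ j ∸ i)) ≈ y (suc n ℕ.+ j ∸ i)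
          Eval-y j rewrite index-eq i j i<n = ren-var _ _

      -- The power `E` arises twice: on one side from the constants 1 + βz of the surviving terms,
      -- on the other from symmetrizing the product of the x_i - z. It is regular and can be
      -- cancelled.
      branching : Φ (suc n) λs ≈ Strip n λs (λ i j → x (suc n) ⊕ y (suc n ℕ.+ j ∸ i)) (Φ n) * pw (λs n) (x (suc n))
      branching = ∏-ε-cancel n x[ suc n ] (begin
        E * Φ (suc n) λs
          ≈⟨ *-cong (trans (ren-∏ _ n _) (∏-cong n (λ _ _ → trans (ren-1+β _ _) (+-congˡ (*-congˡ (ren-var _ _))))))
                    (plugless-Φ (suc n) λs x[ suc n ]) ⟨
        Eval n (∏ n (λ _ → 1# + β * z)) * Eval n (Φ (suc n) λs)
          ≈⟨ ren-* _ _ _ ⟨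
        Eval n (∏ n (λ _ → 1# + β * z) * Φ (suc n) λs)
          ≈⟨ ren-cong _ (*-congˡ (symmetrize-cong (suc n) (trans (∏-snoc n p) (*-congˡ (sym (*-identityʳ _)))))) ⟩
        Eval n (∏ n (λ _ → 1# + β * z) * symmetrize (suc n) (∏ n p * (p n * 1#)))
          ≈⟨ ren-cong _ (peel n ℕₚ.≤-refl (λ _ _ _ → ren-1 _)) ⟨
        Eval n (symmetrize (suc n) (∏ n factor * (p n * 1#)))
          ≈⟨ ren-cong _ (symmetrize-cong (suc n) (*-cong (sym (∏-cong n V-spec)) (*-identityʳ _))) ⟩
        Eval n (symmetrize (suc n) (∏ n (λ i → (x (suc i) - z) * V i z) * p n))
          ≈⟨ ren-cong _ (symmetrize-cong (suc n) (trans (*-congʳ (sym (∏-* n _ _)))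
               (trans (*-assoc _ _ _) (*-congˡ (*-comm _ _))))) ⟩
        Eval n (symmetrize (suc n) (Vanishing n z * (p n * ∏ n (λ i → V i z))))
          ≈⟨ Eval-symmetrize n _ (λ i _ i<n → σ-pw (s-above (s≤s i<n)) (expo n)) ⟩
        E * (Eval n (p n) * symmetrize n (Eval n (∏ n (λ i → V i z))))
          ≈⟨ *-congˡ (*-cong (trans (ren-pw (λ _ → ≡.refl) (expo n) _) (pw-cong (expo n) (ren-var _ _)))
               (symmetrize-cong n (trans (ren-∏ _ n _) (trans (∏-cong n Eval-V) (sym (*-identityˡ _)))))) ⟩
        E * (p n * symmetrize n (1# * ∏ n (λ i → V i (x (suc n)))))
          ≈⟨ *-congˡ (*-cong (reflexive (≡.cong (λ k → pw k (x (suc n)))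
                 (≡.trans (≡.cong (λs n ℕ.+_) (ℕₚ.n∸n≡0 n)) (ℕₚ.+-identityʳ _))))
               (trans (Strip-expand (symmetrize n) (symmetrize-cong n) (symmetrize-+ n)
                         (pull (λ i _ _ → ren-β _)) n dec (λ i j → pull (λ k _ k<n →
                            trans (ren-⊕ _ _ _) (⊕-cong (σ-x (s-above (s≤s k<n))) (σ-y k _)))) 1# _)
                      (Strip-cong n dec (λ _ _ _ → refl) (λ μ _ → symmetrize-cong n (*-identityˡ _))))) ⟩
        E * (pw (λs n) (x (suc n)) * Strip n λs (λ i j → x (suc n) ⊕ y (suc n ℕ.+ j ∸ i)) (Φ n))
          ≈⟨ *-congˡ (*-comm _ _) ⟩
        E * (Strip n λs (λ i j → x (suc n) ⊕ y (suc n ℕ.+ j ∸ i)) (Φ n) * pw (λs n) (x (suc n))) ∎)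
        where
        E = ∏ n (λ _ → ε (suc n))
        pull : ∀ {a} → Invariant n a → ∀ f → symmetrize n (f * a) ≈ symmetrize n f * a
        pull inv f = trans (symmetrize-cong n (*-comm _ _)) (trans (symmetrize-scale n inv f) (*-comm _ _))

-- Lehmer codes, lengths and first ascents.

module Inversions where

  open import Defs
  open AdjacentTranspositions
  open import Data.Bool using (true; false; if_then_else_)
  open import Data.List using (List; []; _∷_; _++_; map; filter; length; cartesianProduct; applyUpTo; upTo; head; foldr)
  import Data.List.Properties as Listₚ
  open import Data.Maybe using (just; nothing)
  open import Data.Nat
  open import Data.Nat.Properties
  open import Data.Nat.Combinatorics using (_C_; nCk+nC[k+1]≡[n+1]C[k+1]; nC1≡n)
  open import Data.Nat.Tactic.RingSolver using (solve-∀)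
  open import Data.Product using (_×_; _,_; ∃-syntax)
  open import Data.Sum using (_⊎_; inj₁; inj₂)
  open import Function using (_∘_; id)
  open import Function.Bundles using (_⇔_; mk⇔; Equivalence)
  open import Relation.Nullary using (¬_; Dec; yes; no; does; _×-dec_; contradiction)
  open import Relation.Nullary.Decidable using (does-⇔; dec-true; dec-false)
  open import Relation.Unary using (Decidable)
  open import Relation.Binary.Definitions using (tri<; tri≈; tri>)
  open import Relation.Binary.PropositionalEquality using (_≡_; _≢_; refl; sym; trans; cong; cong₂; subst; module ≡-Reasoning)

  [_]ᵇ : {P : Set} → Dec P → ℕ
  [ P? ]ᵇ = if does P? then 1 else 0

  []ᵇ-cong : {P Q : Set} (P? : Dec P) (Q? : Dec Q) → P ⇔ Q → [ P? ]ᵇ ≡ [ Q? ]ᵇ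
  []ᵇ-cong P? Q? e = cong (if_then 1 else 0) (does-⇔ e P? Q?)

  []ᵇ-yes : {P : Set} (P? : Dec P) → P → [ P? ]ᵇ ≡ 1
  []ᵇ-yes P? p = cong (if_then 1 else 0) (dec-true P? p)

  []ᵇ-no : {P : Set} (P? : Dec P) → ¬ P → [ P? ]ᵇ ≡ 0
  []ᵇ-no P? ¬p = cong (if_then 1 else 0) (dec-false P? ¬p)

  []ᵇ≤1 : {P : Set} (P? : Dec P) → [ P? ]ᵇ ≤ 1
  []ᵇ≤1 P? with does P?
  ... | true  = ≤-refl
  ... | false = z≤n

  sum₁ : ℕ → (ℕ → ℕ) → ℕ
  sum₁ zero    f = 0
  sum₁ (suc n) f = sum₁ n f + f (suc n)

  sum₁-cong : ∀ n {f g} → (∀ j → 1 ≤ j → j ≤ n → f j ≡ g j) → sum₁ n f ≡ sum₁ n g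
  sum₁-cong zero    e = refl
  sum₁-cong (suc n) e = cong₂ _+_ (sum₁-cong n (λ j p q → e j p (m≤n⇒m≤1+n q))) (e (suc n) (s≤s z≤n) ≤-refl)

  sum₁-+ : ∀ n f g → sum₁ n (λ j → f j + g j) ≡ sum₁ n f + sum₁ n g
  sum₁-+ zero    f g = refl
  sum₁-+ (suc n) f g = trans (cong (_+ (f (suc n) + g (suc n))) (sum₁-+ n f g))
    (lemma (sum₁ n f) (sum₁ n g) (f (suc n)) (g (suc n)))
    where
    lemma : ∀ a b c d → a + b + (c + d) ≡ a + c + (b + d)
    lemma = solve-∀

  sum₁-mono : ∀ n {f g} → (∀ j → 1 ≤ j → j ≤ n → f j ≤ g j) → sum₁ n f ≤ sum₁ n g
  sum₁-mono zero    e = z≤n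
  sum₁-mono (suc n) e = +-mono-≤ (sum₁-mono n (λ j p q → e j p (m≤n⇒m≤1+n q))) (e (suc n) (s≤s z≤n) ≤-refl)

  sum₁-const : ∀ n c → sum₁ n (λ _ → c) ≡ n * c
  sum₁-const zero    c = refl
  sum₁-const (suc n) c = trans (cong (_+ c) (sum₁-const n c)) (+-comm (n * c) c)

  sum₁-null : ∀ n {f} → (∀ j → 1 ≤ j → j ≤ n → f j ≡ 0) → sum₁ n f ≡ 0
  sum₁-null n e = trans (sum₁-cong n e) (trans (sum₁-const n 0) (*-zeroʳ n))

  sum₁-s : ∀ n i (f : ℕ → ℕ) → 1 ≤ i → i < n → sum₁ n (f ∘ s i) ≡ sum₁ n f
  sum₁-s (suc n) (suc i) f p q with m≤n⇒m<n∨m≡n (s≤s⁻¹ q)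
  ... | inj₁ i<n = cong₂ _+_ (sum₁-s n (suc i) f p i<n) (cong f (s-above (s≤s i<n)))
  sum₁-s (suc .(suc i)) (suc i) f p q | inj₂ refl = begin
    sum₁ i (f ∘ s (suc i)) + f (s (suc i) (suc i)) + f (s (suc i) (suc (suc i)))
      ≡⟨ cong₂ _+_ (cong₂ _+_ (sum₁-cong i (λ j _ j≤i → cong f (s-below (s≤s j≤i))))
                              (cong f (s-left (suc i)))) (cong f (s-right (suc i))) ⟩
    sum₁ i f + f (suc (suc i)) + f (suc i)
      ≡⟨ lemma (sum₁ i f) (f (suc (suc i))) (f (suc i)) ⟩
    sum₁ i f + f (suc i) + f (suc (suc i)) ∎
    where
    open ≡-Reasoning
    lemma : ∀ a b c → a + b + c ≡ a + c + b
    lemma = solve-∀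

  sum₁-interval : ∀ n a b → a ≤ b → b ≤ n → sum₁ n (λ j → [ (a <? j) ×-dec (j ≤? b) ]ᵇ) ≡ b ∸ a
  sum₁-interval zero    zero zero    _ _ = refl
  sum₁-interval (suc n) a b a≤b b≤n with m≤n⇒m<n∨m≡n b≤n
  ... | inj₁ b<n = trans (cong₂ _+_ (sum₁-interval n a b a≤b (s≤s⁻¹ b<n))
                                    ([]ᵇ-no ((a <? suc n) ×-dec (suc n ≤? b)) (λ (_ , q) → <⇒≱ b<n q)))
                         (+-identityʳ _)
  ... | inj₂ refl with m≤n⇒m<n∨m≡n a≤b
  ...   | inj₂ refl = trans (sum₁-null (suc n) {λ j → [ (suc n <? j) ×-dec (j ≤? suc n) ]ᵇ}
                        (λ j _ q → []ᵇ-no ((suc n <? j) ×-dec (j ≤? suc n)) (λ (p , _) → <⇒≱ p q))) (sym (n∸n≡0 n))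
  ...   | inj₁ a<b  = begin
    sum₁ n (λ j → [ (a <? j) ×-dec (j ≤? suc n) ]ᵇ) + [ (a <? suc n) ×-dec (suc n ≤? suc n) ]ᵇ
      ≡⟨ cong₂ _+_ (sum₁-cong n (λ j _ q → []ᵇ-cong ((a <? j) ×-dec (j ≤? suc n)) ((a <? j) ×-dec (j ≤? n))
                      (mk⇔ (λ (r , _) → r , q) (λ (r , t) → r , m≤n⇒m≤1+n t))))
                   ([]ᵇ-yes ((a <? suc n) ×-dec (suc n ≤? suc n)) (a<b , ≤-refl)) ⟩
    sum₁ n (λ j → [ (a <? j) ×-dec (j ≤? n) ]ᵇ) + 1
      ≡⟨ cong (_+ 1) (sum₁-interval n a n (s≤s⁻¹ a<b) ≤-refl) ⟩
    n ∸ a + 1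
      ≡⟨ trans (+-comm (n ∸ a) 1) (sym (+-∸-assoc 1 (s≤s⁻¹ a<b))) ⟩
    suc n ∸ a ∎
    where open ≡-Reasoning

  sum₁-delta : ∀ n {i} → 1 ≤ i → i ≤ n → sum₁ n (λ j → [ j ≟ i ]ᵇ) ≡ 1
  sum₁-delta n {suc i} _ i<n = trans
    (sum₁-cong n (λ j _ _ → []ᵇ-cong (j ≟ suc i) ((i <? j) ×-dec (j ≤? suc i))
      (mk⇔ (λ { refl → ≤-refl , ≤-refl }) (λ (p , q) → ≤-antisym q p))))
    (trans (sum₁-interval n i (suc i) (n≤1+n i) i<n) (m+n∸n≡m 1 i))

  -- The Lehmer code, for positions up to n.
  code : ℕ → (ℕ → ℕ) → ℕ → ℕ
  code n u a = sum₁ n (λ j → [ (a <? j) ×-dec (u j <? u a) ]ᵇ)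

  sumᴸ : {A : Set} → List A → (A → ℕ) → ℕ
  sumᴸ xs f = foldr (λ x → f x +_) 0 xs

  length-filter : {A : Set} {P : A → Set} (P? : Decidable P) (xs : List A) →
                  length (filter P? xs) ≡ sumᴸ xs (λ x → [ P? x ]ᵇ)
  length-filter P? []       = refl
  length-filter P? (x ∷ xs) with does (P? x)
  ... | true  = cong suc (length-filter P? xs)
  ... | false = length-filter P? xs

  sumᴸ-++ : {A : Set} (xs ys : List A) (f : A → ℕ) → sumᴸ (xs ++ ys) f ≡ sumᴸ xs f + sumᴸ ys f
  sumᴸ-++ []       ys f = refl
  sumᴸ-++ (x ∷ xs) ys f = trans (cong (f x +_) (sumᴸ-++ xs ys f)) (sym (+-assoc (f x) _ _))

  sumᴸ-map : {A B : Set} (g : A → B) (xs : List A) (f : B → ℕ) → sumᴸ (map g xs) f ≡ sumᴸ xs (f ∘ g)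
  sumᴸ-map g []       f = refl
  sumᴸ-map g (x ∷ xs) f = cong (f (g x) +_) (sumᴸ-map g xs f)

  sumᴸ-product : {A B : Set} (xs : List A) (ys : List B) (f : A × B → ℕ) →
                 sumᴸ (cartesianProduct xs ys) f ≡ sumᴸ xs (λ x → sumᴸ ys (λ y → f (x , y)))
  sumᴸ-product []       ys f = refl
  sumᴸ-product (x ∷ xs) ys f = trans (sumᴸ-++ (map (x ,_) ys) _ f)
                                     (cong₂ _+_ (sumᴸ-map (x ,_) ys f) (sumᴸ-product xs ys f))

  ⟦1…⟧-∷ʳ : ∀ n → ⟦1… suc n ⟧ ≡ ⟦1… n ⟧ ++ (suc n ∷ [])
  ⟦1…⟧-∷ʳ n = trans (cong (map suc) (sym (Listₚ.upTo-∷ʳ n))) (Listₚ.map-++ suc (upTo n) (n ∷ []))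

  sumᴸ-⟦1…⟧ : ∀ n f → sumᴸ ⟦1… n ⟧ f ≡ sum₁ n f
  sumᴸ-⟦1…⟧ zero    f = refl
  sumᴸ-⟦1…⟧ (suc n) f = trans (cong (λ xs → sumᴸ xs f) (⟦1…⟧-∷ʳ n))
    (trans (sumᴸ-++ ⟦1… n ⟧ _ f) (cong₂ _+_ (sumᴸ-⟦1…⟧ n f) (+-identityʳ _)))

  ℓ-code : ∀ n u → ℓ n u ≡ sum₁ n (code n u)
  ℓ-code n u = begin
    ℓ n u
      ≡⟨ length-filter inversion? (cartesianProduct ⟦1… n ⟧ ⟦1… n ⟧) ⟩
    sumᴸ (cartesianProduct ⟦1… n ⟧ ⟦1… n ⟧) (λ p → [ inversion? p ]ᵇ)
      ≡⟨ sumᴸ-product ⟦1… n ⟧ ⟦1… n ⟧ _ ⟩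
    sumᴸ ⟦1… n ⟧ (λ i → sumᴸ ⟦1… n ⟧ (λ j → [ inversion? (i , j) ]ᵇ))
      ≡⟨ sumᴸ-⟦1…⟧ n _ ⟩
    sum₁ n (λ i → sumᴸ ⟦1… n ⟧ (λ j → [ inversion? (i , j) ]ᵇ))
      ≡⟨ sum₁-cong n (λ i _ _ → sumᴸ-⟦1…⟧ n _) ⟩
    sum₁ n (code n u) ∎
    where
    open ≡-Reasoning
    inversion? : ∀ ((i , j) : ℕ × ℕ) → Dec (i < j × u j < u i)
    inversion? (i , j) = (i <? j) ×-dec (u j <? u i)

  s-<-other : ∀ {i a} → a ≢ i → a ≢ suc i → ∀ j → a < s i j ⇔ a < j
  s-<-other {i} {a} ne ne′ j with position i j
  ... | left    rewrite s-left i  = mk⇔ (λ p → ≤∧≢⇒< (s≤s⁻¹ p) ne) m<n⇒m<1+n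
  ... | right   rewrite s-right i = mk⇔ m<n⇒m<1+n (λ p → ≤∧≢⇒< (s≤s⁻¹ p) ne)
  ... | other m m′ rewrite s-other m m′ = mk⇔ id id

  module _ {n i : ℕ} {u : ℕ → ℕ} (1≤i : 1 ≤ i) (i<n : i < n) (asc : u i < u (suc i)) where

    -- The swap creates exactly one inversion, the pair (i, i + 1), which is counted at its left
    -- position i; all other inversions follow the two values that move.
    code-ascent : ∀ a → code n (u ∘ s i) a ≡ code n u (s i a) + [ a ≟ i ]ᵇ
    code-ascent a = begin
      code n (u ∘ s i) a
        ≡⟨ sum₁-cong n (λ j _ _ → []ᵇ-cong ((a <? j) ×-dec (u (s i j) <? u (s i a))) (F? (s i j))
             (mk⇔ (λ (p , q) → subst (a <_) (sym (s-involutive i j)) p , q)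
                  (λ (p , q) → subst (a <_) (s-involutive i j) p , q))) ⟩
      sum₁ n (λ j → [ F? (s i j) ]ᵇ)
        ≡⟨ sum₁-s n i (λ j → [ F? j ]ᵇ) 1≤i i<n ⟩
      sum₁ n (λ j → [ F? j ]ᵇ)
        ≡⟨ split a (position i a) ⟩
      code n u (s i a) + [ a ≟ i ]ᵇ ∎
      where
      open ≡-Reasoning
      F? : ∀ j → Dec (a < s i j × u j < u (s i a))
      F? j = (a <? s i j) ×-dec (u j <? u (s i a))
      split : ∀ a → Position i a →
        sum₁ n (λ j → [ (a <? s i j) ×-dec (u j <? u (s i a)) ]ᵇ) ≡ code n u (s i a) + [ a ≟ i ]ᵇ
      split a (other ne ne′) rewrite s-other ne ne′ = trans
        (sum₁-cong n (λ j _ _ → []ᵇ-cong ((a <? s i j) ×-dec (u j <? u a)) ((a <? j) ×-dec (u j <? u a))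
          (mk⇔ (λ (p , q) → Equivalence.to (s-<-other ne ne′ j) p , q)
               (λ (p , q) → Equivalence.from (s-<-other ne ne′ j) p , q))))
        (sym (trans (cong (code n u a +_) ([]ᵇ-no (a ≟ i) ne)) (+-identityʳ _)))
      split .(suc i) right rewrite s-right i = trans
        (sum₁-cong n (λ j _ _ → []ᵇ-cong ((suc i <? s i j) ×-dec (u j <? u i)) ((i <? j) ×-dec (u j <? u i))
          (pointwise j)))
        (sym (trans (cong (code n u i +_) ([]ᵇ-no (suc i ≟ i) 1+n≢n)) (+-identityʳ _)))
        where
        pointwise : ∀ j → (suc i < s i j × u j < u i) ⇔ (i < j × u j < u i)
        pointwise j with position i j
        ... | left  rewrite s-left i  = mk⇔ (λ (p , _) → contradiction p (<-irrefl refl))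
                                            (λ (p , _) → contradiction p (<-irrefl refl))
        ... | right rewrite s-right i = mk⇔ (λ (_ , q) → contradiction q (<-asym asc))
                                            (λ (_ , q) → contradiction q (<-asym asc))
        ... | other m m′ rewrite s-other m m′ = mk⇔ (λ (p , q) → <-trans (n<1+n i) p , q)
                                                    (λ (p , q) → ≤∧≢⇒< p (m′ ∘ sym) , q)
      split .i left rewrite s-left i = begin
        sum₁ n (λ j → [ (i <? s i j) ×-dec (u j <? u (suc i)) ]ᵇ)
          ≡⟨ sum₁-cong n (λ j _ _ → pointwise j) ⟩
        sum₁ n (λ j → [ (suc i <? j) ×-dec (u j <? u (suc i)) ]ᵇ + [ j ≟ i ]ᵇ)
          ≡⟨ sum₁-+ n _ _ ⟩
        code n u (suc i) + sum₁ n (λ j → [ j ≟ i ]ᵇ)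
          ≡⟨ cong (code n u (suc i) +_) (trans (sum₁-delta n 1≤i (<⇒≤ i<n)) (sym ([]ᵇ-yes (i ≟ i) refl))) ⟩
        code n u (suc i) + [ i ≟ i ]ᵇ ∎
        where
        pointwise : ∀ j → [ (i <? s i j) ×-dec (u j <? u (suc i)) ]ᵇ ≡
                          [ (suc i <? j) ×-dec (u j <? u (suc i)) ]ᵇ + [ j ≟ i ]ᵇ
        pointwise j with position i j
        ... | left rewrite s-left i = trans ([]ᵇ-yes ((i <? suc i) ×-dec (u i <? u (suc i))) (≤-refl , asc))
                (sym (cong₂ _+_ ([]ᵇ-no ((suc i <? i) ×-dec (u i <? u (suc i))) (λ (p , _) → <-asym p (n<1+n i)))
                                ([]ᵇ-yes (i ≟ i) refl)))
        ... | right rewrite s-right i = trans ([]ᵇ-no ((i <? i) ×-dec (u (suc i) <? u (suc i))) (λ (p , _) → <-irrefl refl p))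
                (sym (cong₂ _+_ ([]ᵇ-no ((suc i <? suc i) ×-dec (u (suc i) <? u (suc i))) (λ (p , _) → <-irrefl refl p))
                                ([]ᵇ-no (suc i ≟ i) 1+n≢n)))
        ... | other m m′ rewrite s-other m m′ = trans
                ([]ᵇ-cong ((i <? j) ×-dec (u j <? u (suc i))) ((suc i <? j) ×-dec (u j <? u (suc i)))
                  (mk⇔ (λ (p , q) → ≤∧≢⇒< p (m′ ∘ sym) , q) (λ (p , q) → <-trans (n<1+n i) p , q)))
                (sym (trans (cong ([ (suc i <? j) ×-dec (u j <? u (suc i)) ]ᵇ +_) ([]ᵇ-no (j ≟ i) m)) (+-identityʳ _)))

    ℓ-ascent : ℓ n (u ∘ s i) ≡ suc (ℓ n u)
    ℓ-ascent = begin
      ℓ n (u ∘ s i)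
        ≡⟨ ℓ-code n (u ∘ s i) ⟩
      sum₁ n (code n (u ∘ s i))
        ≡⟨ sum₁-cong n (λ a _ _ → code-ascent a) ⟩
      sum₁ n (λ a → code n u (s i a) + [ a ≟ i ]ᵇ)
        ≡⟨ sum₁-+ n _ _ ⟩
      sum₁ n (code n u ∘ s i) + sum₁ n (λ a → [ a ≟ i ]ᵇ)
        ≡⟨ cong₂ _+_ (sum₁-s n i (code n u) 1≤i i<n) (sum₁-delta n 1≤i (<⇒≤ i<n)) ⟩
      sum₁ n (code n u) + 1
        ≡⟨ cong (_+ 1) (ℓ-code n u) ⟨
      ℓ n u + 1
        ≡⟨ +-comm _ 1 ⟩
      suc (ℓ n u) ∎
      where
      open ≡-Reasoning

  ℓ-cong : ∀ n {u u′} → (∀ i → u i ≡ u′ i) → ℓ n u ≡ ℓ n u′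
  ℓ-cong n {u} {u′} e = trans (ℓ-code n u) (trans
    (sum₁-cong n (λ a _ _ → sum₁-cong n (λ j _ _ → cong₂ (λ p q → [ (a <? j) ×-dec (p <? q) ]ᵇ) (e j) (e a))))
    (sym (ℓ-code n u′)))

  -- Relates `ascents`, which compares lengths, to neighbouring values. A strict descent becomes an
  -- ascent after the swap, so the length drops; equal values are unaffected by it.
  ℓ-nonascent : ∀ {n i u} → 1 ≤ i → i < n → ¬ u i < u (suc i) → ¬ ℓ n u < ℓ n (u ∘ s i)
  ℓ-nonascent {n} {i} {u} p q na lt with <-cmp (u i) (u (suc i))
  ... | tri< a _ _ = na a
  ... | tri≈ _ e _ = <-irrefl (ℓ-cong n fixed) lt
    where
    fixed : ∀ j → u j ≡ u (s i j)
    fixed j with position i j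
    ... | left       = trans e (cong u (sym (s-left i)))
    ... | right      = trans (sym e) (cong u (sym (s-right i)))
    ... | other m m′ = cong u (sym (s-other m m′))
  ... | tri> _ _ gt = <-asym lt (≤-reflexive (sym (trans (ℓ-cong n (λ j → cong u (sym (s-involutive i j))))
          (ℓ-ascent {u = u ∘ s i} p q (subst (λ k → u (s i i) < u k) (sym (s-right i))
            (subst (λ k → u k < u i) (sym (s-left i)) gt))))))

  -- Guarantees that the truncated subtraction in `𝒢` is a true one, so that each step of the
  -- recursion lowers the depth by exactly one.
  ℓ-bound : ∀ n u → ℓ n u ≤ n C 2
  ℓ-bound zero    u = z≤n
  ℓ-bound (suc n) u = begin
    ℓ (suc n) u                                           ≡⟨ ℓ-code (suc n) u ⟩
    sum₁ n (code (suc n) u) + code (suc n) u (suc n)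
      ≡⟨ cong (sum₁ n (code (suc n) u) +_) (sum₁-null (suc n) {λ j → [ (suc n <? j) ×-dec (u j <? u (suc n)) ]ᵇ}
           (λ j _ q → []ᵇ-no ((suc n <? j) ×-dec (u j <? u (suc n))) (λ (p , _) → <⇒≱ p q))) ⟩
    sum₁ n (code (suc n) u) + 0                           ≡⟨ +-identityʳ _ ⟩
    sum₁ n (code (suc n) u)
      ≤⟨ sum₁-mono n {g = λ a → code n u a + 1} (λ a _ _ → +-monoʳ-≤ (code n u a) ([]ᵇ≤1 ((a <? suc n) ×-dec (u (suc n) <? u a)))) ⟩
    sum₁ n (λ a → code n u a + 1)                         ≡⟨ sum₁-+ n _ _ ⟩
    sum₁ n (code n u) + sum₁ n (λ _ → 1)
      ≡⟨ cong₂ _+_ (sym (ℓ-code n u)) (trans (sum₁-const n 1) (*-identityʳ n)) ⟩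
    ℓ n u + n                                             ≤⟨ +-monoˡ-≤ n (ℓ-bound n u) ⟩
    n C 2 + n                                             ≡⟨ +-comm (n C 2) n ⟩
    n + n C 2                                             ≡⟨ cong (_+ n C 2) (nC1≡n n) ⟨
    n C 1 + n C 2                                         ≡⟨ nCk+nC[k+1]≡[n+1]C[k+1] n 1 ⟩
    suc n C 2                                             ∎
    where open ≤-Reasoning

  record FirstAscent (N : ℕ) (u : ℕ → ℕ) (i : ℕ) : Set where
    field
      nonzero   : 1 ≤ i
      bounded   : i ≤ N
      ascent    : u i < u (suc i)
      minimal   : ∀ j → 1 ≤ j → j < i → ¬ u j < u (suc j)

  head-filter : {P : ℕ → Set} (P? : Decidable P) (f : ℕ → ℕ) (n : ℕ) →
    (head (filter P? (map suc (applyUpTo f n))) ≡ nothing × ∀ j → j < n → ¬ P (suc (f j))) ⊎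
    ∃[ i ] (i < n × head (filter P? (map suc (applyUpTo f n))) ≡ just (suc (f i)) × P (suc (f i)) ×
            ∀ j → j < i → ¬ P (suc (f j)))
  head-filter P? f zero    = inj₁ (refl , λ _ ())
  head-filter P? f (suc n) with P? (suc (f 0))
  ... | yes p = inj₂ (0 , z<s , refl , p , λ _ ())
  ... | no ¬p with head-filter P? (f ∘ suc) n
  ...   | inj₁ (e , h) = inj₁ (e , λ { zero _ → ¬p ; (suc j) q → h j (s≤s⁻¹ q) })
  ...   | inj₂ (i , i<n , e , p , h) = inj₂ (suc i , s≤s i<n , e , p , λ { zero _ → ¬p ; (suc j) q → h j (s≤s⁻¹ q) })

  head-ascents : ∀ N u →
    (head (ascents N u) ≡ nothing × ∀ j → 1 ≤ j → j ≤ N → ¬ u j < u (suc j)) ⊎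
    ∃[ i ] (head (ascents N u) ≡ just i × FirstAscent N u i)
  head-ascents N u with head-filter (λ i → ℓ (suc N) u <? ℓ (suc N) (u ∘ s i)) id N
  ... | inj₁ (e , h) = inj₁ (e , λ { (suc j) _ j<N asc → h j j<N
          (≤-reflexive (sym (ℓ-ascent {u = u} (s≤s z≤n) (s≤s j<N) asc))) })
  ... | inj₂ (i , i<N , e , p , h) = inj₂ (suc i , e , record
          { nonzero = s≤s z≤n
          ; bounded = i<N
          ; ascent = ascent
          ; minimal = λ { (suc j) _ j<i asc → h j (s≤s⁻¹ j<i)
              (≤-reflexive (sym (ℓ-ascent {u = u} (s≤s z≤n) (s≤s (<-trans (s≤s⁻¹ j<i) i<N)) asc))) } })
    where
    ascent : u (suc i) < u (suc (suc i))
    ascent with u (suc i) <? u (suc (suc i))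
    ... | yes a = a
    ... | no na = contradiction p (ℓ-nonascent {u = u} (s≤s z≤n) (s≤s i<N) na)

  firstAscent-unique : ∀ {N u i j} → FirstAscent N u i → FirstAscent N u j → i ≡ j
  firstAscent-unique {i = i} {j} p q with <-cmp i j
  ... | tri< lt _ _ = contradiction (FirstAscent.ascent p) (FirstAscent.minimal q i (FirstAscent.nonzero p) lt)
  ... | tri≈ _ e _  = e
  ... | tri> _ _ gt = contradiction (FirstAscent.ascent q) (FirstAscent.minimal p j (FirstAscent.nonzero q) gt)

-- The recursion for double Grothendieck polynomials and the sorting of a prefix.

module GrothendieckRecursion where

  open import Defs
  open AdjacentTranspositions
  open Functionals
  open PolynomialRing
  open IntegerCoefficients
  open DividedDifferences
  open BranchingRule
  open Inversions
  open import Algebra.Bundles using (CommutativeRing)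
  open import Data.List using (head)
  import Data.List.Properties as Listₚ
  open import Data.Maybe using (just; nothing)
  open import Data.Nat
  open import Data.Nat.Properties
  open import Data.Nat.Combinatorics using (_C_)
  open import Data.Product using (_,_)
  open import Data.Sum using (inj₁; inj₂)
  open import Function using (_∘_)
  open import Relation.Nullary using (yes; no; contradiction)
  open import Relation.Binary.PropositionalEquality as ≡ using (_≡_; _≢_; refl; sym; trans; cong; module ≡-Reasoning)

  merge-x : ∀ i → merge i x[ i ] ≡ x[ suc i ]
  merge-x i with x[ i ] ≟ⱽ x[ i ]
  ... | yes _ = refl
  ... | no ne = contradiction refl ne

  merge-other : ∀ {i v} → v ≢ x[ i ] → merge i v ≡ v
  merge-other {i} {v} ne with v ≟ⱽ x[ i ]
  ... | yes e = contradiction e ne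
  ... | no _  = refl

  merge-x-suc : ∀ i → merge i x[ suc i ] ≡ x[ suc i ]
  merge-x-suc i = merge-other {i} λ ()

  merge-swapVar : ∀ i v → merge i (swapVar i v) ≡ merge i v
  merge-swapVar i y[ r ] = refl
  merge-swapVar i x[ r ] with position i r
  ... | left         = trans (cong (merge i ∘ x[_]) (s-left i)) (trans (merge-x-suc i) (sym (merge-x i)))
  ... | right        = trans (cong (merge i ∘ x[_]) (s-right i)) (trans (merge-x i) (sym (merge-x-suc i)))
  ... | other ne ne′ = cong (merge i ∘ x[_]) (s-other ne ne′)

  module Polynomials = CommutativeRing commutativeRing

  ren-neg : ∀ ρ f → ren ρ (-ᵖ f) ≋ -ᵖ ren ρ f
  ren-neg ρ f = Polynomials.reflexive (trans (sym (Listₚ.map-∘ f)) (Listₚ.map-∘ f))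

  numerator : ℕ → Poly → Poly
  numerator i f = (1ᵖ +ᵖ β *ᵖ X (suc i)) *ᵖ f -ᵖ (1ᵖ +ᵖ β *ᵖ X i) *ᵖ swapX i f

  -- Once xᵢ and xᵢ₊₁ are identified, the swap is invisible and the two products coincide. This is
  -- the exactness of the division in π.
  merge-numerator : ∀ i f → ren (merge i) (numerator i f) ≋ 0ᵖ
  merge-numerator i f = begin
    ren (merge i) (numerator i f)
      ≈⟨ ren-+ (merge i) (E (suc i) *ᵖ f) _ ⟩
    ren (merge i) (E (suc i) *ᵖ f) +ᵖ ren (merge i) (-ᵖ (E i *ᵖ swapX i f))
      ≈⟨ +-cong {ren (merge i) (E (suc i) *ᵖ f)} {E′f} (multiplied (suc i) f (merge-x-suc i))
                (≋-trans {g = -ᵖ ren (merge i) (E i *ᵖ swapX i f)}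
                  (ren-neg (merge i) (E i *ᵖ swapX i f))
                  (neg-cong {ren (merge i) (E i *ᵖ swapX i f)} {E′f} swapped)) ⟩
    E′f +ᵖ (-ᵖ E′f)
      ≈⟨ neg-inverseʳ E′f ⟩
    0ᵖ ∎
    where
    open import Relation.Binary.Reasoning.Setoid Polynomials.setoid
    E : ℕ → Poly
    E r = 1ᵖ +ᵖ β *ᵖ X r
    E′f = E (suc i) *ᵖ ren (merge i) f
    multiplied : ∀ r f → merge i x[ r ] ≡ x[ suc i ] → ren (merge i) (E r *ᵖ f) ≋ E (suc i) *ᵖ ren (merge i) f
    multiplied r f e = ≋-trans {g = ren (merge i) (E r) *ᵖ ren (merge i) f} (ren-* (merge i) (E r) f)
      (*-cong {ren (merge i) (E r)} {E (suc i)} {ren (merge i) f} {ren (merge i) f}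
        (Polynomials.reflexive (cong (λ w → 1ᵖ +ᵖ β *ᵖ var w) e)) ≋-refl)
    swapped : ren (merge i) (E i *ᵖ swapX i f) ≋ E′f
    swapped = ≋-trans {g = E (suc i) *ᵖ ren (merge i) (swapX i f)} (multiplied i (swapX i f) (merge-x i))
      (*-cong {E (suc i)} {E (suc i)} {ren (merge i) (swapX i f)} {ren (merge i) f} ≋-refl
        (≋-trans {g = ren (merge i ∘ swapVar i) f} (ren-∘ (merge i) (swapVar i) f) (ren-ext (merge-swapVar i) f)))

  polynomialAlgebra : GrothendieckAlgebra commutativeRing
  polynomialAlgebra = record
    { var = var
    ; β = β
    ; ren = ren
    ; ren-cong = ren-cong
    ; ren-+ = ren-+
    ; ren-* = ren-*
    ; ren-neg = ren-neg
    ; ren-1 = λ ρ → ≋-refl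
    ; ren-β = λ ρ → ≋-refl
    ; ren-var = λ ρ v → ≋-refl
    ; ren-∘ = ren-∘
    ; ren-ext = ren-ext
    ; ren-id = ren-id
    ; π = π
    ; π-spec = λ i f → Division.exact-quotient commutativeRing {X i} {X (suc i)} {π i f} {numerator i f} {ren (merge i) (numerator i f)}
        (quotient-spec i (numerator i f)) (merge-numerator i f)
    ; var-difference-cancel = var-difference-cancel
    ; 1+β-cancel = 1+β-cancel
    }

  module B = Branching commutativeRing polynomialAlgebra

  -- The recursion for double Grothendieck polynomials

  ascents-cong : ∀ N {u u′} → (∀ i → u i ≡ u′ i) → ascents N u ≡ ascents N u′
  ascents-cong N {u} {u′} e = Listₚ.filter-≐
    (λ i → ℓ (suc N) u <? ℓ (suc N) (u ∘ s i)) (λ i → ℓ (suc N) u′ <? ℓ (suc N) (u′ ∘ s i))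
    ( (λ {i} → ≡.subst₂ _<_ (ℓ-cong (suc N) e) (ℓ-cong (suc N) (e ∘ s i)))
    , (λ {i} → ≡.subst₂ _<_ (sym (ℓ-cong (suc N) e)) (sym (ℓ-cong (suc N) (e ∘ s i)))) ) ⟦1… N ⟧

  𝒢-rec-cong : ∀ N d {u u′} → (∀ i → u i ≡ u′ i) → 𝒢-rec N d u ≡ 𝒢-rec N d u′
  𝒢-rec-cong N zero    e = refl
  𝒢-rec-cong N (suc d) {u} {u′} e rewrite ascents-cong N e with head (ascents N u′)
  ... | nothing = refl
  ... | just i  = cong (π i) (𝒢-rec-cong N d (e ∘ s i))

  𝒢-cong : ∀ N {u u′} → (∀ i → u i ≡ u′ i) → 𝒢 N u ≡ 𝒢 N u′
  𝒢-cong N {u} {u′} e = trans (cong (λ k → 𝒢-rec N (suc N C 2 ∸ k) u) (ℓ-cong (suc N) e)) (𝒢-rec-cong N (suc N C 2 ∸ ℓ (suc N) u′) e)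

  -- The default of `maybe′` is `𝒢₀ N` too, so the depth need not be computed here.
  𝒢-last : ∀ N u → head (ascents N u) ≡ nothing → 𝒢 N u ≡ 𝒢₀ N
  𝒢-last N u e with suc N C 2 ∸ ℓ (suc N) u
  ... | zero  = refl
  ... | suc d rewrite e = refl

  depth-ascent : ∀ {N u i} → FirstAscent N u i →
                 suc N C 2 ∸ ℓ (suc N) u ≡ suc (suc N C 2 ∸ ℓ (suc N) (u ∘ s i))
  depth-ascent {N} {u} {i} fa = begin
    suc N C 2 ∸ ℓ (suc N) u                 ≡⟨ cong (suc (suc N C 2) ∸_) (ℓ-ascent {u = u} nonzero (s≤s bounded) ascent) ⟨
    suc (suc N C 2) ∸ ℓ (suc N) (u ∘ s i)   ≡⟨ +-∸-assoc 1 (ℓ-bound (suc N) (u ∘ s i)) ⟩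
    suc (suc N C 2 ∸ ℓ (suc N) (u ∘ s i))   ∎
    where
    open ≡-Reasoning
    open FirstAscent fa

  𝒢-step : ∀ {N u i} → FirstAscent N u i → 𝒢 N u ≡ π i (𝒢 N (u ∘ s i))
  𝒢-step {N} {u} {i} fa rewrite depth-ascent fa with head-ascents N u
  ... | inj₁ (_ , none) = contradiction (FirstAscent.ascent fa) (none i (FirstAscent.nonzero fa) (FirstAscent.bounded fa))
  ... | inj₂ (j , e , fa′) rewrite e | firstAscent-unique fa fa′ = refl

  -- Sorting the increasing prefix of a Grassmannian permutation

  -- The cycle s_p ⋯ s_1. Precomposition with it moves the value at p + 1 to the front and shifts
  -- the first p values one place to the right.
  cycle : ℕ → ℕ → ℕ
  cycle zero    r = r
  cycle (suc p) r = s (suc p) (cycle p r)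

  cycle-above : ∀ p {r} → suc p < r → cycle p r ≡ r
  cycle-above zero    q = refl
  cycle-above (suc p) q = trans (cong (s (suc p)) (cycle-above p (<-trans (n<1+n _) q))) (s-above q)

  cycle-1 : ∀ p → cycle p 1 ≡ suc p
  cycle-1 zero    = refl
  cycle-1 (suc p) = trans (cong (s (suc p)) (cycle-1 p)) (s-left (suc p))

  cycle-suc : ∀ p {r} → 1 ≤ r → r ≤ p → cycle p (suc r) ≡ r
  cycle-suc zero    {suc r} _ ()
  cycle-suc (suc p) {r} 1≤r r≤p with m≤n⇒m<n∨m≡n r≤p
  ... | inj₁ r<p  = trans (cong (s (suc p)) (cycle-suc p 1≤r (s≤s⁻¹ r<p))) (s-below r<p)
  ... | inj₂ refl = trans (cong (s (suc p)) (cycle-above p (n<1+n _))) (s-right (suc p))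

  -- When a decreasing prefix of length p is followed by a larger value, the first ascent is p.
  -- After the swap the larger value stands at p and the first ascent is p - 1, so the recursion
  -- itself carries that value to the front.
  𝒢-insert : ∀ N p u → p ≤ N → (∀ i → 1 ≤ i → i < p → u (suc i) < u i) →
             (∀ i → 1 ≤ i → i ≤ p → u i < u (suc p)) → 𝒢 N u ≡ B.climb p (𝒢 N (u ∘ cycle p))
  𝒢-insert N zero    u p≤N desc max = refl
  𝒢-insert N (suc p) u p≤N desc max = trans
    (𝒢-step record { nonzero = s≤s z≤n ; bounded = p≤N ; ascent = max (suc p) (s≤s z≤n) ≤-refl
                    ; minimal = λ j q r → <-asym (desc j q r) })
    (cong (π (suc p)) (𝒢-insert N p (u ∘ s (suc p)) (<⇒≤ p≤N)
      (λ i q r → ≡.subst₂ (λ a b → u a < u b) (sym (s-below (s≤s r))) (sym (s-below (m<n⇒m<1+n r))) (desc i q (m<n⇒m<1+n r)))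
      (λ i q r → ≡.subst₂ (λ a b → u a < u b) (sym (s-below (s≤s r))) (sym (s-left (suc p))) (max i q (m≤n⇒m≤1+n r)))))

  reversePrefix : ℕ → (ℕ → ℕ) → ℕ → ℕ
  reversePrefix zero    w = w
  reversePrefix (suc p) w = reversePrefix p w ∘ cycle p

  mutual
    reversePrefix-≤ : ∀ p w {i} → 1 ≤ i → i ≤ p → reversePrefix p w i ≡ w (suc p ∸ i)
    reversePrefix-≤ (suc p) w {suc zero}    _ _ = trans (cong (reversePrefix p w) (cycle-1 p)) (reversePrefix-> p w (n<1+n p))
    reversePrefix-≤ (suc p) w {suc (suc i)} _ q =
      trans (cong (reversePrefix p w) (cycle-suc p (s≤s z≤n) (s≤s⁻¹ q))) (reversePrefix-≤ p w (s≤s z≤n) (s≤s⁻¹ q))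

    reversePrefix-> : ∀ p w {i} → p < i → reversePrefix p w i ≡ w i
    reversePrefix-> zero    w q = refl
    reversePrefix-> (suc p) w q =
      trans (cong (reversePrefix p w) (cycle-above p q)) (reversePrefix-> p w (<-trans (n<1+n p) q))

  module _ {k : ℕ} {w : ℕ → ℕ} (inc : ∀ {i j : ℕ} → 1 ≤ i → i < j → j ≤ k → w i < w j) where

    reversePrefix-descends : ∀ {p i j} → p ≤ k → 1 ≤ i → i < j → j ≤ p → reversePrefix p w j < reversePrefix p w i
    reversePrefix-descends {p} {i} {j} p≤k 1≤i i<j j≤p = ≡.subst₂ _<_
      (sym (reversePrefix-≤ p w (≤-trans 1≤i (<⇒≤ i<j)) j≤p)) (sym (reversePrefix-≤ p w 1≤i (≤-trans (<⇒≤ i<j) j≤p)))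
      (inc (m<n⇒0<n∸m (s≤s j≤p)) (∸-monoʳ-< i<j (m≤n⇒m≤1+n j≤p)) (≤-trans (∸-monoʳ-≤ (suc p) 1≤i) p≤k))

    -- An insertion sort: inserting the value at p + 1 applies `climb p` inside `symmetrize p`,
    -- which is how `symmetrize (suc p)` is built.
    𝒢-sort : ∀ N p → p ≤ k → p ≤ suc N → 𝒢 N w ≡ B.symmetrize p (𝒢 N (reversePrefix p w))
    𝒢-sort N zero    _   _   = refl
    𝒢-sort N (suc p) p<k p<N = trans (𝒢-sort N p (<⇒≤ p<k) (<⇒≤ p<N)) (cong (B.symmetrize p)
      (𝒢-insert N p (reversePrefix p w) (s≤s⁻¹ p<N)
        (λ i q r → reversePrefix-descends (<⇒≤ p<k) q (n<1+n i) r)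
        (λ i q r → ≡.subst₂ _<_ (sym (reversePrefix-≤ p w q r)) (sym (reversePrefix-> p w (n<1+n p)))
          (inc (m<n⇒0<n∸m (s≤s r)) (∸-monoʳ-< q (m≤n⇒m≤1+n r)) p<k))))

-- Products of factorial powers and the action of π on them.

module MonomialProducts where

  open import Defs hiding (var; β; π; X; Y; _⊕_)
  open AdjacentTranspositions
  open StripSums
  open DividedDifferences
  open BranchingRule
  open Inversions
  open import Level using (0ℓ)
  open import Algebra.Bundles using (CommutativeRing)
  open import Data.Bool using (true; false; if_then_else_; T)
  open import Data.Unit using (tt)
  open import Data.List using (List; []; _∷_; _++_; map; filter; cartesianProduct; applyUpTo; foldr)
  open import Data.List.Relation.Unary.All as All using ([]; _∷_)
  open import Data.List.Relation.Unary.Linked as Linked using ([]; _∷_)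
  open import Data.Nat as ℕ using (ℕ; zero; suc; _≤_; _<_; z≤n; s≤s; z<s; s≤s⁻¹; _∸_; _≤?_; _≟_)
  import Data.Nat.Properties as ℕₚ
  open import Data.Nat.Properties using (<⇒≱; ≤-trans; ≤-reflexive; +-suc; m+[n∸m]≡n; +-monoʳ-≤; m∸n≤m; <-trans; n<1+n; m≤n⇒m<n∨m≡n)
  open import Data.Product using (_×_; _,_; proj₁; proj₂)
  open import Data.Sum using (inj₁; inj₂)
  open import Function using (_∘_; id)
  open import Relation.Nullary using (Dec; does)
  open import Relation.Nullary.Decidable using (dec-true; dec-false)
  open import Relation.Unary using (Decidable)
  open import Relation.Binary.PropositionalEquality as ≡ using (_≡_; cong; subst)

  module ListProducts (R : CommutativeRing 0ℓ 0ℓ) (β : CommutativeRing.Carrier R) where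
    open CommutativeRing R hiding (zero)
    open Strips R β
    open import Relation.Binary.Reasoning.Setoid setoid

    ∏ᴸ : {A : Set} → List A → (A → Carrier) → Carrier
    ∏ᴸ as f = foldr (λ a → f a *_) 1# as

    ∏ᴸ-++ : {A : Set} (as bs : List A) (f : A → Carrier) → ∏ᴸ (as ++ bs) f ≈ ∏ᴸ as f * ∏ᴸ bs f
    ∏ᴸ-++ []       bs f = sym (*-identityˡ _)
    ∏ᴸ-++ (a ∷ as) bs f = trans (*-congˡ (∏ᴸ-++ as bs f)) (sym (*-assoc _ _ _))

    ∏ᴸ-map : {A B : Set} (g : A → B) (as : List A) (f : B → Carrier) → ∏ᴸ (map g as) f ≈ ∏ᴸ as (f ∘ g)
    ∏ᴸ-map g []       f = refl
    ∏ᴸ-map g (a ∷ as) f = *-congˡ (∏ᴸ-map g as f)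

    ∏ᴸ-product : {A B : Set} (as : List A) (bs : List B) (f : A × B → Carrier) →
                 ∏ᴸ (cartesianProduct as bs) f ≈ ∏ᴸ as (λ a → ∏ᴸ bs (λ b → f (a , b)))
    ∏ᴸ-product []       bs f = refl
    ∏ᴸ-product (a ∷ as) bs f = trans (∏ᴸ-++ (map (a ,_) bs) _ f) (*-cong (∏ᴸ-map (a ,_) bs f) (∏ᴸ-product as bs f))

    ∏ᴸ-filter : {A : Set} {P : A → Set} (P? : Decidable P) (as : List A) (f : A → Carrier) →
                ∏ᴸ (filter P? as) f ≈ ∏ᴸ as (λ a → if does (P? a) then f a else 1#)
    ∏ᴸ-filter P? []       f = refl
    ∏ᴸ-filter P? (a ∷ as) f with does (P? a)
    ... | true  = *-congˡ (∏ᴸ-filter P? as f)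
    ... | false = trans (∏ᴸ-filter P? as f) (sym (*-identityˡ _))

    ∏ᴸ-upTo : ∀ n (g : ℕ → ℕ) (f : ℕ → Carrier) → ∏ᴸ (map suc (applyUpTo g n)) f ≈ ∏ n (λ i → f (suc (g i)))
    ∏ᴸ-upTo zero    g f = refl
    ∏ᴸ-upTo (suc n) g f = *-congˡ (∏ᴸ-upTo n (g ∘ suc) f)

    ∏-truncate : ∀ {k n f} → k ≤ n → (∀ i → k ≤ i → i < n → f i ≈ 1#) → ∏ n f ≈ ∏ k f
    ∏-truncate {zero}  {zero}  _ e = refl
    ∏-truncate {zero}  {suc n} _ e = trans (*-cong (e 0 z≤n z<s) (∏-truncate z≤n (λ i _ q → e (suc i) z≤n (s≤s q))))
                                           (*-identityˡ 1#)
    ∏-truncate {suc k} {suc n} (s≤s k≤n) e = *-congˡ (∏-truncate k≤n (λ i p q → e (suc i) (s≤s p) (s≤s q)))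

    ∏-one : ∀ n {f} → (∀ i → i < n → f i ≈ 1#) → ∏ n f ≈ 1#
    ∏-one n e = ∏-truncate z≤n (λ i _ → e i)

    ∏-delta : ∀ {n k} → k < n → ∀ g → ∏ n (λ i → if does (i ≟ k) then g else 1#) ≈ g
    ∏-delta {suc n} {zero}  _ g = trans (*-congˡ (∏-one n (λ _ _ → refl))) (*-identityʳ g)
    ∏-delta {suc n} {suc k} (s≤s k<n) g = trans (*-identityˡ _) (∏-delta k<n g)

    ∏-s : ∀ n k (f : ℕ → Carrier) → 1 ≤ k → k < n → ∏ n (λ i → f (s k (suc i))) ≈ ∏ n (λ i → f (suc i))
    ∏-s (suc n) (suc k) f p q with m≤n⇒m<n∨m≡n (s≤s⁻¹ q)
    ... | inj₁ k<n = begin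
      ∏ (suc n) (λ i → f (s (suc k) (suc i)))                  ≈⟨ ∏-snoc n _ ⟩
      ∏ n (λ i → f (s (suc k) (suc i))) * f (s (suc k) (suc n))
        ≈⟨ *-cong (∏-s n (suc k) f p k<n) (reflexive (cong f (s-above (s≤s k<n)))) ⟩
      ∏ n (λ i → f (suc i)) * f (suc n)                        ≈⟨ ∏-snoc n _ ⟨
      ∏ (suc n) (λ i → f (suc i))                              ∎
    ∏-s (suc .(suc k)) (suc k) f p q | inj₂ ≡.refl = begin
      ∏ (suc (suc k)) (λ i → f (s (suc k) (suc i)))
        ≈⟨ trans (∏-snoc (suc k) (λ i → f (s (suc k) (suc i)))) (*-congʳ (∏-snoc k (λ i → f (s (suc k) (suc i))))) ⟩
      ∏ k (λ i → f (s (suc k) (suc i))) * f (s (suc k) (suc k)) * f (s (suc k) (suc (suc k)))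
        ≈⟨ *-cong (*-cong (∏-cong k (λ i i<k → reflexive (cong f (s-below (s≤s i<k)))))
                          (reflexive (cong f (s-left (suc k))))) (reflexive (cong f (s-right (suc k)))) ⟩
      ∏ k (λ i → f (suc i)) * f (suc (suc k)) * f (suc k)
        ≈⟨ solve 3 (λ a b c → a :* b :* c := a :* c :* b) refl _ _ _ ⟩
      ∏ k (λ i → f (suc i)) * f (suc k) * f (suc (suc k))
        ≈⟨ trans (∏-snoc (suc k) (λ i → f (suc i))) (*-congʳ (∏-snoc k (λ i → f (suc i)))) ⟨
      ∏ (suc (suc k)) (λ i → f (suc i)) ∎

  module DominantMonomials (R : CommutativeRing 0ℓ 0ℓ) (A : GrothendieckAlgebra R) where
    open CommutativeRing R hiding (zero)
    open GrothendieckAlgebra A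
    open Branching R A
    open ListProducts R β public
    open import Relation.Binary.Reasoning.Setoid setoid

    monomial : ℕ → (ℕ → ℕ) → Carrier
    monomial n c = ∏ n (λ i → pw (c (suc i)) (x (suc i)))

    monomial-cong : ∀ n {c c′} → (∀ i → 1 ≤ i → i ≤ n → c i ≡ c′ i) → monomial n c ≈ monomial n c′
    monomial-cong n e = ∏-cong n (λ i i<n → reflexive (cong (λ a → pw a (x (suc i))) (e (suc i) (s≤s z≤n) i<n)))

    π-⊕ : ∀ k j → π k (x k ⊕ y j) ≈ 1#
    π-⊕ k j = sym (π-unique k (begin
      (x k - x (suc k)) * 1#
        ≈⟨ solve 4 (λ b x₁ x₂ y → let one = con (Data.Integer.+ 1) in
             (x₁ :- x₂) :* one :=
             (one :+ b :* x₂) :* (x₁ :+ y :+ b :* x₁ :* y) :- (one :+ b :* x₁) :* (x₂ :+ y :+ b :* x₂ :* y))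
             refl β (x k) (x (suc k)) (y j) ⟩
      ε (suc k) * (x k ⊕ y j) - ε k * (x (suc k) ⊕ y j)
        ≈⟨ +-congˡ (-‿cong (*-congˡ (trans (ren-⊕ _ _ _) (⊕-cong (σ-x (s-left k)) (σ-y k j))))) ⟨
      ε (suc k) * (x k ⊕ y j) - ε k * σ k (x k ⊕ y j) ∎))
      where import Data.Integer

    -- With equal exponents at k and k + 1 the product for `c` is symmetric in these two variables.
    -- The argument of π is this product times one factor x_k ⊕ y_j, and π sends that factor to 1.
    π-monomial : ∀ n k c → 1 ≤ k → k < n → c k ≡ c (suc k) →
                 π k (monomial n (λ a → c (s k a) ℕ.+ [ a ≟ k ]ᵇ)) ≈ monomial n c
    π-monomial n (suc k) c p k<n e = begin
      π (suc k) (monomial n (λ a → c (s (suc k) a) ℕ.+ [ a ≟ suc k ]ᵇ))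
        ≈⟨ π-cong (suc k) (∏-cong n (λ i _ → pointwise i)) ⟩
      π (suc k) (∏ n (λ i → pw (c (suc i)) (x (suc i)) * (if does (i ≟ k) then g else 1#)))
        ≈⟨ π-cong (suc k) (∏-* n _ _) ⟨
      π (suc k) (monomial n c * ∏ n (λ i → if does (i ≟ k) then g else 1#))
        ≈⟨ π-cong (suc k) (*-congˡ (∏-delta (<-trans (n<1+n k) k<n) g)) ⟩
      π (suc k) (monomial n c * g)
        ≈⟨ π-scale (suc k) symmetric g ⟩
      monomial n c * π (suc k) g
        ≈⟨ trans (*-congˡ (π-⊕ (suc k) _)) (*-identityʳ _) ⟩
      monomial n c ∎
      where
      g = x (suc k) ⊕ y (suc (c (suc k)))
      c-s : ∀ a → c (s (suc k) a) ≡ c a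
      c-s a with position (suc k) a
      ... | left         = ≡.trans (cong c (s-left (suc k))) (≡.sym e)
      ... | right        = ≡.trans (cong c (s-right (suc k))) e
      ... | other ne ne′ = cong c (s-other ne ne′)
      pointwise : ∀ i → pw (c (s (suc k) (suc i)) ℕ.+ [ suc i ≟ suc k ]ᵇ) (x (suc i)) ≈
                        pw (c (suc i)) (x (suc i)) * (if does (i ≟ k) then g else 1#)
      pointwise i = trans (reflexive (cong (λ a → pw (a ℕ.+ [ suc i ≟ suc k ]ᵇ) (x (suc i))) (c-s (suc i))))
                          -- Both tests, `suc i ≟ suc k` and `i ≟ k`, compute to the Boolean
                          -- `i ≡ᵇ k`, on which `bump` splits.
                          (bump i (i ℕ.≡ᵇ k) (λ h → ℕₚ.≡ᵇ⇒≡ i k (subst T (≡.sym h) tt)))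
        where
        bump : ∀ i b → (b ≡ true → i ≡ k) → pw (c (suc i) ℕ.+ (if b then 1 else 0)) (x (suc i)) ≈
                                            pw (c (suc i)) (x (suc i)) * (if b then g else 1#)
        bump i false h = trans (reflexive (cong (λ a → pw a (x (suc i))) (ℕₚ.+-identityʳ (c (suc i))))) (sym (*-identityʳ _))
        bump i true  h with h ≡.refl
        ... | ≡.refl = trans (reflexive (cong (λ a → pw a (x (suc k))) (ℕₚ.+-comm (c (suc k)) 1))) (∏-snoc (c (suc k)) _)
      symmetric : σ (suc k) (monomial n c) ≈ monomial n c
      symmetric = begin
        σ (suc k) (monomial n c)
          ≈⟨ trans (ren-∏ _ n _) (∏-cong n (λ i _ → trans (σ-pw ≡.refl (c (suc i)))
               (reflexive (cong (λ a → pw a (x (s (suc k) (suc i)))) (≡.sym (c-s (suc i))))))) ⟩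
        ∏ n (λ i → pw (c (s (suc k) (suc i))) (x (s (suc k) (suc i))))
          ≈⟨ ∏-s n (suc k) (λ a → pw (c a) (x a)) (s≤s z≤n) k<n ⟩
        monomial n c ∎

    staircase : ∀ n →
      ∏ᴸ (filter (λ (i , j) → i ℕ.+ j ≤? n) (cartesianProduct ⟦1… n ⟧ ⟦1… n ⟧)) (λ (i , j) → x i ⊕ y j) ≈
      monomial n (n ∸_)
    staircase n = begin
      ∏ᴸ (filter below? (cartesianProduct ⟦1… n ⟧ ⟦1… n ⟧)) (λ (i , j) → x i ⊕ y j)
        ≈⟨ ∏ᴸ-filter below? (cartesianProduct ⟦1… n ⟧ ⟦1… n ⟧) _ ⟩
      ∏ᴸ (cartesianProduct ⟦1… n ⟧ ⟦1… n ⟧) (λ p → F p)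
        ≈⟨ ∏ᴸ-product ⟦1… n ⟧ ⟦1… n ⟧ _ ⟩
      ∏ᴸ ⟦1… n ⟧ (λ i → ∏ᴸ ⟦1… n ⟧ (λ j → F (i , j)))
        ≈⟨ ∏ᴸ-upTo n id _ ⟩
      ∏ n (λ i → ∏ᴸ ⟦1… n ⟧ (λ j → F (suc i , j)))
        ≈⟨ ∏-cong n (λ i i<n → begin
             ∏ᴸ ⟦1… n ⟧ (λ j → F (suc i , j))   ≈⟨ ∏ᴸ-upTo n id (λ j → F (suc i , j)) ⟩
             ∏ n (λ j → F (suc i , suc j))
               ≈⟨ ∏-truncate (m∸n≤m n (suc i)) (λ j p _ → reflexive (cong (if_then x (suc i) ⊕ y (suc j) else 1#)
                    (dec-false (below? (suc i , suc j)) (λ q → <⇒≱ (≤-trans (≤-reflexive (≡.sym (+-suc (suc i) j))) q)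
                      (≤-trans (≤-reflexive (≡.sym (m+[n∸m]≡n i<n))) (+-monoʳ-≤ (suc i) p)))))) ⟩
             ∏ (n ∸ suc i) (λ j → F (suc i , suc j))
               ≈⟨ ∏-cong (n ∸ suc i) (λ j q → reflexive (cong (if_then x (suc i) ⊕ y (suc j) else 1#)
                    (dec-true (below? (suc i , suc j)) (≤-trans (+-monoʳ-≤ (suc i) q) (≤-reflexive (m+[n∸m]≡n i<n)))))) ⟩
             pw (n ∸ suc i) (x (suc i))         ∎) ⟩
      monomial n (n ∸_) ∎
      where
      below? : ∀ ((i , j) : ℕ × ℕ) → Dec (i ℕ.+ j ≤ n)
      below? (i , j) = i ℕ.+ j ≤? n
      F : ℕ × ℕ → Carrier
      F p = if does (below? p) then x (proj₁ p) ⊕ y (proj₂ p) else 1#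

-- Dominant permutations and the Grassmannian permutation of a partition.

module GrassmannianPermutations where

  open import Defs hiding (β; _⊕_)
  open AdjacentTranspositions
  open PolynomialRing using (_≋_; commutativeRing)
  open Inversions
  open GrothendieckRecursion
  open MonomialProducts
  open import Data.List using (List; []; _∷_; length)
  import Data.List.Properties as Listₚ
  open import Data.List.Relation.Unary.All as All using ([]; _∷_)
  open import Data.List.Relation.Unary.Linked as Linked using (Linked; []; [-]; _∷_)
  open import Data.Nat
  open import Data.Nat.Properties
  open import Data.Nat.Combinatorics using (_C_)
  open import Data.Product using (_×_; _,_; proj₁; proj₂)
  open import Data.Sum using (inj₁; inj₂)
  open import Function using (_∘_)
  open import Function.Bundles using (mk⇔)
  open import Relation.Nullary using (¬_; yes; no; _×-dec_; contradiction)
  open import Relation.Binary.Definitions using (tri<; tri≈; tri>)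
  open import Relation.Binary.PropositionalEquality as ≡ using (_≡_; _≢_; refl; sym; trans; cong; subst; subst₂)

  open DominantMonomials commutativeRing polynomialAlgebra using (monomial; monomial-cong; π-monomial; staircase; ∏-truncate)

  -- `avoids` is avoidance of the pattern 132.
  record Dominant (n : ℕ) (u : ℕ → ℕ) : Set where
    field
      injective : ∀ {a b} → 1 ≤ a → a ≤ n → 1 ≤ b → b ≤ n → u a ≡ u b → a ≡ b
      avoids    : ∀ {a b c} → 1 ≤ a → a < b → b < c → c ≤ n → u a < u c → ¬ u c < u b

  s-bounds : ∀ {n i r} → 1 ≤ i → i < n → 1 ≤ r → r ≤ n → 1 ≤ s i r × s i r ≤ n
  s-bounds {n} {i} {r} p q 1≤r r≤n with position i r
  ... | left       rewrite s-left i     = s≤s z≤n , q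
  ... | right      rewrite s-right i    = p , <⇒≤ q
  ... | other m m′ rewrite s-other m m′ = 1≤r , r≤n

  s-mono : ∀ {i a b} → a < b → ¬ (a ≡ i × b ≡ suc i) → s i a < s i b
  s-mono {i} {a} {b} a<b ne with position i a | position i b
  ... | left       | left       = contradiction a<b (<-irrefl refl)
  ... | left       | right      = contradiction (refl , refl) ne
  ... | left       | other m m′ rewrite s-left i | s-other m m′ = ≤∧≢⇒< a<b (m′ ∘ sym)
  ... | right      | left       = contradiction a<b (<-asym (n<1+n i))
  ... | right      | right      = contradiction a<b (<-irrefl refl)
  ... | right      | other m m′ rewrite s-right i | s-other m m′ = <-trans (n<1+n i) a<b
  ... | other m m′ | left       rewrite s-left i | s-other m m′ = m<n⇒m<1+n a<b
  ... | other m m′ | right      rewrite s-right i | s-other m m′ = ≤∧≢⇒< (s≤s⁻¹ a<b) m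
  ... | other m m′ | other l l′ rewrite s-other m m′ | s-other l l′ = a<b

  module _ {N : ℕ} {u : ℕ → ℕ} (dom : Dominant (suc N) u) where
    open Dominant dom

    descends-to : ∀ {i} → i ≤ suc N → (∀ j → 1 ≤ j → j < i → ¬ u j < u (suc j)) →
                  ∀ {a b} → 1 ≤ a → a < b → b ≤ i → u b < u a
    descends-to {i} i≤n noasc {a} {suc b} 1≤a a<b b≤i with m≤n⇒m<n∨m≡n (s≤s⁻¹ a<b)
    ... | inj₂ refl = ≤∧≢⇒< (≮⇒≥ (noasc a 1≤a b≤i))
      (λ e → 1+n≢n (injective (s≤s z≤n) (≤-trans b≤i i≤n) 1≤a (≤-trans (<⇒≤ b≤i) i≤n) e))
    ... | inj₁ a<b′ = <-trans (≤∧≢⇒< (≮⇒≥ (noasc b (≤-trans 1≤a (<⇒≤ a<b′)) b≤i))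
      (λ e → 1+n≢n (injective (s≤s z≤n) (≤-trans b≤i i≤n) (≤-trans 1≤a (<⇒≤ a<b′)) (≤-trans (<⇒≤ b≤i) i≤n) e)))
      (descends-to i≤n noasc 1≤a a<b′ (<⇒≤ b≤i))

    -- The swap keeps the order of all positions except i and i + 1, so a new pattern must use both.
    -- As its first two entries they would contradict the ascent at i; as its last two they would
    -- need a smaller value before i, where u decreases.
    dominant-step : ∀ {i} → FirstAscent N u i → Dominant (suc N) (u ∘ s i)
    dominant-step {i} fa = record
      { injective = λ {a} {b} p q r t e →
          let (p′ , q′) = s-bounds nonzero (s≤s bounded) p q
              (r′ , t′) = s-bounds nonzero (s≤s bounded) r t
          in trans (sym (s-involutive i a)) (trans (cong (s i) (injective p′ q′ r′ t′ e)) (s-involutive i b))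
      ; avoids = avoid
      }
      where
      open FirstAscent fa
      avoid : ∀ {a b c} → 1 ≤ a → a < b → b < c → c ≤ suc N → u (s i a) < u (s i c) → ¬ u (s i c) < u (s i b)
      avoid {a} {b} {c} 1≤a a<b b<c c≤n lt gt with (a ≟ i) ×-dec (b ≟ suc i) | (b ≟ i) ×-dec (c ≟ suc i)
      ... | yes (refl , refl) | _ = <-asym ascent (subst₂ (λ p q → u p < u q) (s-left i) (s-right i) (<-trans lt gt))
      ... | no _ | yes (refl , refl) = <-asym
        (subst₂ (λ p q → u p < u q) (s-below a<b) (s-right i) lt)
        (descends-to (≤-trans bounded (n≤1+n N)) minimal 1≤a a<b ≤-refl)
      ... | no ne | no ne′ = avoids (proj₁ (s-bounds nonzero (s≤s bounded) 1≤a (≤-trans (<⇒≤ a<b) (≤-trans (<⇒≤ b<c) c≤n))))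
        (s-mono a<b ne) (s-mono b<c ne′)
        (proj₂ (s-bounds nonzero (s≤s bounded) (≤-trans 1≤a (≤-trans (<⇒≤ a<b) (<⇒≤ b<c))) c≤n)) lt gt

    -- A value strictly between u(i) and u(i + 1) at a later position would complete a pattern 132,
    -- so the two code entries count the same positions.
    code-plateau : ∀ {i} → FirstAscent N u i → code (suc N) u i ≡ code (suc N) u (suc i)
    code-plateau {i} fa = sum₁-cong (suc N) (λ j p q →
      []ᵇ-cong ((i <? j) ×-dec (u j <? u i)) ((suc i <? j) ×-dec (u j <? u (suc i))) (mk⇔ (forth j) (back j p q)))
      where
      open FirstAscent fa
      forth : ∀ j → i < j × u j < u i → suc i < j × u j < u (suc i)
      forth j (i<j , lt) = ≤∧≢⇒< i<j (λ { refl → <-asym lt ascent }) , <-trans lt ascent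
      back : ∀ j → 1 ≤ j → j ≤ suc N → suc i < j × u j < u (suc i) → i < j × u j < u i
      back j p q (i<j , lt) with <-cmp (u j) (u i)
      ... | tri< l _ _ = <-trans (n<1+n i) i<j , l
      ... | tri≈ _ e _ = contradiction (injective p q nonzero (≤-trans bounded (n≤1+n N)) e)
                                       (λ { refl → <-asym i<j (n<1+n i) })
      ... | tri> _ _ g = contradiction lt (avoids nonzero (n<1+n i) i<j q g)

  -- `d` bounds the remaining depth and drives the induction. Without ascents u is decreasing and
  -- its code is the staircase; at a first ascent the code changes as `code-ascent` says, which is
  -- the situation of `π-monomial` by `code-plateau`.
  dominant-𝒢 : ∀ N d u → suc N C 2 ∸ ℓ (suc N) u ≤ d → Dominant (suc N) u →
               𝒢 N u ≋ monomial (suc N) (code (suc N) u)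
  dominant-𝒢 N d u bound dom with head-ascents N u
  ... | inj₁ (e , none) = Polynomials.trans (Polynomials.reflexive (𝒢-last N u e))
    (Polynomials.trans (staircase (suc N)) (monomial-cong (suc N) {suc N ∸_} {code (suc N) u} (λ a p q → sym (trans
      (sum₁-cong (suc N) (λ j _ r → []ᵇ-cong ((a <? j) ×-dec (u j <? u a)) ((a <? j) ×-dec (j ≤? suc N))
        (mk⇔ (λ (t , _) → t , r) (λ (t , _) → t ,
          descends-to dom ≤-refl (λ j p q → none j p (s≤s⁻¹ q)) p t r))))
      (sum₁-interval (suc N) a (suc N) q ≤-refl)))))
  dominant-𝒢 N zero u bound dom | inj₂ (i , e , fa) =
    contradiction (≤-trans (≤-reflexive (sym (depth-ascent fa))) bound) λ ()
  dominant-𝒢 N (suc d) u bound dom | inj₂ (i , e , fa) =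
    Polynomials.trans (Polynomials.reflexive (𝒢-step fa))
    (Polynomials.trans (B.π-cong i (Polynomials.trans
        (dominant-𝒢 N d (u ∘ s i) (s≤s⁻¹ (≤-trans (≤-reflexive (sym (depth-ascent fa))) bound)) (dominant-step dom fa))
        (monomial-cong (suc N) {code (suc N) (u ∘ s i)} {λ a → code (suc N) u (s i a) + [ a ≟ i ]ᵇ}
          (λ a _ _ → code-ascent {u = u} (FirstAscent.nonzero fa) (s≤s (FirstAscent.bounded fa)) (FirstAscent.ascent fa) a))))
      (π-monomial (suc N) i (code (suc N) u) (FirstAscent.nonzero fa) (s≤s (FirstAscent.bounded fa)) (code-plateau dom fa)))

  -- Partitions

  part-beyond : ∀ μ {k} → length μ ≤ k → part μ (suc k) ≡ 0
  part-beyond []      p = refl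
  part-beyond (a ∷ μ) {suc k} (s≤s p) = part-beyond μ p

  part-decreasing : ∀ {μ} → Linked _≥_ μ → ∀ k → part μ (suc (suc k)) ≤ part μ (suc k)
  part-decreasing []      k       = z≤n
  part-decreasing [-]     k       = z≤n
  part-decreasing (p ∷ l) zero    = p
  part-decreasing (p ∷ l) (suc k) = part-decreasing l k

  part-antitone : ∀ {μ} → Linked _≥_ μ → ∀ {i j} → 1 ≤ i → i ≤ j → part μ j ≤ part μ i
  part-antitone l {i} {j} 1≤i i≤j with m≤n⇒m<n∨m≡n i≤j
  ... | inj₂ refl = ≤-refl
  part-antitone l {suc i} {suc (suc j)} 1≤i i≤j | inj₁ i<j =
    ≤-trans (part-decreasing l j) (part-antitone l 1≤i (s≤s⁻¹ i<j))
  part-antitone l {suc i} {suc zero} 1≤i i≤j | inj₁ (s≤s ())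

  linked-tail : ∀ {a μ} → Linked _≥_ (a ∷ μ) → Linked _≥_ μ
  linked-tail [-]     = []
  linked-tail (_ ∷ l) = l

  conjPart-∷ : ∀ a μ J → conjPart (a ∷ μ) J ≡ [ J ≤? a ]ᵇ + conjPart μ J
  conjPart-∷ a μ J = trans (length-filter (J ≤?_) (a ∷ μ))
    (cong ([ J ≤? a ]ᵇ +_) (sym (length-filter (J ≤?_) μ)))

  -- With `conjPart-≤`, the two readings of the box in row i + 1 and column J: it lies in the
  -- diagram through the length of its row or through that of its column.
  conjPart-> : ∀ {μ} → Linked _≥_ μ → ∀ i {J} → 1 ≤ J → J ≤ part μ (suc i) → i < conjPart μ J
  conjPart-> {[]}    l i {suc J} _ ()
  conjPart-> {a ∷ μ} l zero    {J} 1≤J p = subst (0 <_) (sym (trans (conjPart-∷ a μ J)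
    (cong (_+ conjPart μ J) ([]ᵇ-yes (J ≤? a) p)))) z<s
  conjPart-> {a ∷ μ} l (suc i) {J} 1≤J p = subst (suc i <_) (sym (trans (conjPart-∷ a μ J)
    (cong (_+ conjPart μ J) ([]ᵇ-yes (J ≤? a) (≤-trans p (part-antitone l {1} {suc (suc i)} ≤-refl (s≤s z≤n)))))))
    (s≤s (conjPart-> (linked-tail l) i 1≤J p))

  conjPart-≤ : ∀ {μ} → Linked _≥_ μ → ∀ i {J} → part μ (suc i) < J → conjPart μ J ≤ i
  conjPart-≤ {[]}    l i p = z≤n
  conjPart-≤ {a ∷ μ} l zero {J} p = subst (_≤ 0) (sym (trans (conjPart-∷ a μ J)
    (cong (_+ conjPart μ J) ([]ᵇ-no (J ≤? a) (<⇒≱ p)))))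
    (conjPart-≤ (linked-tail l) zero (≤-<-trans (part-antitone l {1} {2} ≤-refl (s≤s z≤n)) p))
  conjPart-≤ {a ∷ μ} l (suc i) {J} p = subst (_≤ suc i) (sym (conjPart-∷ a μ J))
    (+-mono-≤ ([]ᵇ≤1 (J ≤? a)) (conjPart-≤ (linked-tail l) i p))

  conjPart-length : ∀ μ J → conjPart μ J ≤ length μ
  conjPart-length μ J = Listₚ.length-filter (J ≤?_) μ

  conjPart-antitone : ∀ μ {J J′} → J ≤ J′ → conjPart μ J′ ≤ conjPart μ J
  conjPart-antitone []      p = z≤n
  conjPart-antitone (a ∷ μ) {J} {J′} p = subst₂ _≤_ (sym (conjPart-∷ a μ J′)) (sym (conjPart-∷ a μ J))
    (+-mono-≤ head≤ (conjPart-antitone μ p))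
    where
    head≤ : [ J′ ≤? a ]ᵇ ≤ [ J ≤? a ]ᵇ
    head≤ with J′ ≤? a
    ... | yes q = ≤-trans ([]ᵇ≤1 (J′ ≤? a)) (≤-reflexive (sym ([]ᵇ-yes (J ≤? a) (≤-trans p q))))
    ... | no nq = ≤-trans (≤-reflexive ([]ᵇ-no (J′ ≤? a) nq)) z≤n

  permutation-≤ : ∀ μ {p i} → i ≤ p → permutation μ p i ≡ i + part μ (suc p ∸ i)
  permutation-≤ μ {p} {i} q with i ≤? p
  ... | yes _ = refl
  ... | no nq = contradiction q nq

  permutation-> : ∀ μ {p i} → p < i → permutation μ p i ≡ i ∸ conjPart μ (i ∸ p)
  permutation-> μ {p} {i} q with i ≤? p
  ... | yes r = contradiction r (<⇒≱ q)
  ... | no _  = refl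

  module Grassmannian {μ : List ℕ} (sorted : Linked _≥_ μ) {k : ℕ} (len : length μ ≤ k) where

    w v : ℕ → ℕ
    w = permutation μ k
    v = reversePrefix k w

    w-increasing : ∀ {i j} → 1 ≤ i → i < j → j ≤ k → w i < w j
    w-increasing {i} {j} 1≤i i<j j≤k = subst₂ _<_
      (sym (permutation-≤ μ (≤-trans (<⇒≤ i<j) j≤k))) (sym (permutation-≤ μ j≤k))
      (+-mono-<-≤ i<j (part-antitone sorted (m<n⇒0<n∸m (s≤s j≤k)) (∸-monoʳ-≤ (suc k) (<⇒≤ i<j))))

    conj≤k : ∀ J → conjPart μ J ≤ k
    conj≤k J = ≤-trans (conjPart-length μ J) len

    v-left : ∀ {i} → i < k → v (suc i) ≡ (k ∸ i) + part μ (suc i)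
    v-left {i} i<k = trans (reversePrefix-≤ k w (s≤s z≤n) i<k)
      (trans (permutation-≤ μ (m∸n≤m k i)) (cong (λ r → k ∸ i + part μ r)
        (trans (+-∸-assoc 1 (m∸n≤m k i)) (cong suc (m∸[m∸n]≡n (<⇒≤ i<k))))))

    v-right : ∀ {j} → k < j → v j ≡ j ∸ conjPart μ (j ∸ k)
    v-right q = trans (reversePrefix-> k w q) (permutation-> μ q)

    v-descends : ∀ {a b} → 1 ≤ a → a < b → b ≤ k → v b < v a
    v-descends = reversePrefix-descends {k} {w} w-increasing ≤-refl

    v-ascends : ∀ {a b} → k < a → a < b → v a < v b
    v-ascends {a} {b} k<a a<b = subst₂ _<_ (sym (v-right k<a)) (sym (v-right (<-trans k<a a<b)))
      (≤-<-trans (∸-monoʳ-≤ a (conjPart-antitone μ (∸-monoˡ-≤ k (<⇒≤ a<b))))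
                 (∸-monoˡ-< a<b (≤-trans (conj≤k (b ∸ k)) (<⇒≤ k<a))))

    -- With `v-cross->`: among the positions beyond k, those with a value below v(i + 1) form the
    -- interval up to k + μ_{i+1}. This turns the Lehmer code into the length of an interval.
    v-cross-< : ∀ {i j} → i < k → k < j → j ≤ k + part μ (suc i) → v j < v (suc i)
    v-cross-< {i} {j} i<k k<j q = subst₂ _<_ (sym (v-right k<j)) (sym (v-left i<k)) (begin-strict
      j ∸ conjPart μ (j ∸ k)   ≤⟨ ∸-monoʳ-≤ j (conjPart-> sorted i (m<n⇒0<n∸m k<j)
                                    (≤-trans (∸-monoˡ-≤ k q) (≤-reflexive (m+n∸m≡n k _)))) ⟩
      j ∸ suc i                <⟨ ∸-monoʳ-< (n<1+n i) (<-trans i<k k<j) ⟩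
      j ∸ i                    ≤⟨ ∸-monoˡ-≤ i q ⟩
      k + part μ (suc i) ∸ i   ≡⟨ +-∸-comm _ (<⇒≤ i<k) ⟩
      k ∸ i + part μ (suc i)   ∎)
      where open ≤-Reasoning

    v-cross-> : ∀ {i j} → i < k → k + part μ (suc i) < j → v (suc i) < v j
    v-cross-> {i} {j} i<k q = subst₂ _<_ (sym (v-left i<k)) (sym (v-right k<j)) (begin-strict
      k ∸ i + part μ (suc i)   ≡⟨ +-∸-comm _ (<⇒≤ i<k) ⟨
      k + part μ (suc i) ∸ i   <⟨ ∸-monoˡ-< q (≤-trans (<⇒≤ i<k) (m≤m+n k _)) ⟩
      j ∸ i                    ≤⟨ ∸-monoʳ-≤ j (conjPart-≤ sorted i
                                    (subst (_< j ∸ k) (m+n∸m≡n k _) (∸-monoˡ-< q (m≤m+n k _)))) ⟩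
      j ∸ conjPart μ (j ∸ k)   ∎)
      where
      open ≤-Reasoning
      k<j = ≤-<-trans (m≤m+n k _) q

    v-distinct : ∀ {a b} → 1 ≤ a → a < b → v a ≢ v b
    v-distinct {suc i} {b} 1≤a a<b e with b ≤? k | suc i ≤? k
    ... | yes b≤k | _      = <-irrefl (sym e) (v-descends 1≤a a<b b≤k)
    ... | no _    | no k≱a = <-irrefl e (v-ascends (≰⇒> k≱a) a<b)
    ... | no k≱b  | yes i<k with b ≤? k + part μ (suc i)
    ...   | yes q = <-irrefl (sym e) (v-cross-< i<k (≰⇒> k≱b) q)
    ...   | no q  = <-irrefl e (v-cross-> i<k (≰⇒> q))

    -- A pattern 132 rises from its first to its second entry and falls from the second to the
    -- third. Since v decreases up to k and increases beyond k, the second entry fits in neither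
    -- part.
    v-dominant : ∀ n → Dominant n v
    v-dominant n = record { injective = inj ; avoids = avoid }
      where
      inj : ∀ {a b} → 1 ≤ a → a ≤ n → 1 ≤ b → b ≤ n → v a ≡ v b → a ≡ b
      inj {a} {b} p _ q _ e with <-cmp a b
      ... | tri< lt _ _ = contradiction e (v-distinct p lt)
      ... | tri≈ _ e′ _ = e′
      ... | tri> _ _ gt = contradiction (sym e) (v-distinct q gt)
      avoid : ∀ {a b c} → 1 ≤ a → a < b → b < c → c ≤ n → v a < v c → ¬ v c < v b
      avoid {a} {b} {c} 1≤a a<b b<c _ lt gt with b ≤? k
      ... | yes b≤k = <-asym (<-trans lt gt) (v-descends 1≤a a<b b≤k)
      ... | no k≱b  = <-asym gt (v-ascends (≰⇒> k≱b) b<c)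

    v-code-left : ∀ {n i} → i < k → k + part μ (suc i) ≤ n → code n v (suc i) ≡ part μ (suc i) + (k ∸ suc i)
    v-code-left {n} {i} i<k q = begin
      code n v (suc i)
        ≡⟨ sum₁-cong n (λ j _ _ → []ᵇ-cong ((suc i <? j) ×-dec (v j <? v (suc i)))
             ((suc i <? j) ×-dec (j ≤? k + part μ (suc i))) (mk⇔ (forth j) (back j))) ⟩
      sum₁ n (λ j → [ (suc i <? j) ×-dec (j ≤? k + part μ (suc i)) ]ᵇ)
        ≡⟨ sum₁-interval n (suc i) (k + part μ (suc i)) (≤-trans i<k (m≤m+n k _)) q ⟩
      k + part μ (suc i) ∸ suc i
        ≡⟨ trans (+-∸-comm _ i<k) (+-comm (k ∸ suc i) _) ⟩
      part μ (suc i) + (k ∸ suc i) ∎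
      where
      open ≡.≡-Reasoning
      forth : ∀ j → suc i < j × v j < v (suc i) → suc i < j × j ≤ k + part μ (suc i)
      forth j (p , lt) = p , ≮⇒≥ (λ gt → <-asym lt (v-cross-> i<k gt))
      back : ∀ j → suc i < j × j ≤ k + part μ (suc i) → suc i < j × v j < v (suc i)
      back j (p , le) with j ≤? k
      ... | yes j≤k = p , v-descends (s≤s z≤n) p j≤k
      ... | no k≱j  = p , v-cross-< i<k (≰⇒> k≱j) le

    v-code-right : ∀ {n i} → k ≤ i → code n v (suc i) ≡ 0
    v-code-right {n} {i} k≤i = sum₁-null n (λ j _ _ → []ᵇ-no ((suc i <? j) ×-dec (v j <? v (suc i)))
      (λ (p , lt) → <-asym lt (v-ascends (s≤s k≤i) p)))

    grassmannian-𝒢 : ∀ {N} → k + part μ 1 ≤ suc N → 𝒢 N w ≋ B.Φ k (λ i → part μ (suc i))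
    grassmannian-𝒢 {N} q = Polynomials.trans
      (Polynomials.reflexive (𝒢-sort w-increasing N k ≤-refl (≤-trans (m≤m+n k _) q)))
      (B.symmetrize-cong k (Polynomials.trans (dominant-𝒢 N _ v ≤-refl (v-dominant (suc N)))
        (Polynomials.trans
          (∏-truncate {k} {suc N} {λ i → B.pw (code (suc N) v (suc i)) (X (suc i))} (≤-trans (m≤m+n k _) q)
            (λ i k≤i _ → Polynomials.reflexive (cong (λ a → B.pw a (X (suc i))) (v-code-right {suc N} k≤i))))
          -- The value at 0 is a filler; `monomial` reads positions from 1 on.
          (monomial-cong k {code (suc N) v} {λ { zero → 0 ; (suc i) → part μ (suc i) + (k ∸ suc i) }}
            (λ { (suc i) _ i<k → v-code-left i<k (≤-trans (+-monoʳ-≤ k (part-antitone sorted {1} {suc i} ≤-refl (s≤s z≤n))) q) })))))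

-- Entries of subsets and the effect of adjoining a largest element.

module SubsetEntries where

  open import Defs hiding (var; β; π; X; Y; _⊕_)
  open import Data.Bool using (Bool; true; false; _∨_; if_then_else_)
  open import Data.Bool.Properties using (∨-assoc)
  open import Data.Fin as Fin using (Fin; zero; suc; toℕ)
  open import Data.Fin.Subset using (Subset; Nonempty; ∣_∣)
  open import Data.Fin.Subset.Properties using (_∈?_)
  open import Data.List as List using ([]; _∷_; _++_; map; filter; allFin; tabulate)
  import Data.List.Properties as Listₚ
  open import Data.List.Extrema.Nat using (max; max≤v⁺; v≤min⁺; max<v⁺; v<min⁺; xs≤max; min≤xs)
  open import Data.List.Relation.Unary.All as All using (All; []; _∷_)
  open import Data.List.Membership.Propositional using () renaming (_∈_ to _∈ᴸ_)
  import Data.List.Relation.Unary.All.Properties as Allₚ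
  open import Data.List.Relation.Unary.Any as Any using (here; there)
  open import Data.Nat as ℕ using (ℕ; zero; suc; _≤_; _<_; z≤n; s≤s; _≤?_; _<?_)
  import Data.Nat.Properties as ℕₚ
  open import Data.Product using (_×_; _,_; ∃-syntax)
  open import Data.Vec using ([]; _∷_; _∷ʳ_; here; there)
  open import Function using (_∘_; id)
  open import Function.Bundles using (_⇔_; mk⇔; Equivalence)
  open import Relation.Nullary using (Dec; does; contradiction)
  open import Relation.Binary.PropositionalEquality using (_≡_; refl; sym; trans; cong; subst)

  filter-∈?-suc : ∀ {k} s (S : Subset k) is →
                  filter (_∈? (s ∷ S)) (map Fin.suc is) ≡ map Fin.suc (filter (_∈? S) is)
  filter-∈?-suc s S []       = refl
  filter-∈?-suc s S (i ∷ is) with does (i ∈? S)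
  ... | true  = cong (Fin.suc i ∷_) (filter-∈?-suc s S is)
  ... | false = filter-∈?-suc s S is

  entry : ∀ {k} → Fin k → ℕ
  entry = ℕ.suc ∘ toℕ

  private
    entries-tail : ∀ {k} s (S : Subset k) →
      map entry (filter (_∈? (s ∷ S)) (tabulate Fin.suc)) ≡ map ℕ.suc (entries S)
    entries-tail {k} s S = trans
      (cong (λ is → map entry (filter (_∈? (s ∷ S)) is)) (sym (Listₚ.map-tabulate id Fin.suc)))
      (trans (cong (map entry) (filter-∈?-suc s S (allFin k)))
        (trans (sym (Listₚ.map-∘ {g = entry} {f = Fin.suc} (filter (_∈? S) (allFin k))))
               (Listₚ.map-∘ {g = ℕ.suc} {f = entry} (filter (_∈? S) (allFin k)))))

  entries-∷ : ∀ {k} s (S : Subset k) → entries (s ∷ S) ≡ (if s then 1 ∷ [] else []) ++ map suc (entries S)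
  entries-∷ true  S = cong (1 ∷_) (entries-tail true S)
  entries-∷ false S = entries-tail false S

  entries-∷ʳ : ∀ {k} (S : Subset k) b → entries (S ∷ʳ b) ≡ entries S ++ (if b then suc k ∷ [] else [])
  entries-∷ʳ []      true  = refl
  entries-∷ʳ []      false = refl
  entries-∷ʳ {suc k} (s ∷ S) b = trans (entries-∷ s (S ∷ʳ b)) (trans
    (cong (first ++_) (trans (cong (map suc) (entries-∷ʳ S b)) (trans (Listₚ.map-++ suc (entries S) _) (cong (map suc (entries S) ++_) (last b)))))
    (trans (sym (Listₚ.++-assoc first (map suc (entries S)) _)) (cong (_++ (if b then suc (suc k) ∷ [] else [])) (sym (entries-∷ s S)))))
    where
    first = if s then 1 ∷ [] else []
    last : ∀ b → map suc (if b then suc k ∷ [] else []) ≡ (if b then suc (suc k) ∷ [] else [])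
    last true  = refl
    last false = refl

  entries≤k : ∀ {k} (S : Subset k) → All (_≤ k) (entries S)
  entries≤k []      = []
  entries≤k (s ∷ S) = subst (All _) (sym (entries-∷ s S)) (Allₚ.++⁺ (first s) (Allₚ.map⁺ (All.map s≤s (entries≤k S))))
    where
    first : ∀ s → All (_≤ suc _) (if s then 1 ∷ [] else [])
    first true  = s≤s z≤n ∷ []
    first false = []

  1≤entries : ∀ {k} (S : Subset k) → All (1 ≤_) (entries S)
  1≤entries {k} S = Allₚ.map⁺ (All.universal (λ _ → s≤s z≤n) _)

  occupied : ∀ {k} → Subset k → Bool
  occupied []      = false
  occupied (s ∷ S) = s ∨ occupied S

  occupied-∷ʳ : ∀ {k} (S : Subset k) b → occupied (S ∷ʳ b) ≡ occupied S ∨ b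
  occupied-∷ʳ []      true  = refl
  occupied-∷ʳ []      false = refl
  occupied-∷ʳ (s ∷ S) b = trans (cong (s ∨_) (occupied-∷ʳ S b)) (sym (∨-assoc s _ b))

  occupied⇒nonempty : ∀ {k} (S : Subset k) → occupied S ≡ true → Nonempty S
  occupied⇒nonempty (true  ∷ S) e = zero , here
  occupied⇒nonempty (false ∷ S) e with occupied⇒nonempty S e
  ... | i , p = suc i , there p

  nonempty⇒occupied : ∀ {k} (S : Subset k) → Nonempty S → occupied S ≡ true
  nonempty⇒occupied (true  ∷ S) (i , p)           = refl
  nonempty⇒occupied (false ∷ S) (suc i , there p) = nonempty⇒occupied S (i , p)

  occupied⇒entry : ∀ {k} (S : Subset k) → occupied S ≡ true → ∃[ r ] r ∈ᴸ entries S
  occupied⇒entry (s ∷ S) e = subst (λ rs → ∃[ r ] r ∈ᴸ rs) (sym (entries-∷ s S)) (found s e)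
    where
    found : ∀ s → s ∨ occupied S ≡ true → ∃[ r ] r ∈ᴸ (if s then 1 ∷ [] else []) ++ map suc (entries S)
    found true  e = 1 , here refl
    found false e with occupied⇒entry S e
    ... | r , p = suc r , map∈ p
      where
      map∈ : ∀ {r rs} → r ∈ᴸ rs → suc r ∈ᴸ map suc rs
      map∈ (here refl) = here refl
      map∈ (there p)   = there (map∈ p)

  unoccupied⇒entries : ∀ {k} (S : Subset k) → occupied S ≡ false → entries S ≡ []
  unoccupied⇒entries []          e = refl
  unoccupied⇒entries (false ∷ S) e = trans (entries-∷ false S) (cong (map suc) (unoccupied⇒entries S e))

  size-∷ʳ : ∀ {k} (S : Subset k) b → ∣ S ∷ʳ b ∣ ≡ (if b then 1 else 0) ℕ.+ ∣ S ∣
  size-∷ʳ []          true  = refl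
  size-∷ʳ []          false = refl
  size-∷ʳ (true  ∷ S) b = trans (cong suc (size-∷ʳ S b)) (sym (ℕₚ.+-suc _ ∣ S ∣))
  size-∷ʳ (false ∷ S) b = size-∷ʳ S b

  occupied⇒size : ∀ {k} (S : Subset k) → occupied S ≡ true → 1 ≤ ∣ S ∣
  occupied⇒size (true  ∷ S) e = s≤s z≤n
  occupied⇒size (false ∷ S) e = occupied⇒size S e

  unoccupied⇒size : ∀ {k} (S : Subset k) → occupied S ≡ false → ∣ S ∣ ≡ 0
  unoccupied⇒size []          e = refl
  unoccupied⇒size (false ∷ S) e = unoccupied⇒size S e

  infix 4 _⊴_ _◁_
  -- Entrywise, so that an empty set satisfies every comparison. With the default k of `minEntry`,
  -- an entry k above an empty box would violate the strict comparison.
  _⊴_ _◁_ : ∀ {k} → Subset k → Subset k → Set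
  S ⊴ S′ = All (λ r → All (r ≤_) (entries S′)) (entries S)
  S ◁ S′ = All (λ r → All (r <_) (entries S′)) (entries S)

  _⊴?_ : ∀ {k} (S S′ : Subset k) → Dec (S ⊴ S′)
  S ⊴? S′ = All.all? (λ r → All.all? (r ≤?_) (entries S′)) (entries S)

  _◁?_ : ∀ {k} (S S′ : Subset k) → Dec (S ◁ S′)
  S ◁? S′ = All.all? (λ r → All.all? (r <?_) (entries S′)) (entries S)

  module _ {k : ℕ} (S S′ : Subset k) (b b′ : Bool) where
    private
      subst₂-All : {_∼_ : ℕ → ℕ → Set} →
        All (λ r → All (r ∼_) (entries S′ ++ (if b′ then suc k ∷ [] else []))) (entries S ++ (if b then suc k ∷ [] else [])) ⇔
        All (λ r → All (r ∼_) (entries (S′ ∷ʳ b′))) (entries (S ∷ʳ b))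
      subst₂-All rewrite entries-∷ʳ S b | entries-∷ʳ S′ b′ = mk⇔ id id

      blocked : {_∼_ : ℕ → ℕ → Set} → (∀ {r} → suc k ∼ r → k < r) → b ≡ true →
        All (λ r → All (r ∼_) (entries S′ ++ (if b′ then suc k ∷ [] else []))) (entries S ++ (if b then suc k ∷ [] else [])) →
        occupied S′ ≡ false
      blocked gt refl h with occupied S′ in eq
      ... | false = refl
      ... | true with occupied⇒entry S′ eq
      ...   | r , r∈ = contradiction (All.lookup (entries≤k S′) r∈) (ℕₚ.<⇒≱ (gt
                (All.lookup (Allₚ.++⁻ˡ (entries S′) (All.head (Allₚ.++⁻ʳ (entries S) h))) r∈)))

    -- The new entry k + 1 exceeds all old ones, so in the left box it tolerates on its right at
    -- most another k + 1.
    ⊴-∷ʳ : S ∷ʳ b ⊴ S′ ∷ʳ b′ ⇔ (S ⊴ S′ × (b ≡ true → occupied S′ ≡ false))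
    ⊴-∷ʳ = mk⇔
      (λ h → let h′ = Equivalence.from (subst₂-All {_≤_}) h in
        All.map (Allₚ.++⁻ˡ (entries S′)) (Allₚ.++⁻ˡ (entries S) h′) , λ e → blocked {_≤_} id e h′)
      (λ (h , e) → Equivalence.to (subst₂-All {_≤_}) (Allₚ.++⁺
        (All.zipWith (λ (p , r≤k) → Allₚ.++⁺ p (new b′ (ℕₚ.≤-trans r≤k (ℕₚ.n≤1+n k)))) (h , entries≤k S))
        (old b e)))
      where
      new : ∀ b′ {r} → r ≤ suc k → All (r ≤_) (if b′ then suc k ∷ [] else [])
      new true  p = p ∷ []
      new false p = []
      old : ∀ b → (b ≡ true → occupied S′ ≡ false) →
            All (λ r → All (r ≤_) (entries S′ ++ (if b′ then suc k ∷ [] else []))) (if b then suc k ∷ [] else [])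
      old false e = []
      old true  e rewrite unoccupied⇒entries S′ (e refl) = new b′ ℕₚ.≤-refl ∷ []

    -- Strictness excludes also a second k + 1, so the box below an entry k + 1 stays empty.
    ◁-∷ʳ : S ∷ʳ b ◁ S′ ∷ʳ b′ ⇔ (S ◁ S′ × (b ≡ true → occupied S′ ∨ b′ ≡ false))
    ◁-∷ʳ = mk⇔
      (λ h → let h′ = Equivalence.from (subst₂-All {_<_}) h in
        All.map (Allₚ.++⁻ˡ (entries S′)) (Allₚ.++⁻ˡ (entries S) h′) , λ e → empty b′ e h′)
      (λ (h , e) → Equivalence.to (subst₂-All {_<_}) (Allₚ.++⁺
        (All.zipWith (λ (p , r≤k) → Allₚ.++⁺ p (new b′ (s≤s r≤k))) (h , entries≤k S))
        (old b b′ e)))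
      where
      new : ∀ b′ {r} → r < suc k → All (r <_) (if b′ then suc k ∷ [] else [])
      new true  p = p ∷ []
      new false p = []
      old : ∀ b b′ → (b ≡ true → occupied S′ ∨ b′ ≡ false) →
            All (λ r → All (r <_) (entries S′ ++ (if b′ then suc k ∷ [] else []))) (if b then suc k ∷ [] else [])
      old false b′ e = []
      old true  b′ e with occupied S′ in eq | b′ | e refl
      ... | false | false | _ rewrite unoccupied⇒entries S′ eq = [] ∷ []
      empty : ∀ c → b ≡ true →
        All (λ r → All (r <_) (entries S′ ++ (if c then suc k ∷ [] else []))) (entries S ++ (if b then suc k ∷ [] else [])) →
        occupied S′ ∨ c ≡ false
      empty c refl h with occupied S′ in eq | c
      ... | false | false = refl
      ... | false | true  = contradiction (All.head (Allₚ.++⁻ʳ (entries S′) (All.head (Allₚ.++⁻ʳ (entries S) h)))) (ℕₚ.<-irrefl refl)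
      ... | true  | c with occupied⇒entry S′ eq
      ...   | r , r∈ = contradiction (All.lookup (entries≤k S′) r∈) (ℕₚ.<⇒≱ (ℕₚ.<-trans (ℕₚ.n<1+n k)
                (All.lookup (Allₚ.++⁻ˡ (entries S′) (All.head (Allₚ.++⁻ʳ (entries S) h))) r∈)))

  max≤min : ∀ {k} (S S′ : Subset k) → maxEntry S ≤ minEntry S′ ⇔ S ⊴ S′
  max≤min {k} S S′ = mk⇔
    (λ p → All.map (λ q → All.map (λ t → ℕₚ.≤-trans q (ℕₚ.≤-trans p t)) (min≤xs k (entries S′))) (xs≤max 0 (entries S)))
    (λ h → v≤min⁺ (max≤v⁺ z≤n (entries≤k S))
      (All.tabulate (λ r′∈ → max≤v⁺ z≤n (All.map (λ h → All.lookup h r′∈) h))))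

  max<min : ∀ {k} (S S′ : Subset k) → occupied S′ ≡ true → maxEntry S < minEntry S′ ⇔ S ◁ S′
  max<min {k} S S′ occ = mk⇔
    (λ p → All.map (λ q → All.map (λ t → ℕₚ.≤-<-trans q (ℕₚ.<-≤-trans p t)) (min≤xs k (entries S′))) (xs≤max 0 (entries S)))
    (λ h → v<min⁺ (below-k h) (All.tabulate (below h)))
    where
    below : S ◁ S′ → ∀ {r′} → r′ ∈ᴸ entries S′ → max 0 (entries S) < r′
    below h r′∈ = max<v⁺ (All.lookup (1≤entries S′) r′∈) (All.map (λ h → All.lookup h r′∈) h)
    below-k : S ◁ S′ → max 0 (entries S) < k
    below-k h with occupied⇒entry S′ occ
    ... | r′ , r′∈ = ℕₚ.<-≤-trans (below h r′∈) (All.lookup (entries≤k S′) r′∈)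

-- Sums over fillings and the evaluation of a single row.

module ChoiceSums where

  open import Defs hiding (var; β; π; X; Y; _⊕_)
  open IntegerCoefficients
  open StripSums
  open import Level using (0ℓ)
  open import Algebra.Bundles using (CommutativeRing)
  open import Data.Bool using (Bool; true; false; _∨_; if_then_else_)
  import Data.Bool as Bool
  import Data.Integer as ℤ
  open import Data.Fin as Fin using (Fin; zero; suc; toℕ)
  open import Data.Fin.Properties using (all?; ∀-cons; ∀-cons-⇔)
  open import Data.Fin.Subset using (Subset; outside; inside)
  open import Data.List as List using (List; []; _∷_; _++_; map; filter; foldr; cartesianProductWith)
  open import Data.Nat as ℕ using (ℕ; zero; suc; _≤_; z≤n; s≤s; _∸_; pred; _≤?_; _<?_; _≟_)
  import Data.Nat.Properties as ℕₚ
  open import Data.Product using (_×_; _,_)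
  open import Data.Vec using ([]; _∷_; _∷ʳ_)
  open import Function using (_∘_)
  open import Function.Bundles using (_⇔_; mk⇔; Equivalence)
  open import Relation.Nullary using (¬_; Dec; yes; does; _×-dec_; _→-dec_)
  open import Relation.Nullary.Decidable using (does-⇔; dec-true; dec-false)
  open import Relation.Unary using (Decidable)
  open import Relation.Binary.PropositionalEquality as ≡ using (_≡_; cong)

  module ListSums (R : CommutativeRing 0ℓ 0ℓ) where
    open CommutativeRing R hiding (zero)
    open Solver R
    open import Relation.Binary.Reasoning.Setoid setoid

    Σᴸ : {A : Set} → List A → (A → Carrier) → Carrier
    Σᴸ as f = foldr (λ a → f a +_) 0# as

    Σᴸ-cong : {A : Set} (as : List A) {f g : A → Carrier} → (∀ a → f a ≈ g a) → Σᴸ as f ≈ Σᴸ as g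
    Σᴸ-cong []       e = refl
    Σᴸ-cong (a ∷ as) e = +-cong (e a) (Σᴸ-cong as e)

    Σᴸ-++ : {A : Set} (as bs : List A) (f : A → Carrier) → Σᴸ (as ++ bs) f ≈ Σᴸ as f + Σᴸ bs f
    Σᴸ-++ []       bs f = sym (+-identityˡ _)
    Σᴸ-++ (a ∷ as) bs f = trans (+-congˡ (Σᴸ-++ as bs f)) (sym (+-assoc _ _ _))

    Σᴸ-map : {A B : Set} (g : A → B) (as : List A) (f : B → Carrier) → Σᴸ (map g as) f ≈ Σᴸ as (f ∘ g)
    Σᴸ-map g []       f = refl
    Σᴸ-map g (a ∷ as) f = +-congˡ (Σᴸ-map g as f)

    Σᴸ-product : {A B C : Set} (g : A → B → C) (as : List A) (bs : List B) (f : C → Carrier) →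
                 Σᴸ (cartesianProductWith g as bs) f ≈ Σᴸ as (λ a → Σᴸ bs (λ b → f (g a b)))
    Σᴸ-product g []       bs f = refl
    Σᴸ-product g (a ∷ as) bs f = trans (Σᴸ-++ (map (g a) bs) _ f) (+-cong (Σᴸ-map (g a) bs f) (Σᴸ-product g as bs f))

    Σᴸ-zero : {A : Set} (as : List A) → Σᴸ as (λ _ → 0#) ≈ 0#
    Σᴸ-zero []       = refl
    Σᴸ-zero (a ∷ as) = trans (+-identityˡ _) (Σᴸ-zero as)

    Σᴸ-+ : {A : Set} (as : List A) (f g : A → Carrier) → Σᴸ as (λ a → f a + g a) ≈ Σᴸ as f + Σᴸ as g
    Σᴸ-+ []       f g = sym (+-identityˡ 0#)
    Σᴸ-+ (a ∷ as) f g = trans (+-congˡ (Σᴸ-+ as f g))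
      (solve 4 (λ p q r s → (p :+ q) :+ (r :+ s) := (p :+ r) :+ (q :+ s)) refl _ _ _ _)

    Σᴸ-*ˡ : {A : Set} (as : List A) (c : Carrier) (f : A → Carrier) → Σᴸ as (λ a → c * f a) ≈ c * Σᴸ as f
    Σᴸ-*ˡ []       c f = sym (zeroʳ c)
    Σᴸ-*ˡ (a ∷ as) c f = trans (+-congˡ (Σᴸ-*ˡ as c f)) (sym (distribˡ c _ _))

    Σᴸ-*ʳ : {A : Set} (as : List A) (c : Carrier) (f : A → Carrier) → Σᴸ as (λ a → f a * c) ≈ Σᴸ as f * c
    Σᴸ-*ʳ as c f = trans (Σᴸ-cong as (λ a → *-comm _ _)) (trans (Σᴸ-*ˡ as c f) (*-comm _ _))

    Σᴸ-swap : {A B : Set} (as : List A) (bs : List B) (f : A → B → Carrier) →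
              Σᴸ as (λ a → Σᴸ bs (f a)) ≈ Σᴸ bs (λ b → Σᴸ as (λ a → f a b))
    Σᴸ-swap []       bs f = sym (Σᴸ-zero bs)
    Σᴸ-swap (a ∷ as) bs f = trans (+-congˡ (Σᴸ-swap as bs f)) (sym (Σᴸ-+ bs (f a) _))

    ind : {P : Set} → Dec P → Carrier
    ind P? = if does P? then 1# else 0#

    ind-cong : {P Q : Set} (P? : Dec P) (Q? : Dec Q) → P ⇔ Q → ind P? ≈ ind Q?
    ind-cong P? Q? e = reflexive (cong (if_then 1# else 0#) (does-⇔ e P? Q?))

    ind-yes : {P : Set} (P? : Dec P) → P → ind P? ≈ 1#
    ind-yes P? p = reflexive (cong (if_then 1# else 0#) (dec-true P? p))

    ind-no : {P : Set} (P? : Dec P) → ¬ P → ind P? ≈ 0#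
    ind-no P? p = reflexive (cong (if_then 1# else 0#) (dec-false P? p))

    ind-× : {P Q : Set} (P? : Dec P) (Q? : Dec Q) → ind (P? ×-dec Q?) ≈ ind P? * ind Q?
    ind-× P? Q? with does P?
    ... | true  = sym (*-identityˡ _)
    ... | false = sym (zeroˡ _)

    Σᴸ-filter : {A : Set} {P : A → Set} (P? : Decidable P) (as : List A) (f : A → Carrier) →
                Σᴸ (filter P? as) f ≈ Σᴸ as (λ a → ind (P? a) * f a)
    Σᴸ-filter P? []       f = refl
    Σᴸ-filter P? (a ∷ as) f with does (P? a)
    ... | true  = +-cong (sym (*-identityˡ _)) (Σᴸ-filter P? as f)
    ... | false = trans (Σᴸ-filter P? as f) (sym (trans (+-congʳ (zeroˡ _)) (+-identityˡ _)))

    ∏ᶠ : ∀ {n} → (Fin n → Carrier) → Carrier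
    ∏ᶠ {zero}  f = 1#
    ∏ᶠ {suc n} f = f zero * ∏ᶠ (f ∘ suc)

    ∏ᶠ-cong : ∀ {n} {f g : Fin n → Carrier} → (∀ i → f i ≈ g i) → ∏ᶠ f ≈ ∏ᶠ g
    ∏ᶠ-cong {zero}  e = refl
    ∏ᶠ-cong {suc n} e = *-cong (e zero) (∏ᶠ-cong (e ∘ suc))

    ∏ᶠ-* : ∀ {n} (f g : Fin n → Carrier) → ∏ᶠ (λ i → f i * g i) ≈ ∏ᶠ f * ∏ᶠ g
    ∏ᶠ-* {zero}  f g = sym (*-identityˡ 1#)
    ∏ᶠ-* {suc n} f g = trans (*-congˡ (∏ᶠ-* (f ∘ suc) (g ∘ suc)))
      (solve 4 (λ a b c d → (a :* b) :* (c :* d) := (a :* c) :* (b :* d)) refl _ _ _ _)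

    ∏ᶠ-one : ∀ {n} {f : Fin n → Carrier} → (∀ i → f i ≈ 1#) → ∏ᶠ f ≈ 1#
    ∏ᶠ-one {zero}  e = refl
    ∏ᶠ-one {suc n} e = trans (*-cong (e zero) (∏ᶠ-one (e ∘ suc))) (*-identityˡ 1#)

    ∏ᶠ-ind : ∀ {n} {P : Fin n → Set} (P? : Decidable P) → ∏ᶠ (λ i → ind (P? i)) ≈ ind (all? P?)
    ∏ᶠ-ind {zero}  P? = sym (ind-yes (all? P?) λ ())
    ∏ᶠ-ind {suc n} P? = trans (*-congˡ (∏ᶠ-ind (P? ∘ suc)))
      (trans (sym (ind-× (P? zero) (all? (P? ∘ suc)))) (ind-cong (P? zero ×-dec all? (P? ∘ suc)) (all? P?) ∀-cons-⇔))

    -- Sums over dependent functions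

    cons : ∀ {n} (A : Fin (suc n) → Set) → A zero → (∀ i → A (suc i)) → ∀ i → A i
    cons A = ∀-cons {P = A}

    Σ-choices-suc : ∀ {n} (A : Fin (suc n) → Set) (as : ∀ i → List (A i)) F →
      Σᴸ (choices as) F ≈ Σᴸ (as zero) (λ a → Σᴸ (choices (as ∘ suc)) (λ r → F (cons A a r)))
    Σ-choices-suc A as F = Σᴸ-product (∀-cons {P = A}) (as zero) (choices (as ∘ suc)) F

    -- Fillings are functions and are only compared pointwise, so sums over them are rearranged for
    -- summands that respect this. The relation E allows nesting: it is equality for a row and
    -- pointwise equality of rows for a grid.
    Ext : ∀ {n} (A : Fin n → Set) (E : ∀ i → A i → A i → Set) → ((∀ i → A i) → Carrier) → Set
    Ext A E F = ∀ {p q} → (∀ i → E i (p i) (q i)) → F p ≈ F q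

    Ext-cons : ∀ {n} (A : Fin (suc n) → Set) (E : ∀ i → A i → A i → Set) (E-refl : ∀ i {a} → E i a a) {F} →
               Ext A E F → ∀ a → Ext (A ∘ suc) (E ∘ suc) (λ r → F (cons A a r))
    Ext-cons A E E-refl ext a {p} {q} e = ext {cons A a p} {cons A a q} λ { zero → E-refl zero ; (suc i) → e i }

    Ext-head : ∀ {n} (A : Fin (suc n) → Set) (E : ∀ i → A i → A i → Set) (E-refl : ∀ i {a} → E i a a) {F} →
               Ext A E F → ∀ r {a b} → E zero a b → F (cons A a r) ≈ F (cons A b r)
    Ext-head A E E-refl ext r {a} {b} e = ext {cons A a r} {cons A b r} λ { zero → e ; (suc i) → E-refl (suc i) }

    -- A sum against Kronecker deltas, one in each coordinate.
    Σ-select : ∀ {n} (A : Fin n → Set) (E : ∀ i → A i → A i → Set) (E-refl : ∀ i {a} → E i a a)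
      (as : ∀ i → List (A i)) (δ : ∀ i → A i → Carrier) (t : ∀ i → A i) →
      (∀ i (f : A i → Carrier) → (∀ {a b} → E i a b → f a ≈ f b) → Σᴸ (as i) (λ a → δ i a * f a) ≈ f (t i)) →
      ∀ F → Ext A E F → Σᴸ (choices as) (λ p → ∏ᶠ (λ i → δ i (p i)) * F p) ≈ F t
    Σ-select {zero}  A E E-refl as δ t h F ext = trans (+-identityʳ _) (trans (*-identityˡ _) (ext λ ()))
    Σ-select {suc n} A E E-refl as δ t h F ext = begin
      Σᴸ (choices as) (λ p → ∏ᶠ (λ i → δ i (p i)) * F p)
        ≈⟨ Σ-choices-suc A as (λ p → ∏ᶠ (λ i → δ i (p i)) * F p) ⟩
      Σᴸ (as zero) (λ a → Σᴸ rest (λ r → (δ zero a * D r) * F (cons A a r)))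
        ≈⟨ Σᴸ-cong (as zero) (λ a → trans (Σᴸ-cong rest (λ r → *-assoc (δ zero a) (D r) (F (cons A a r))))
             (trans (Σᴸ-*ˡ rest (δ zero a) (λ r → D r * F (cons A a r)))
               (*-congˡ (Σ-select (A ∘ suc) (E ∘ suc) (λ i → E-refl (suc i)) (as ∘ suc) (λ i → δ (suc i)) (t ∘ suc)
                 (λ i → h (suc i)) (λ r → F (cons A a r)) (Ext-cons A E E-refl ext a))))) ⟩
      Σᴸ (as zero) (λ a → δ zero a * F (cons A a (t ∘ suc)))
        ≈⟨ h zero (λ a → F (cons A a (t ∘ suc))) (Ext-head A E E-refl ext (t ∘ suc)) ⟩
      F (cons A (t zero) (t ∘ suc))
        ≈⟨ ext {cons A (t zero) (t ∘ suc)} {t} (λ { zero → E-refl zero ; (suc i) → E-refl (suc i) }) ⟩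
      F t ∎
      where
      rest = choices (as ∘ suc)
      D : (∀ i → A (suc i)) → Carrier
      D r = ∏ᶠ (λ i → δ (suc i) (r i))

    Σ-single : ∀ {n} (A : Fin n → Set) (E : ∀ i → A i → A i → Set) (E-refl : ∀ i {a} → E i a a)
      (as : ∀ i → List (A i)) (t : ∀ i → A i) →
      (∀ i (f : A i → Carrier) → (∀ {a b} → E i a b → f a ≈ f b) → Σᴸ (as i) f ≈ f (t i)) →
      ∀ F → Ext A E F → Σᴸ (choices as) F ≈ F t
    Σ-single {n} A E E-refl as t h F ext = trans
      (Σᴸ-cong (choices as) (λ p → sym (trans (*-congʳ (∏ᶠ-one {n} {λ _ → 1#} (λ _ → refl))) (*-identityˡ (F p)))))
      (Σ-select A E E-refl as (λ _ _ → 1#) t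
        (λ i f resp → trans (Σᴸ-cong (as i) (λ a → *-identityˡ (f a))) (h i f resp)) F ext)

    Σ-split : ∀ {n} (A A₁ A₂ : Fin n → Set) (E : ∀ i → A i → A i → Set) (E-refl : ∀ i {a} → E i a a)
      (as : ∀ i → List (A i)) (as₁ : ∀ i → List (A₁ i)) (as₂ : ∀ i → List (A₂ i)) (g : ∀ i → A₁ i → A₂ i → A i) →
      (∀ i (f : A i → Carrier) → (∀ {a b} → E i a b → f a ≈ f b) →
         Σᴸ (as i) f ≈ Σᴸ (as₁ i) (λ a → Σᴸ (as₂ i) (λ b → f (g i a b)))) →
      ∀ F → Ext A E F → Σᴸ (choices as) F ≈ Σᴸ (choices as₁) (λ p → Σᴸ (choices as₂) (λ q → F (λ i → g i (p i) (q i))))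
    Σ-split {zero} A A₁ A₂ E E-refl as as₁ as₂ g h F ext = trans (+-congʳ (ext λ ())) (sym (+-identityʳ _))
    Σ-split {suc n} A A₁ A₂ E E-refl as as₁ as₂ g h F ext = begin
      Σᴸ (choices as) F
        ≈⟨ Σ-choices-suc A as F ⟩
      Σᴸ (as zero) (λ a → Σᴸ rest (λ r → F (cons A a r)))
        ≈⟨ h zero (λ a → Σᴸ rest (λ r → F (cons A a r))) (λ e → Σᴸ-cong rest (λ r → Ext-head A E E-refl ext r e)) ⟩
      Σᴸ (as₁ zero) (λ a → Σᴸ (as₂ zero) (λ b → Σᴸ rest (λ r → F (cons A (g zero a b) r))))
        ≈⟨ Σᴸ-cong (as₁ zero) (λ a → Σᴸ-cong (as₂ zero) (λ b →
             Σ-split (A ∘ suc) (A₁ ∘ suc) (A₂ ∘ suc) (E ∘ suc) (λ i → E-refl (suc i)) (as ∘ suc) (as₁ ∘ suc) (as₂ ∘ suc)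
               (λ i → g (suc i)) (λ i → h (suc i)) (λ r → F (cons A (g zero a b) r)) (Ext-cons A E E-refl ext (g zero a b)))) ⟩
      Σᴸ (as₁ zero) (λ a → Σᴸ (as₂ zero) (λ b → Σᴸ rest₁ (λ p → Σᴸ rest₂ (λ q → G a b p q))))
        ≈⟨ Σᴸ-cong (as₁ zero) (λ a → Σᴸ-swap (as₂ zero) rest₁ (λ b p → Σᴸ rest₂ (λ q → G a b p q))) ⟩
      Σᴸ (as₁ zero) (λ a → Σᴸ rest₁ (λ p → Σᴸ (as₂ zero) (λ b → Σᴸ rest₂ (λ q → G a b p q))))
        ≈⟨ Σᴸ-cong (as₁ zero) (λ a → Σᴸ-cong rest₁ (λ p → Σᴸ-cong (as₂ zero) (λ b → Σᴸ-cong rest₂ (λ q → ext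
             {cons A (g zero a b) (λ i → g (suc i) (p i) (q i))} {λ i → g i (cons A₁ a p i) (cons A₂ b q i)}
             λ { zero → E-refl zero ; (suc i) → E-refl (suc i) })))) ⟩
      Σᴸ (as₁ zero) (λ a → Σᴸ rest₁ (λ p → Σᴸ (as₂ zero) (λ b → Σᴸ rest₂ (λ q → H (cons A₁ a p) (cons A₂ b q)))))
        ≈⟨ Σᴸ-cong (as₁ zero) (λ a → Σᴸ-cong rest₁ (λ p → Σ-choices-suc A₂ as₂ (H (cons A₁ a p)))) ⟨
      Σᴸ (as₁ zero) (λ a → Σᴸ rest₁ (λ p → Σᴸ (choices as₂) (H (cons A₁ a p))))
        ≈⟨ Σ-choices-suc A₁ as₁ (λ p → Σᴸ (choices as₂) (H p)) ⟨
      Σᴸ (choices as₁) (λ p → Σᴸ (choices as₂) (H p)) ∎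
      where
      rest  = choices (as ∘ suc)
      rest₁ = choices (as₁ ∘ suc)
      rest₂ = choices (as₂ ∘ suc)
      H : (∀ i → A₁ i) → (∀ i → A₂ i) → Carrier
      H p q = F (λ i → g i (p i) (q i))
      G : A₁ zero → A₂ zero → (∀ i → A₁ (suc i)) → (∀ i → A₂ (suc i)) → Carrier
      G a b p q = F (cons A (g zero a b) (λ i → g (suc i) (p i) (q i)))

    bits : List Bool
    bits = outside ∷ inside ∷ []

    -- `subsets` branches on the smallest element, whereas the tableau recursion removes the
    -- largest.
    Σ-subsets-∷ʳ : ∀ k (f : Subset (suc k) → Carrier) →
      Σᴸ (subsets (suc k)) f ≈ Σᴸ (subsets k) (λ S → Σᴸ bits (λ b → f (S ∷ʳ b)))
    Σ-subsets-∷ʳ zero f = sym (+-identityʳ _)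
    Σ-subsets-∷ʳ (suc k) f = begin
      Σᴸ (subsets (suc (suc k))) f
        ≈⟨ Σᴸ-product _∷_ bits (subsets (suc k)) f ⟩
      Σᴸ bits (λ s → Σᴸ (subsets (suc k)) (λ S → f (s ∷ S)))
        ≈⟨ Σᴸ-cong bits (λ s → Σ-subsets-∷ʳ k (λ S → f (s ∷ S))) ⟩
      Σᴸ bits (λ s → Σᴸ (subsets k) (λ S → Σᴸ bits (λ b → f (s ∷ (S ∷ʳ b)))))
        ≈⟨ Σᴸ-product _∷_ bits (subsets k) _ ⟨
      Σᴸ (subsets (suc k)) (λ S → Σᴸ bits (λ b → f (S ∷ʳ b))) ∎

    δᵇ : Bool → Bool → Carrier
    δᵇ a b = ind (a Bool.≟ b)

    Σ-bits-select : ∀ t (f : Bool → Carrier) → Σᴸ bits (λ b → δᵇ t b * f b) ≈ f t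
    Σ-bits-select false f = solve 2 (λ p q → con ℤ.1ℤ :* p :+ (con ℤ.0ℤ :* q :+ con ℤ.0ℤ) := p) refl _ _
    Σ-bits-select true  f = solve 2 (λ p q → con ℤ.0ℤ :* p :+ (con ℤ.1ℤ :* q :+ con ℤ.0ℤ) := q) refl _ _

  module RowSums (R : CommutativeRing 0ℓ 0ℓ) (β : CommutativeRing.Carrier R) where
    open CommutativeRing R hiding (zero)
    open Strips R β
    open ListSums R
    open import Relation.Binary.Reasoning.Setoid setoid

    -- The factor contributed by the newest variable, of weight u, to a box that was occupied before
    -- (e) and that it enters (b).
    ω : Bool → Bool → Carrier → Carrier
    ω e     false u = 1#
    ω false true  u = u
    ω true  true  u = β * u

    bar : ∀ {B} → ℕ → Fin B → Bool
    bar c j = does (toℕ j <? c)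

    Check : Bool → ℕ → ℕ → Bool → Bool → Set
    Check p l′ l e b = (e ∨ b ≡ does (0 <? l)) × (p ≡ true → e ≡ false) × (b ≡ true → l′ ≤ 0)

    check? : ∀ p l′ l e b → Dec (Check p l′ l e b)
    check? p l′ l e b = ((e ∨ b) Bool.≟ does (0 <? l)) ×-dec ((p Bool.≟ true) →-dec (e Bool.≟ false))
                          ×-dec ((b Bool.≟ true) →-dec (l′ ≤? 0))

    -- Growing a row e over a row of length l′ to one of length l by the boxes b; p records whether
    -- the newest variable entered the box before the row.
    record RowGrowth {B} (p : Bool) (l′ l : ℕ) (e b : Fin B → Bool) : Set where
      constructor growth
      field
        union    : ∀ j → e j ∨ b j ≡ bar l j
        previous : ∀ j → toℕ j ≡ 0 → p ≡ true → e j ≡ false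
        adjacent : ∀ j j′ → toℕ j′ ≡ suc (toℕ j) → b j ≡ true → e j′ ≡ false
        below    : ∀ j → b j ≡ true → l′ ≤ toℕ j

    bar-pred : ∀ {B} l (j : Fin B) → bar l (Fin.suc j) ≡ bar (pred l) j
    bar-pred zero    j = ≡.refl
    bar-pred (suc l) j = ≡.refl

    rowGrowth-suc : ∀ {B p l′ l} {e b : Fin (suc B) → Bool} →
      (Check p l′ l (e zero) (b zero) × RowGrowth (b zero) (pred l′) (pred l) (e ∘ suc) (b ∘ suc)) ⇔ RowGrowth p l′ l e b
    rowGrowth-suc {B} {p} {l′} {l} {e} {b} = mk⇔
      (λ ((c₁ , c₂ , c₃) , growth u p a d) → growth
        (λ { zero → c₁ ; (suc j) → ≡.trans (u j) (≡.sym (bar-pred l j)) })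
        (λ { zero _ → c₂ ; (suc j) () })
        (λ { zero zero () ; zero (suc j′) q → p j′ (ℕₚ.suc-injective q)
           ; (suc j) zero () ; (suc j) (suc j′) q → a j j′ (ℕₚ.suc-injective q) })
        (λ { zero → c₃ ; (suc j) h → ≤-suc (d j h) }))
      (λ (growth u p a d) →
        (u zero , p zero ≡.refl , d zero) ,
        growth (λ j → ≡.trans (u (suc j)) (bar-pred l j)) (λ j q → a zero (suc j) (cong suc q))
          (λ j j′ q → a (suc j) (suc j′) (cong suc q)) (λ j h → ℕₚ.pred-mono-≤ (d (suc j) h)))
      where
      ≤-suc : ∀ {l m} → pred l ≤ m → l ≤ suc m
      ≤-suc {zero}  q = z≤n
      ≤-suc {suc l} q = s≤s q

    rowGrowth? : ∀ {B} p l′ l (e b : Fin B → Bool) → Dec (RowGrowth p l′ l e b)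
    rowGrowth? {zero}  p l′ l e b = yes (growth (λ ()) (λ ()) (λ ()) (λ ()))
    rowGrowth? {suc B} p l′ l e b = Relation.Nullary.map′ (Equivalence.to rowGrowth-suc) (Equivalence.from rowGrowth-suc)
      (check? p l′ l (e zero) (b zero) ×-dec rowGrowth? (b zero) (pred l′) (pred l) (e ∘ suc) (b ∘ suc))
      where import Relation.Nullary

    -- The weight of a growth, read from left to right: p remembers whether the previous box was
    -- entered, and both row lengths shrink with each box. In this form the sum over rows can be
    -- computed by recursion; `κ-growth` relates it to `RowGrowth`.
    κ : ∀ {B} → Bool → ℕ → ℕ → (ℕ → Carrier) → (e b : Fin B → Bool) → Carrier
    κ {zero}  p l′ l u e b = 1#
    κ {suc B} p l′ l u e b = (ind (check? p l′ l (e zero) (b zero)) * ω (e zero) (b zero) (u 0)) *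
                             κ (b zero) (pred l′) (pred l) (u ∘ suc) (e ∘ suc) (b ∘ suc)

    κ-growth : ∀ {B} p l′ l u (e b : Fin B → Bool) →
      κ p l′ l u e b ≈ ind (rowGrowth? p l′ l e b) * ∏ᶠ (λ j → ω (e j) (b j) (u (toℕ j)))
    κ-growth {zero}  p l′ l u e b = sym (*-identityˡ 1#)
    κ-growth {suc B} p l′ l u e b = trans (*-congˡ (κ-growth (b zero) (pred l′) (pred l) (u ∘ suc) (e ∘ suc) (b ∘ suc)))
      (trans (solve 4 (λ a b c d → (a :* b) :* (c :* d) := (a :* c) :* (b :* d)) refl _ _ _ _)
             (*-congʳ (sym (ind-× (check? p l′ l (e zero) (b zero))
                                  (rowGrowth? (b zero) (pred l′) (pred l) (e ∘ suc) (b ∘ suc))))))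

    rows : ∀ B → List (Fin B → Bool)
    rows B = choices (λ _ → bits)

    RowExt : ∀ {B} → ((Fin B → Bool) → Carrier) → Set
    RowExt = Ext (λ _ → Bool) (λ _ → _≡_)

    rowSum : ∀ B → Bool → ℕ → ℕ → (ℕ → Carrier) → ((Fin B → Bool) → Carrier) → Carrier
    rowSum B p l′ l u H = Σᴸ (rows B) (λ e → Σᴸ (rows B) (λ b → κ p l′ l u e b * H e))

    infixr 5 _▸_
    _▸_ : ∀ {B} → Bool → (Fin B → Bool) → Fin (suc B) → Bool
    b ▸ r = cons (λ _ → Bool) b r

    rowSum-suc : ∀ B p l′ l u H → rowSum (suc B) p l′ l u H ≈ Σᴸ bits (λ e → Σᴸ bits (λ b →
      (ind (check? p l′ l e b) * ω e b (u 0)) * rowSum B b (pred l′) (pred l) (u ∘ suc) (λ r → H (e ▸ r))))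
    rowSum-suc B p l′ l u H = begin
      rowSum (suc B) p l′ l u H
        ≈⟨ Σ-choices-suc {n = B} (λ _ → Bool) (λ _ → bits) (λ e → Σᴸ (rows (suc B)) (λ b → κ p l′ l u e b * H e)) ⟩
      Σᴸ bits (λ e → Σᴸ (rows B) (λ r → Σᴸ (rows (suc B)) (λ b → κ p l′ l u (e ▸ r) b * H (e ▸ r))))
        ≈⟨ Σᴸ-cong bits (λ e → Σᴸ-cong (rows B) (λ r → Σ-choices-suc {n = B} (λ _ → Bool) (λ _ → bits)
             (λ b → κ p l′ l u (e ▸ r) b * H (e ▸ r)))) ⟩
      Σᴸ bits (λ e → Σᴸ (rows B) (λ r → Σᴸ bits (λ b → Σᴸ (rows B) (λ t →
        (τ e b * κ b (pred l′) (pred l) (u ∘ suc) r t) * H (e ▸ r)))))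
        ≈⟨ Σᴸ-cong bits (λ e → Σᴸ-swap (rows B) bits (λ r b → Σᴸ (rows B) (λ t → (τ e b * κ′ r b t) * H (e ▸ r)))) ⟩
      Σᴸ bits (λ e → Σᴸ bits (λ b → Σᴸ (rows B) (λ r → Σᴸ (rows B) (λ t →
        (τ e b * κ b (pred l′) (pred l) (u ∘ suc) r t) * H (e ▸ r)))))
        ≈⟨ Σᴸ-cong bits (λ e → Σᴸ-cong bits (λ b → trans
             (Σᴸ-cong (rows B) (λ r → trans (Σᴸ-cong (rows B) (λ t → *-assoc _ _ _)) (Σᴸ-*ˡ (rows B) (τ e b) (λ t → κ′ r b t * H (e ▸ r)))))
             (Σᴸ-*ˡ (rows B) (τ e b) (λ r → Σᴸ (rows B) (λ t → κ′ r b t * H (e ▸ r)))))) ⟩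
      Σᴸ bits (λ e → Σᴸ bits (λ b → τ e b * rowSum B b (pred l′) (pred l) (u ∘ suc) (λ r → H (e ▸ r)))) ∎
      where
      τ : Bool → Bool → Carrier
      τ e b = ind (check? p l′ l e b) * ω e b (u 0)
      κ′ : (Fin B → Bool) → Bool → (Fin B → Bool) → Carrier
      κ′ r b t = κ b (pred l′) (pred l) (u ∘ suc) r t

    RowExt-▹ : ∀ {B} {H : (Fin (suc B) → Bool) → Carrier} → RowExt H → ∀ e → RowExt (λ r → H (e ▸ r))
    RowExt-▹ ext e = Ext-cons (λ _ → Bool) (λ _ → _≡_) (λ _ → ≡.refl) ext e

    private
      bar-▸ : ∀ {B} {H : (Fin (suc B) → Bool) → Carrier} → RowExt H → ∀ c → H (true ▸ bar c) ≈ H (bar (suc c))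
      bar-▸ ext c = ext λ { zero → ≡.refl ; (suc j) → ≡.refl }

      bar-0 : ∀ {B} {H : (Fin (suc B) → Bool) → Carrier} → RowExt H → H (false ▸ bar 0) ≈ H (bar 0)
      bar-0 ext = ext λ { zero → ≡.refl ; (suc j) → ≡.refl }

      -- The four variants list which pairs (e, b) pass `check?` in the first box: neither bit, only
      -- b, only e, or all pairs except (0, 0).
      select₀₀ : ∀ {s₀₀ s₀₁ s₁₀ s₁₁ w₀₁ w₁₁} →
        ((1# * 1#) * s₀₀ + ((0# * w₀₁) * s₀₁ + 0#)) + (((0# * 1#) * s₁₀ + ((0# * w₁₁) * s₁₁ + 0#)) + 0#) ≈ s₀₀
      select₀₀ = solve 6 (λ s t s′ t′ w w′ → let z = con ℤ.0ℤ ; o = con ℤ.1ℤ in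
        ((o :* o) :* s :+ ((z :* w) :* t :+ z)) :+ (((z :* o) :* s′ :+ ((z :* w′) :* t′ :+ z)) :+ z) := s) refl _ _ _ _ _ _

      select₀₁ : ∀ {s₀₀ s₀₁ s₁₀ s₁₁ w₀₁ w₁₁} →
        ((0# * 1#) * s₀₀ + ((1# * w₀₁) * s₀₁ + 0#)) + (((0# * 1#) * s₁₀ + ((0# * w₁₁) * s₁₁ + 0#)) + 0#) ≈ w₀₁ * s₀₁
      select₀₁ = solve 6 (λ s t s′ t′ w w′ → let z = con ℤ.0ℤ ; o = con ℤ.1ℤ in
        ((z :* o) :* s :+ ((o :* w) :* t :+ z)) :+ (((z :* o) :* s′ :+ ((z :* w′) :* t′ :+ z)) :+ z) := w :* t) refl _ _ _ _ _ _

      select₁₀ : ∀ {s₀₀ s₀₁ s₁₀ s₁₁ w₀₁ w₁₁} →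
        ((0# * 1#) * s₀₀ + ((0# * w₀₁) * s₀₁ + 0#)) + (((1# * 1#) * s₁₀ + ((0# * w₁₁) * s₁₁ + 0#)) + 0#) ≈ s₁₀
      select₁₀ = solve 6 (λ s t s′ t′ w w′ → let z = con ℤ.0ℤ ; o = con ℤ.1ℤ in
        ((z :* o) :* s :+ ((z :* w) :* t :+ z)) :+ (((o :* o) :* s′ :+ ((z :* w′) :* t′ :+ z)) :+ z) := s′) refl _ _ _ _ _ _

      select₀₁₁ : ∀ {s₀₀ s₀₁ s₁₀ s₁₁ w₀₁ w₁₁} →
        ((0# * 1#) * s₀₀ + ((1# * w₀₁) * s₀₁ + 0#)) + (((1# * 1#) * s₁₀ + ((1# * w₁₁) * s₁₁ + 0#)) + 0#) ≈
        w₀₁ * s₀₁ + (s₁₀ + w₁₁ * s₁₁)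
      select₀₁₁ = solve 6 (λ s t s′ t′ w w′ → let z = con ℤ.0ℤ ; o = con ℤ.1ℤ in
        ((z :* o) :* s :+ ((o :* w) :* t :+ z)) :+ (((o :* o) :* s′ :+ ((o :* w′) :* t′ :+ z)) :+ z) :=
        w :* t :+ (s′ :+ w′ :* t′)) refl _ _ _ _ _ _

    mutual
      -- Once a box has been entered, no box to its right was occupied before; the remaining l boxes
      -- must all be new.
      rowSum-forced : ∀ B {l} u H → RowExt H → l ≤ B → rowSum B true 0 l u H ≈ H (bar 0) * ∏ l u
      rowSum-forced zero {zero} u H ext _ = trans (+-identityʳ _) (trans (+-identityʳ _) (trans (*-comm _ _) (*-congʳ (ext λ ()))))
      rowSum-forced (suc B) {zero} u H ext _ = begin
        rowSum (suc B) true 0 0 u H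
          ≈⟨ trans (rowSum-suc B true 0 0 u H) select₀₀ ⟩
        rowSum B false 0 0 (u ∘ suc) (λ r → H (false ▸ r))
          ≈⟨ rowSum-row B {0} {0} (u ∘ suc) _ (RowExt-▹ ext false) z≤n z≤n ⟩
        H (false ▸ bar 0)
          ≈⟨ trans (bar-0 ext) (sym (*-identityʳ _)) ⟩
        H (bar 0) * 1# ∎
      rowSum-forced (suc B) {suc l} u H ext (s≤s l≤B) = begin
        rowSum (suc B) true 0 (suc l) u H
          ≈⟨ trans (rowSum-suc B true 0 (suc l) u H) select₀₁ ⟩
        u 0 * rowSum B true 0 l (u ∘ suc) (λ r → H (false ▸ r))
          ≈⟨ *-congˡ (trans (rowSum-forced B (u ∘ suc) _ (RowExt-▹ ext false) l≤B) (*-congʳ (bar-0 ext))) ⟩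
        u 0 * (H (bar 0) * ∏ l (u ∘ suc))
          ≈⟨ solve 3 (λ a b c → a :* (b :* c) := b :* (a :* c)) refl _ _ _ ⟩
        H (bar 0) * ∏ (suc l) u ∎

      -- A first box over an occupied box of the shape must be old. Otherwise, if l > 0, it is new,
      -- or old and joined, which both force the rest of the row, or old and not joined, which
      -- leaves the same problem for a shorter row.
      rowSum-row : ∀ B {l′ l} u H → RowExt H → l′ ≤ l → l ≤ B →
                   rowSum B false l′ l u H ≈ Row l′ (l ∸ l′) u (λ c → H (bar c))
      rowSum-row zero {zero} {zero} u H ext _ _ = trans (+-identityʳ _) (trans (+-identityʳ _) (trans (*-identityˡ _) (ext λ ())))
      rowSum-row (suc B) {zero} {zero} u H ext _ _ = begin
        rowSum (suc B) false 0 0 u H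
          ≈⟨ trans (rowSum-suc B false 0 0 u H) select₀₀ ⟩
        rowSum B false 0 0 (u ∘ suc) (λ r → H (false ▸ r))
          ≈⟨ rowSum-row B {0} {0} (u ∘ suc) _ (RowExt-▹ ext false) z≤n z≤n ⟩
        H (false ▸ bar 0)
          ≈⟨ bar-0 ext ⟩
        H (bar 0) ∎
      rowSum-row (suc B) {zero} {suc l} u H ext _ (s≤s l≤B) = begin
        rowSum (suc B) false 0 (suc l) u H
          ≈⟨ trans (rowSum-suc B false 0 (suc l) u H) select₀₁₁ ⟩
        u 0 * rowSum B true 0 l (u ∘ suc) (λ r → H (false ▸ r))
          + (rowSum B false 0 l (u ∘ suc) (λ r → H (true ▸ r)) + β * u 0 * rowSum B true 0 l (u ∘ suc) (λ r → H (true ▸ r)))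
          ≈⟨ +-cong (*-congˡ (trans (rowSum-forced B (u ∘ suc) _ (RowExt-▹ ext false) l≤B) (*-congʳ (bar-0 ext))))
               (+-cong (trans (rowSum-row B (u ∘ suc) _ (RowExt-▹ ext true) z≤n l≤B)
                              (Row-cong 0 l (λ _ → refl) (λ c _ _ → bar-▸ ext c)))
                       (*-congˡ (trans (rowSum-forced B (u ∘ suc) _ (RowExt-▹ ext true) l≤B) (*-congʳ (bar-▸ ext 0))))) ⟩
        u 0 * (H (bar 0) * P) + (Q + β * u 0 * (H (bar 1) * P))
          ≈⟨ solve 6 (λ u F G p q b → u :* (F :* p) :+ (q :+ b :* u :* (G :* p)) := (F :+ G :* b) :* (u :* p) :+ q)
               refl (u 0) (H (bar 0)) (H (bar 1)) P Q β ⟩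
        (H (bar 0) + H (bar 1) * β) * (u 0 * P) + Q ∎
        where
        P = ∏ l (u ∘ suc)
        Q = Row 0 l (u ∘ suc) (λ c → H (bar (suc c)))
      rowSum-row (suc B) {suc l′} {suc l} u H ext (s≤s l′≤l) (s≤s l≤B) = begin
        rowSum (suc B) false (suc l′) (suc l) u H
          ≈⟨ trans (rowSum-suc B false (suc l′) (suc l) u H) select₁₀ ⟩
        rowSum B false l′ l (u ∘ suc) (λ r → H (true ▸ r))
          ≈⟨ trans (rowSum-row B (u ∘ suc) _ (RowExt-▹ ext true) l′≤l l≤B)
                   (Row-cong l′ (l ∸ l′) (λ _ → refl) (λ c _ _ → bar-▸ ext c)) ⟩
        Row (suc l′) (suc l ∸ suc l′) u (λ c → H (bar c)) ∎

-- Tableau sums on a fixed grid and their branching rule.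

module TableauSums where

  open import Defs hiding (var; β; π; X; Y; _⊕_; β^)
  open StripSums
  open MonomialProducts
  open SubsetEntries
  open ChoiceSums
  open import Level using (0ℓ)
  open import Algebra.Bundles using (CommutativeRing)
  open import Data.Bool using (Bool; true; false; _∨_)
  import Data.Bool as Bool
  open import Data.Fin as Fin using (Fin; zero; suc; toℕ; fromℕ<)
  open import Data.Fin.Properties using (all?; toℕ-fromℕ<)
  open import Data.Fin.Subset using (Subset; ∣_∣)
  open import Data.List as List using (List; []; _∷_)
  open import Data.Nat as ℕ using (ℕ; zero; suc; _≤_; _<_; _∸_; pred; _<?_; _≟_)
  import Data.Nat.Properties as ℕₚ
  open import Data.Product using (_×_; _,_; proj₁; proj₂)
  open import Data.Vec using ([]; _∷_; _∷ʳ_)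
  open import Function using (_∘_)
  open import Function.Bundles using (_⇔_; mk⇔; Equivalence)
  open import Relation.Nullary using (¬_; Dec; yes; no; _×-dec_; _→-dec_; contradiction)
  open import Relation.Nullary.Decidable using (dec-true; dec-false)
  open import Relation.Binary.PropositionalEquality as ≡ using (_≡_; cong; subst; subst₂)

  Grid : ∀ {n} → (Fin n → ℕ) → Set → Set
  Grid B A = ∀ i → Fin (B i) → A

  module Tableaux (R : CommutativeRing 0ℓ 0ℓ) (β^ : ℕ → CommutativeRing.Carrier R)
    (β^-zero : CommutativeRing._≈_ R (β^ 0) (CommutativeRing.1# R))
    (β^-+ : ∀ a b → CommutativeRing._≈_ R (β^ (a ℕ.+ b)) (CommutativeRing._*_ R (β^ a) (β^ b)))
    (x y : ℕ → CommutativeRing.Carrier R) where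

    open CommutativeRing R hiding (zero)
    open Strips R (β^ 1)
    open ListProducts R (β^ 1)
    open ListSums R
    open RowSums R (β^ 1) public
    open import Relation.Binary.Reasoning.Setoid setoid

    infixl 6 _⊕_
    _⊕_ : Carrier → Carrier → Carrier
    f ⊕ g = f + g + β^ 1 * f * g

    factor : ℕ → ℕ → ℕ → Carrier
    factor r i j = x r ⊕ y (r ℕ.+ j ∸ i)

    factor-small : ∀ {r i j} → x r ≈ 0# → y (r ℕ.+ j ∸ i) ≈ 0# → factor r i j ≈ 0#
    factor-small e e′ = trans (+-cong (+-cong e e′) (trans (*-congˡ e′) (zeroʳ _)))
                              (trans (+-identityʳ _) (+-identityʳ 0#))

    cell : ∀ {k} → ℕ → ℕ → Subset k → Carrier
    cell i j S = β^ (∣ S ∣ ∸ 1) * ∏ᴸ (entries S) (λ r → factor r i j)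

    -- By the truncated subtraction an empty box has weight 1, so the first entry of a box brings no
    -- β and every further one brings exactly one.
    cell-∷ʳ : ∀ {k} i j (S : Subset k) b → cell i j (S ∷ʳ b) ≈ cell i j S * ω (occupied S) b (factor (suc k) i j)
    cell-∷ʳ {k} i j S false rewrite size-∷ʳ S false | entries-∷ʳ S false =
      trans (*-congˡ (trans (∏ᴸ-++ (entries S) [] _) (*-identityʳ _))) (sym (*-identityʳ _))
    cell-∷ʳ {k} i j S true rewrite size-∷ʳ S true | entries-∷ʳ S true with occupied S in eq
    ... | false rewrite unoccupied⇒size S eq = trans
      (*-congˡ (trans (∏ᴸ-++ (entries S) (suc k ∷ []) _) (*-congˡ (*-identityʳ _)))) (sym (*-assoc _ _ _))
    ... | true with ∣ S ∣ | occupied⇒size S eq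
    ...   | suc m | _ = trans (*-cong (β^-+ 1 m) (trans (∏ᴸ-++ (entries S) (suc k ∷ []) _) (*-congˡ (*-identityʳ _))))
      (solve 4 (λ b p q u → (b :* p) :* (q :* u) := (p :* q) :* (b :* u)) refl _ _ _ _)

    module _ {n : ℕ} (B : Fin n → ℕ) where

      grids : {A : Set} → List A → List (Grid B A)
      grids as = choices λ i → choices λ j → as

      GridExt : {A : Set} → (Grid B A → Carrier) → Set
      GridExt {A} = Ext (λ i → Fin (B i) → A) (λ i p q → ∀ j → p j ≡ q j)

      ∏∏ : (∀ i → Fin (B i) → Carrier) → Carrier
      ∏∏ f = ∏ᶠ (λ i → ∏ᶠ (f i))

      ∏∏-cong : ∀ {f g : ∀ i → Fin (B i) → Carrier} → (∀ i j → f i j ≈ g i j) → ∏∏ f ≈ ∏∏ g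
      ∏∏-cong e = ∏ᶠ-cong (λ i → ∏ᶠ-cong (e i))

      ∏∏-* : ∀ (f g : ∀ i → Fin (B i) → Carrier) → ∏∏ (λ i j → f i j * g i j) ≈ ∏∏ f * ∏∏ g
      ∏∏-* f g = trans (∏ᶠ-cong (λ i → ∏ᶠ-* {B i} (f i) (g i))) (∏ᶠ-* {n} (λ i → ∏ᶠ (f i)) (λ i → ∏ᶠ (g i)))

      Σ-grid-split : ∀ k (F : Grid B (Subset (suc k)) → Carrier) → GridExt F →
        Σᴸ (grids (subsets (suc k))) F ≈ Σᴸ (grids (subsets k)) (λ T → Σᴸ (grids bits) (λ b → F (λ i j → T i j ∷ʳ b i j)))
      Σ-grid-split k F ext = Σ-split (λ i → Fin (B i) → Subset (suc k)) (λ i → Fin (B i) → Subset k) (λ i → Fin (B i) → Bool)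
        (λ i p q → ∀ j → p j ≡ q j) (λ _ _ → ≡.refl) _ _ _ (λ i p q j → p j ∷ʳ q j)
        (λ i f resp → Σ-split (λ _ → Subset (suc k)) (λ _ → Subset k) (λ _ → Bool) (λ _ → _≡_) (λ _ → ≡.refl)
          (λ _ → subsets (suc k)) (λ _ → subsets k) (λ _ → bits) (λ _ → _∷ʳ_)
          (λ _ g _ → Σ-subsets-∷ʳ k g) f resp) F ext

      Σ-grid-select : ∀ (t : Grid B Bool) (F : Grid B Bool → Carrier) → GridExt F →
        Σᴸ (grids bits) (λ e → ∏∏ (λ i j → δᵇ (t i j) (e i j)) * F e) ≈ F t
      Σ-grid-select t F ext = Σ-select (λ i → Fin (B i) → Bool) (λ i p q → ∀ j → p j ≡ q j) (λ _ _ → ≡.refl) _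
        (λ i p → ∏ᶠ (λ j → δᵇ (t i j) (p j))) t
        (λ i f resp → Σ-select (λ _ → Bool) (λ _ → _≡_) (λ _ → ≡.refl) (λ _ → bits) (λ j → δᵇ (t i j)) (t i)
          (λ j g _ → Σ-bits-select (t i j) g) f resp) F ext

      Σ-grid-single : {A : Set} (a : A) (F : Grid B A → Carrier) → GridExt F → Σᴸ (grids (a ∷ [])) F ≈ F (λ _ _ → a)
      Σ-grid-single {A} a F ext = Σ-single (λ i → Fin (B i) → A) (λ i p q → ∀ j → p j ≡ q j) (λ _ _ → ≡.refl)
        (λ i → choices λ j → a ∷ []) (λ _ _ → a)
        (λ i f resp → Σ-single (λ _ → A) (λ _ → _≡_) (λ _ → ≡.refl) (λ _ → a ∷ []) (λ _ → a)
          (λ j g _ → +-identityʳ (g a)) f resp) F ext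

      Core : ∀ {k} → Grid B (Subset k) → Set
      Core T = (∀ i j j′ → toℕ j′ ≡ suc (toℕ j) → T i j ⊴ T i j′)
             × (∀ i i′ j j′ → toℕ i′ ≡ suc (toℕ i) → toℕ j′ ≡ toℕ j → T i j ◁ T i′ j′)

      core? : ∀ {k} (T : Grid B (Subset k)) → Dec (Core T)
      core? T = (all? λ i → all? λ j → all? λ j′ → (toℕ j′ ≟ suc (toℕ j)) →-dec (T i j ⊴? T i j′))
        ×-dec (all? λ i → all? λ i′ → all? λ j → all? λ j′ →
                 (toℕ i′ ≟ suc (toℕ i)) →-dec ((toℕ j′ ≟ toℕ j) →-dec (T i j ◁? T i′ j′)))

      core-ext : ∀ {k} {T T′ : Grid B (Subset k)} → (∀ i j → T i j ≡ T′ i j) → Core T → Core T′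
      core-ext e (r , c) = (λ i j j′ p → subst₂ _⊴_ (e i j) (e i j′) (r i j j′ p))
                         , (λ i i′ j j′ p q → subst₂ _◁_ (e i j) (e i′ j′) (c i i′ j j′ p q))

      cells : ∀ {k} → Grid B (Subset k) → Carrier
      cells T = ∏∏ (λ i j → cell (toℕ i) (toℕ j) (T i j))

      support : ∀ {k} → Grid B (Subset k) → Grid B Bool
      support T i j = occupied (T i j)

      match : Grid B Bool → Grid B Bool → Carrier
      match t e = ∏∏ (λ i j → δᵇ (t i j) (e i j))

      tableauTerm : ∀ {k} → Grid B Bool → Grid B (Subset k) → Carrier
      tableauTerm e T = match (support T) e * (ind (core? T) * cells T)

      -- The empty boxes of a grid lie outside of the shape e, so that tableaux of all shapes live on the same grid.
      Z : ℕ → Grid B Bool → Carrier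
      Z k e = Σᴸ (grids (subsets k)) (tableauTerm e)

      tableauTerm-ext : ∀ {k} e → GridExt (tableauTerm {k} e)
      tableauTerm-ext e {T} {T′} eq = *-cong
        (∏∏-cong (λ i j → reflexive (cong (λ S → δᵇ (occupied S) (e i j)) (eq i j))))
        (*-cong (ind-cong (core? T) (core? T′) (mk⇔ (core-ext eq) (core-ext (λ i j → ≡.sym (eq i j)))))
                (∏∏-cong (λ i j → reflexive (cong (cell (toℕ i) (toℕ j)) (eq i j)))))

      Z-ext : ∀ k → GridExt (Z k)
      Z-ext k eq = Σᴸ-cong (grids (subsets k)) (λ T → *-congʳ
        (∏∏-cong (λ i j → reflexive (cong (δᵇ (support T i j)) (eq i j)))))

      record Growth (e′ e b : Grid B Bool) : Set where
        constructor growth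
        field
          union : ∀ i j → e i j ∨ b i j ≡ e′ i j
          right : ∀ i j j′ → toℕ j′ ≡ suc (toℕ j) → b i j ≡ true → e i j′ ≡ false
          below : ∀ i i′ j j′ → toℕ i′ ≡ suc (toℕ i) → toℕ j′ ≡ toℕ j → b i j ≡ true → e′ i′ j′ ≡ false

      match-ind : ∀ t e → match t e ≈ ind (all? λ i → all? λ j → t i j Bool.≟ e i j)
      match-ind t e = trans (∏ᶠ-cong (λ i → ∏ᶠ-ind (λ j → t i j Bool.≟ e i j))) (∏ᶠ-ind (λ i → all? λ j → t i j Bool.≟ e i j))

      core-growth : ∀ {k} e′ (T : Grid B (Subset k)) b →
        ((∀ i j → occupied (T i j ∷ʳ b i j) ≡ e′ i j) × Core (λ i j → T i j ∷ʳ b i j)) ⇔ (Core T × Growth e′ (support T) b)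
      core-growth e′ T b = mk⇔
        (λ (u , r , c) →
          ( (λ i j j′ p → proj₁ (Equivalence.to (⊴-∷ʳ (T i j) (T i j′) (b i j) (b i j′)) (r i j j′ p)))
          , (λ i i′ j j′ p q → proj₁ (Equivalence.to (◁-∷ʳ (T i j) (T i′ j′) (b i j) (b i′ j′)) (c i i′ j j′ p q))) )
          , growth (λ i j → ≡.trans (≡.sym (occupied-∷ʳ (T i j) (b i j))) (u i j))
              (λ i j j′ p → proj₂ (Equivalence.to (⊴-∷ʳ (T i j) (T i j′) (b i j) (b i j′)) (r i j j′ p)))
              (λ i i′ j j′ p q h → ≡.trans (≡.sym (≡.trans (≡.sym (occupied-∷ʳ (T i′ j′) (b i′ j′))) (u i′ j′)))
                (proj₂ (Equivalence.to (◁-∷ʳ (T i j) (T i′ j′) (b i j) (b i′ j′)) (c i i′ j j′ p q)) h)))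
        (λ ((r , c) , growth u r′ b′) →
          (λ i j → ≡.trans (occupied-∷ʳ (T i j) (b i j)) (u i j))
          , (λ i j j′ p → Equivalence.from (⊴-∷ʳ (T i j) (T i j′) (b i j) (b i j′)) (r i j j′ p , r′ i j j′ p))
          , (λ i i′ j j′ p q → Equivalence.from (◁-∷ʳ (T i j) (T i′ j′) (b i j) (b i′ j′))
              (c i i′ j j′ p q , λ h → ≡.trans (u i′ j′) (b′ i i′ j j′ p q h))))

      shape : (ℕ → ℕ) → Grid B Bool
      shape μ i = bar (μ (toℕ i))

      rowWeight : (ℕ → ℕ) → (ℕ → ℕ → Carrier) → Grid B Bool → Grid B Bool → Carrier
      rowWeight λs u e b = ∏ᶠ (λ i → κ false (λs (suc (toℕ i))) (λs (toℕ i)) (u (toℕ i)) (e i) (b i))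

      module _ {λs : ℕ → ℕ} (fits : ∀ i → λs (toℕ i) ≤ B i) (null : ∀ i → n ≤ i → λs i ≡ 0) where

        -- The column condition only says that nothing of the shape `λs` lies below an entered box,
        -- that is, a bound by the length of the next row; the rows therefore decouple. Because `λs`
        -- fits the grid, a box of the shape below the given one is a box of the grid.
        growth-rows : ∀ e b → Growth (shape λs) e b ⇔
          (∀ i → RowGrowth false (λs (suc (toℕ i))) (λs (toℕ i)) (e i) (b i))
        growth-rows e b = mk⇔
          (λ (growth u r d) i → growth (u i) (λ _ _ ()) (r i) (λ j h → ℕₚ.≮⇒≥ (λ lt → clash i j d h lt)))
          (λ g → growth (λ i → RowGrowth.union (g i)) (λ i → RowGrowth.adjacent (g i))
            (λ i i′ j j′ p q h → dec-false (toℕ j′ <? λs (toℕ i′)) (λ lt → ℕₚ.<⇒≱ lt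
              (≡.subst₂ _≤_ (cong λs (≡.sym p)) (≡.sym q) (RowGrowth.below (g i) j h)))))
          where
          clash : ∀ i j → (∀ i i′ j j′ → toℕ i′ ≡ suc (toℕ i) → toℕ j′ ≡ toℕ j → b i j ≡ true → shape λs i′ j′ ≡ false) →
                    b i j ≡ true → ¬ toℕ j < λs (suc (toℕ i))
          clash i j d h lt with suc (toℕ i) <? n
          ... | no n≤i = ℕₚ.n≮0 (subst (toℕ j <_) (null (suc (toℕ i)) (ℕₚ.≮⇒≥ n≤i)) lt)
          ... | yes i<n = contradiction (≡.trans (≡.sym covered) (d i i′ j j′ i′≡ j′≡ h)) λ ()
            where
            i′ = fromℕ< i<n
            i′≡ = toℕ-fromℕ< i<n
            lt′ : toℕ j < λs (toℕ i′)
            lt′ = subst (λ r → toℕ j < λs r) (≡.sym i′≡) lt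
            j<B = ℕₚ.<-≤-trans lt′ (fits i′)
            j′ = fromℕ< j<B
            j′≡ = toℕ-fromℕ< j<B
            covered : shape λs i′ j′ ≡ true
            covered = dec-true (toℕ j′ <? λs (toℕ i′)) (subst (_< λs (toℕ i′)) (≡.sym j′≡) lt′)

        tableauTerm-∷ʳ : ∀ {k} (T : Grid B (Subset k)) b → tableauTerm (shape λs) (λ i j → T i j ∷ʳ b i j) ≈
          (ind (core? T) * cells T) * rowWeight λs (factor (suc k)) (support T) b
        tableauTerm-∷ʳ {k} T b = begin
          match (support T′) (shape λs) * (ind (core? T′) * cells T′)
            ≈⟨ *-cong (match-ind (support T′) (shape λs))
                 (*-congˡ (trans (∏∏-cong (λ i j → cell-∷ʳ (toℕ i) (toℕ j) (T i j) (b i j))) (∏∏-* _ _))) ⟩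
          ind E? * (ind (core? T′) * (cells T * Ω))
            ≈⟨ trans (sym (*-assoc _ _ _)) (*-congʳ (sym (ind-× E? (core? T′)))) ⟩
          ind (E? ×-dec core? T′) * (cells T * Ω)
            ≈⟨ *-congʳ (trans (ind-cong (E? ×-dec core? T′) (core? T ×-dec rowGrowths?) (mk⇔
                 (λ h → let (c , g) = Equivalence.to (core-growth (shape λs) T b) h in
                        c , Equivalence.to (growth-rows (support T) b) g)
                 (λ (c , g) → Equivalence.from (core-growth (shape λs) T b) (c , Equivalence.from (growth-rows (support T) b) g))))
                 (ind-× (core? T) rowGrowths?)) ⟩
          (ind (core? T) * ind rowGrowths?) * (cells T * Ω)
            ≈⟨ solve 4 (λ a b c d → (a :* b) :* (c :* d) := (a :* c) :* (b :* d)) refl _ _ _ _ ⟩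
          (ind (core? T) * cells T) * (ind rowGrowths? * Ω)
            ≈⟨ *-congˡ (trans (*-congʳ (sym (∏ᶠ-ind rowGrowth?ᵢ))) (trans (sym (∏ᶠ-* {n} (λ i → ind (rowGrowth?ᵢ i)) (λ i → ∏ᶠ (ωs i))))
                 (∏ᶠ-cong (λ i → sym (κ-growth false (λs (suc (toℕ i))) (λs (toℕ i)) (factor (suc k) (toℕ i)) (support T i) (b i)))))) ⟩
          (ind (core? T) * cells T) * rowWeight λs (factor (suc k)) (support T) b ∎
          where
          T′ : Grid B (Subset (suc k))
          T′ i j = T i j ∷ʳ b i j
          ωs : ∀ i → Fin (B i) → Carrier
          ωs i j = ω (support T i j) (b i j) (factor (suc k) (toℕ i) (toℕ j))
          Ω = ∏∏ ωs
          E? = all? λ i → all? λ j → support T′ i j Bool.≟ shape λs i j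
          rowGrowth?ᵢ : ∀ i → Dec (RowGrowth false (λs (suc (toℕ i))) (λs (toℕ i)) (support T i) (b i))
          rowGrowth?ᵢ i = rowGrowth? false (λs (suc (toℕ i))) (λs (toℕ i)) (support T i) (b i)
          rowGrowths? = all? rowGrowth?ᵢ

        Z-suc : ∀ k → Z (suc k) (shape λs) ≈
          Σᴸ (grids bits) (λ e → Σᴸ (grids bits) (λ b → rowWeight λs (factor (suc k)) e b * Z k e))
        Z-suc k = begin
          Z (suc k) (shape λs)
            ≈⟨ Σ-grid-split k (tableauTerm (shape λs)) (tableauTerm-ext (shape λs)) ⟩
          Σᴸ (grids (subsets k)) (λ T → Σᴸ (grids bits) (λ b → tableauTerm (shape λs) (λ i j → T i j ∷ʳ b i j)))
            ≈⟨ Σᴸ-cong (grids (subsets k)) (λ T → trans (Σᴸ-cong (grids bits) (tableauTerm-∷ʳ T))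
                 (Σᴸ-*ˡ (grids bits) (c T) (w (support T)))) ⟩
          Σᴸ (grids (subsets k)) (λ T → c T * G (support T))
            -- The support of T becomes a summation variable e, so that the tableaux can be grouped
            -- by shape.
            ≈⟨ Σᴸ-cong (grids (subsets k)) (λ T → trans (*-congˡ (sym (Σ-grid-select (support T) G G-ext)))
                 (sym (Σᴸ-*ˡ (grids bits) (c T) (λ e → match (support T) e * G e)))) ⟩
          Σᴸ (grids (subsets k)) (λ T → Σᴸ (grids bits) (λ e → c T * (match (support T) e * G e)))
            ≈⟨ Σᴸ-swap (grids (subsets k)) (grids bits) _ ⟩
          Σᴸ (grids bits) (λ e → Σᴸ (grids (subsets k)) (λ T → c T * (match (support T) e * G e)))
            ≈⟨ Σᴸ-cong (grids bits) (λ e → trans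
                 (Σᴸ-cong (grids (subsets k)) (λ T → solve 3 (λ c m g → c :* (m :* g) := (m :* c) :* g) refl (c T) _ _))
                 (Σᴸ-*ʳ (grids (subsets k)) (G e) (tableauTerm e))) ⟩
          Σᴸ (grids bits) (λ e → Z k e * G e)
            ≈⟨ Σᴸ-cong (grids bits) (λ e → trans (*-comm _ _) (sym (Σᴸ-*ʳ (grids bits) (Z k e) (w e)))) ⟩
          Σᴸ (grids bits) (λ e → Σᴸ (grids bits) (λ b → w e b * Z k e)) ∎
          where
          c : Grid B (Subset k) → Carrier
          c T = ind (core? T) * cells T
          w : Grid B Bool → Grid B Bool → Carrier
          w = rowWeight λs (factor (suc k))
          G : Grid B Bool → Carrier
          G e = Σᴸ (grids bits) (w e)
          κ-ext : ∀ {B} p l′ l u {e e′ : Fin B → Bool} b → (∀ j → e j ≡ e′ j) → κ p l′ l u e b ≈ κ p l′ l u e′ b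
          κ-ext {zero}  p l′ l u b eq = refl
          κ-ext {suc B} p l′ l u b eq = *-cong
            (reflexive (cong (λ a → ind (check? p l′ l a (b zero)) * ω a (b zero) (u 0)) (eq zero)))
            (κ-ext (b zero) (pred l′) (pred l) (u ∘ suc) (b ∘ suc) (eq ∘ suc))
          G-ext : GridExt G
          G-ext eq = Σᴸ-cong (grids bits) (λ b → ∏ᶠ-cong (λ i →
            κ-ext false (λs (suc (toℕ i))) (λs (toℕ i)) (factor (suc k) (toℕ i)) (b i) (eq i)))

    -- The supports e range over all bit patterns; in each row `rowSum-row` leaves only those that
    -- are initial segments, whose lengths become the parts of μ.
    strip-sum : ∀ {n} (B : Fin n → ℕ) {λs} u {F : Grid B Bool → Carrier} → GridExt B F → Decreasing λs →
      (∀ i → λs (toℕ i) ≤ B i) →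
      Σᴸ (grids B bits) (λ e → Σᴸ (grids B bits) (λ b → rowWeight B λs u e b * F e)) ≈ Strip n λs u (λ μ → F (shape B μ))
    strip-sum {zero} B u ext dec fits =
      trans (+-identityʳ _) (trans (+-identityʳ _) (trans (*-identityˡ _) (ext λ ())))
    strip-sum {suc n} B {λs} u {F} ext dec fits = begin
      Σᴸ (grids B bits) (λ e → Σᴸ (grids B bits) (λ b → rowWeight B λs u e b * F e))
        ≈⟨ Σ-choices-suc A as (λ e → Σᴸ (grids B bits) (λ b → rowWeight B λs u e b * F e)) ⟩
      Σᴸ row₀ (λ e → Σᴸ rest (λ r → Σᴸ (grids B bits) (λ b → rowWeight B λs u (cons A e r) b * F (cons A e r))))
        ≈⟨ Σᴸ-cong row₀ (λ e → Σᴸ-cong rest (λ r →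
             Σ-choices-suc A as (λ b → rowWeight B λs u (cons A e r) b * F (cons A e r)))) ⟩
      Σᴸ row₀ (λ e → Σᴸ rest (λ r → Σᴸ row₀ (λ b → Σᴸ rest (λ t → (κ₀ e b * w r t) * F (cons A e r)))))
        ≈⟨ Σᴸ-cong row₀ (λ e → Σᴸ-swap rest row₀ (λ r b → Σᴸ rest (λ t → (κ₀ e b * w r t) * F (cons A e r)))) ⟩
      Σᴸ row₀ (λ e → Σᴸ row₀ (λ b → Σᴸ rest (λ r → Σᴸ rest (λ t → (κ₀ e b * w r t) * F (cons A e r)))))
        ≈⟨ Σᴸ-cong row₀ (λ e → Σᴸ-cong row₀ (λ b → trans
             (Σᴸ-cong rest (λ r → trans (Σᴸ-cong rest (λ t → *-assoc _ _ _)) (Σᴸ-*ˡ rest (κ₀ e b) (λ t → w r t * F (cons A e r)))))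
             (Σᴸ-*ˡ rest (κ₀ e b) (λ r → Σᴸ rest (λ t → w r t * F (cons A e r)))))) ⟩
      rowSum (B zero) false (λs 1) (λs 0) (u 0) inner
        ≈⟨ rowSum-row (B zero) (u 0) inner
             (λ eq → Σᴸ-cong rest (λ r → Σᴸ-cong rest (λ t → *-congˡ (Ext-head A E (λ _ _ → ≡.refl) ext r eq))))
             (dec 0) (fits zero) ⟩
      Row (λs 1) (λs 0 ∸ λs 1) (u 0) (λ c → inner (bar c))
        ≈⟨ Row-cong (λs 1) (λs 0 ∸ λs 1) (λ _ → refl) (λ c _ _ → trans
             (strip-sum (B ∘ suc) {λs ∘ suc} (u ∘ suc) {λ r → F (cons A (bar c) r)}
               (Ext-cons A E (λ _ _ → ≡.refl) ext (bar c)) (dec ∘ suc) (λ i → fits (suc i)))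
             (Strip-cong n (dec ∘ suc) (λ _ _ _ → refl) (λ μ _ → ext λ { zero _ → ≡.refl ; (suc i) _ → ≡.refl }))) ⟩
      Strip (suc n) λs u (λ μ → F (shape B μ)) ∎
      where
      A : Fin (suc n) → Set
      A i = Fin (B i) → Bool
      E : ∀ i → A i → A i → Set
      E i p q = ∀ j → p j ≡ q j
      as : ∀ i → List (A i)
      as i = choices λ j → bits
      row₀ = rows (B zero)
      rest = grids (B ∘ suc) bits
      κ₀ : A zero → A zero → Carrier
      κ₀ = κ false (λs 1) (λs 0) (u 0)
      w : Grid (B ∘ suc) Bool → Grid (B ∘ suc) Bool → Carrier
      w = rowWeight (B ∘ suc) (λs ∘ suc) (u ∘ suc)
      inner : A zero → Carrier
      inner e = Σᴸ rest (λ r → Σᴸ rest (λ t → w r t * F (cons A e r)))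

    Z-branching : ∀ {n} (B : Fin n → ℕ) {λs} → Decreasing λs → (∀ i → λs (toℕ i) ≤ B i) → (∀ i → n ≤ i → λs i ≡ 0) →
      ∀ k → Z B (suc k) (shape B λs) ≈ Strip n λs (factor (suc k)) (λ μ → Z B k (shape B μ))
    Z-branching B dec fits null k = trans (Z-suc B fits null k)
      (strip-sum B (factor (suc k)) (Z-ext B k) dec fits)

    Z-zero : ∀ {n} (B : Fin n → ℕ) e → (∀ i j → e i j ≡ false) → Z B 0 e ≈ 1#
    Z-zero {n} B e none = begin
      Z B 0 e
        ≈⟨ Σ-grid-single B [] (tableauTerm B e) (tableauTerm-ext B e) ⟩
      match B (λ _ _ → false) e * (ind (core? B (λ _ _ → [])) * cells B (λ _ _ → []))
        ≈⟨ *-cong (∏ᶠ-one (λ i → ∏ᶠ-one (λ j → reflexive (cong (δᵇ false) (none i j)))))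
             (*-cong (ind-yes (core? B (λ _ _ → [])) ((λ _ _ _ _ → All.[]) , (λ _ _ _ _ _ _ → All.[])))
               (∏ᶠ-one {n} {λ i → ∏ᶠ {B i} (λ j → cell {0} (toℕ i) (toℕ j) [])} (λ i → ∏ᶠ-one {B i} {λ j → cell {0} (toℕ i) (toℕ j) []}
                 (λ j → trans (*-identityʳ _) β^-zero)))) ⟩
      1# * (1# * 1#)
        ≈⟨ trans (*-identityˡ _) (*-identityˡ _) ⟩
      1# ∎
      where import Data.List.Relation.Unary.All as All

    Z-zero-vanishes : ∀ {n} (B : Fin n → ℕ) e i j → e i j ≡ true → Z B 0 e ≈ 0#
    Z-zero-vanishes B e i j some = begin
      Z B 0 e
        ≈⟨ Σ-grid-single B [] (tableauTerm B e) (tableauTerm-ext B e) ⟩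
      match B (λ _ _ → false) e * (ind (core? B (λ _ _ → [])) * cells B (λ _ _ → []))
        ≈⟨ *-congʳ (trans (match-ind B (λ _ _ → false) e)
             (ind-no (all? λ i → all? λ j → false Bool.≟ e i j) (λ h → contradiction (≡.trans (h i j) some) λ ()))) ⟩
      0# * (ind (core? B (λ _ _ → [])) * cells B (λ _ _ → []))
        ≈⟨ zeroˡ _ ⟩
      0# ∎

-- From factorial Grothendieck polynomials to tableau sums on a grid.

module TableauFormulas where

  open import Defs hiding (var; β; π; X; Y; _⊕_; β^)
  open StripSums
  open MonomialProducts
  open SubsetEntries
  open ChoiceSums
  open TableauSums
  open import Level using (0ℓ)
  open import Algebra.Bundles using (CommutativeRing)
  open import Data.Bool using (Bool; true)
  import Data.Bool as Bool
  open import Data.Fin as Fin using (Fin; zero; suc; toℕ)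
  open import Data.Fin.Properties using (all?; toℕ<n)
  open import Data.Fin.Subset using (∣_∣)
  open import Data.List as List using (List; []; _∷_; map; concatMap; allFin; tabulate; length; lookup)
  import Data.List.Properties as Listₚ
  open import Data.Nat as ℕ using (ℕ; zero; suc; _≤_; _<_; z≤n; _∸_; _<?_)
  import Data.Nat.Properties as ℕₚ
  open import Data.Nat.ListAction using (sum)
  open import Data.Product using (_×_; _,_; proj₁)
  open import Function using (_∘_; id)
  open import Function.Bundles using (_⇔_; mk⇔; Equivalence)
  open import Relation.Nullary using (Dec; yes; no; _×-dec_)
  open import Relation.Nullary.Decidable using (dec-true)
  open import Relation.Binary.PropositionalEquality as ≡ using (_≡_; cong; subst)

  length-concatMap : {A B : Set} (g : A → List B) (as : List A) → length (concatMap g as) ≡ sum (map (length ∘ g) as)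
  length-concatMap g []       = ≡.refl
  length-concatMap g (a ∷ as) = ≡.trans (Listₚ.length-++ (g a)) (cong (length (g a) ℕ.+_) (length-concatMap g as))

  length-boxes : ∀ μ → length (boxes μ) ≡ sum μ
  length-boxes μ = ≡.trans (length-concatMap row (allFin (length μ)))
    (cong sum (≡.trans (Listₚ.map-cong row-length (allFin (length μ)))
      (≡.trans (Listₚ.map-tabulate id (lookup μ)) (Listₚ.tabulate-lookup μ))))
    where
    row : (i : Fin (length μ)) → List (Box μ)
    row i = map (i ,_) (allFin (lookup μ i))
    row-length : ∀ i → length (row i) ≡ lookup μ i
    row-length i = ≡.trans (Listₚ.length-map {B = Box μ} (i ,_) (allFin (lookup μ i))) (Listₚ.length-tabulate {n = lookup μ i} id)

  part-lookup : ∀ μ (i : Fin (length μ)) → part μ (suc (toℕ i)) ≡ lookup μ i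
  part-lookup (a ∷ μ) zero    = ≡.refl
  part-lookup (a ∷ μ) (suc i) = part-lookup μ i

  module TableauFormula (R : CommutativeRing 0ℓ 0ℓ) (β^ : ℕ → CommutativeRing.Carrier R)
    (β^-zero : CommutativeRing._≈_ R (β^ 0) (CommutativeRing.1# R))
    (β^-+ : ∀ a b → CommutativeRing._≈_ R (β^ (a ℕ.+ b)) (CommutativeRing._*_ R (β^ a) (β^ b)))
    (x y : ℕ → CommutativeRing.Carrier R) where

    open CommutativeRing R hiding (zero)
    open ListProducts R (β^ 1)
    open ListSums R
    open Tableaux R β^ β^-zero β^-+ x y public
    open import Relation.Binary.Reasoning.Setoid setoid

    tableauWeight : ∀ {k} μ → Filling k μ → Carrier
    tableauWeight μ T = β^ (size μ T ∸ sum μ) *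
      ∏ᴸ (boxes μ) (λ (i , j) → ∏ᴸ (entries (T i j)) (λ r → factor r (toℕ i) (toℕ j)))

    -- For polynomials this unfolds to `factorialGrothendieck`; over a general ring it also covers
    -- the truncated one.
    factorial : List ℕ → ℕ → Carrier
    factorial μ k = Σᴸ (setValuedTableaux k μ) (tableauWeight μ)

    ∏ᴸ-tabulate : ∀ {n} {A : Set} (g : Fin n → A) (f : A → Carrier) → ∏ᴸ (tabulate g) f ≈ ∏ᶠ (f ∘ g)
    ∏ᴸ-tabulate {zero}  g f = refl
    ∏ᴸ-tabulate {suc n} g f = *-congˡ (∏ᴸ-tabulate (g ∘ suc) f)

    ∏ᴸ-concatMap : {A B : Set} (g : A → List B) (as : List A) (f : B → Carrier) →
                   ∏ᴸ (concatMap g as) f ≈ ∏ᴸ as (λ a → ∏ᴸ (g a) f)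
    ∏ᴸ-concatMap g []       f = refl
    ∏ᴸ-concatMap g (a ∷ as) f = trans (∏ᴸ-++ (g a) _ f) (*-congˡ (∏ᴸ-concatMap g as f))

    ∏ᴸ-* : {A : Set} (as : List A) (f g : A → Carrier) → ∏ᴸ as f * ∏ᴸ as g ≈ ∏ᴸ as (λ a → f a * g a)
    ∏ᴸ-* []       f g = *-identityˡ 1#
    ∏ᴸ-* (a ∷ as) f g = trans
      (trans (*-assoc _ _ _) (trans (*-congˡ (trans (sym (*-assoc _ _ _)) (trans (*-congʳ (*-comm _ _)) (*-assoc _ _ _)))) (sym (*-assoc _ _ _))))
      (*-congˡ (∏ᴸ-* as f g))

    ∏ᴸ-boxes : ∀ μ (f : Box μ → Carrier) → ∏ᴸ (boxes μ) f ≈ ∏∏ (lookup μ) (λ i j → f (i , j))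
    ∏ᴸ-boxes μ f = trans (∏ᴸ-concatMap (λ i → map (i ,_) (allFin (lookup μ i))) (allFin (length μ)) f)
      (trans (∏ᴸ-tabulate id (λ i → ∏ᴸ (map (i ,_) (allFin (lookup μ i))) f))
        (∏ᶠ-cong (λ i → trans (∏ᴸ-map (i ,_) (allFin (lookup μ i)) f) (∏ᴸ-tabulate id (λ j → f (i , j))))))

    length≤sum : {A : Set} (as : List A) {f : A → ℕ} → (∀ a → 1 ≤ f a) → length as ≤ sum (map f as)
    length≤sum []       p = z≤n
    length≤sum (a ∷ as) p = ℕₚ.+-mono-≤ (p a) (length≤sum as p)

    -- Distributes the excess |T| - |λ| over the boxes; since every box has at least one entry, no
    -- truncation occurs.
    β^-sum : {A : Set} (as : List A) {f : A → ℕ} → (∀ a → 1 ≤ f a) →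
             β^ (sum (map f as) ∸ length as) ≈ ∏ᴸ as (λ a → β^ (f a ∸ 1))
    β^-sum []       p = β^-zero
    β^-sum (a ∷ as) {f} p with f a | p a
    ... | suc m | _ = trans (reflexive (cong β^ (ℕₚ.+-∸-assoc m (length≤sum as p))))
                            (trans (β^-+ m _) (*-congˡ (β^-sum as p)))

    tableauWeight-cells : ∀ {k} μ (T : Filling k μ) → (∀ i j → occupied (T i j) ≡ true) →
                          tableauWeight μ T ≈ cells (lookup μ) T
    tableauWeight-cells μ T occ = begin
      tableauWeight μ T
        ≈⟨ *-congʳ (trans (reflexive (cong (λ l → β^ (size μ T ∸ l)) (≡.sym (length-boxes μ))))
             (β^-sum (boxes μ) (λ (i , j) → occupied⇒size (T i j) (occ i j)))) ⟩
      ∏ᴸ (boxes μ) (λ (i , j) → β^ (∣ T i j ∣ ∸ 1)) *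
        ∏ᴸ (boxes μ) (λ (i , j) → ∏ᴸ (entries (T i j)) (λ r → factor r (toℕ i) (toℕ j)))
        ≈⟨ ∏ᴸ-* (boxes μ) _ _ ⟩
      ∏ᴸ (boxes μ) (λ (i , j) → cell (toℕ i) (toℕ j) (T i j))
        ≈⟨ ∏ᴸ-boxes μ _ ⟩
      cells (lookup μ) T ∎

    full : ∀ μ → Grid (lookup μ) Bool
    full μ _ _ = true

    setValued-core : ∀ {k} μ (T : Filling k μ) →
      IsSetValuedTableau μ T ⇔ ((∀ i j → occupied (T i j) ≡ true) × Core (lookup μ) T)
    setValued-core μ T = mk⇔
      (λ (ne , r , c) → let occ = λ i j → nonempty⇒occupied (T i j) (ne i j) in
        occ , (λ i j j′ p → Equivalence.to (max≤min (T i j) (T i j′)) (r i j j′ p))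
            , (λ i i′ j j′ p q → Equivalence.to (max<min (T i j) (T i′ j′) (occ i′ j′)) (c i i′ j j′ p q)))
      (λ (occ , r , c) →
        (λ i j → occupied⇒nonempty (T i j) (occ i j))
        , (λ i j j′ p → Equivalence.from (max≤min (T i j) (T i j′)) (r i j j′ p))
        , (λ i i′ j j′ p q → Equivalence.from (max<min (T i j) (T i′ j′) (occ i′ j′)) (c i i′ j j′ p q)))

    factorial-Z : ∀ μ k → factorial μ k ≈ Z (lookup μ) k (full μ)
    factorial-Z μ k = trans (Σᴸ-filter (isSetValuedTableau? μ) (choices λ i → choices λ j → subsets k) (tableauWeight μ))
      (Σᴸ-cong (choices λ i → choices λ j → subsets k) term)
      where
      term : ∀ T → ind (isSetValuedTableau? μ T) * tableauWeight μ T ≈ tableauTerm (lookup μ) (full μ) T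
      term T = trans weights (sym (begin
        tableauTerm (lookup μ) (full μ) T
          ≈⟨ *-congʳ (match-ind (lookup μ) (support (lookup μ) T) (full μ)) ⟩
        ind E? * (ind C? * cells (lookup μ) T)
          ≈⟨ trans (sym (*-assoc _ _ _)) (*-congʳ (sym (ind-× E? C?))) ⟩
        ind (E? ×-dec C?) * cells (lookup μ) T
          ≈⟨ *-congʳ (ind-cong (E? ×-dec C?) (isSetValuedTableau? μ T)
               (mk⇔ (Equivalence.from (setValued-core μ T)) (Equivalence.to (setValued-core μ T)))) ⟩
        ind (isSetValuedTableau? μ T) * cells (lookup μ) T ∎))
        where
        E? = all? λ i → all? λ j → occupied (T i j) Bool.≟ true
        C? = core? (lookup μ) T
        weights : ind (isSetValuedTableau? μ T) * tableauWeight μ T ≈ ind (isSetValuedTableau? μ T) * cells (lookup μ) T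
        weights = by-cases (isSetValuedTableau? μ T)
          where
          by-cases : (d : Dec (IsSetValuedTableau μ T)) → ind d * tableauWeight μ T ≈ ind d * cells (lookup μ) T
          by-cases (yes p) = *-congˡ (tableauWeight-cells μ T (proj₁ (Equivalence.to (setValued-core μ T) p)))
          by-cases (no _)  = trans (zeroˡ _) (sym (zeroˡ _))

    open Strips R (β^ 1) using (Strip-small)

    factorial-shape : ∀ μ k → factorial μ k ≈ Z (lookup μ) k (shape (lookup μ) (λ i → part μ (suc i)))
    factorial-shape μ k = trans (factorial-Z μ k) (Z-ext (lookup μ) k (λ i j →
      ≡.sym (dec-true (toℕ j <? part μ (suc (toℕ i))) (subst (toℕ j <_) (≡.sym (part-lookup μ i)) (toℕ<n j)))))

    Z-stable : ∀ {n} (B : Fin n → ℕ) {λs} → Decreasing λs → (∀ i → λs (toℕ i) ≤ B i) → (∀ i → n ≤ i → λs i ≡ 0) →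
      ∀ {k} → (∀ i j → i < n → factor (suc k) i j ≈ 0#) → Z B (suc k) (shape B λs) ≈ Z B k (shape B λs)
    Z-stable {n} B dec fits null {k} small = trans (Z-branching B dec fits null k)
      (Strip-small n dec (λ e → Z-ext B k (λ i j → cong (λ c → bar c j) (e (toℕ i)))) small null)

-- Comparison of the two branching rules.

module BranchingFamilies where

  open StripSums
  open DividedDifferences
  open BranchingRule
  open import Level using (0ℓ)
  open import Algebra.Bundles using (CommutativeRing)
  open import Data.Bool using (true; false; if_then_else_)
  open import Data.Nat as ℕ using (ℕ; zero; suc; _≤_; _<_; z≤n; _∸_; _<?_)
  import Data.Nat.Properties as ℕₚ
  open import Relation.Nullary using (Dec; yes; no; does; contradiction)
  open import Relation.Nullary.Decidable using (dec-true)
  open import Relation.Binary.PropositionalEquality as ≡ using (_≡_; cong; subst)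

  -- The properties of tableau sums that determine them. ν is the shape of the grid, and the shapes
  -- that occur stay inside it.
  record BranchingFamily (R : CommutativeRing 0ℓ 0ℓ) (A : GrothendieckAlgebra R) (n : ℕ) (ν : ℕ → ℕ)
                         (Z : ℕ → (ℕ → ℕ) → CommutativeRing.Carrier R) : Set where
    open CommutativeRing R using (_≈_; 0#; 1#)
    open Branching R A
    field
      ν-null          : ∀ i → n ≤ i → ν i ≡ 0
      Z-ext           : ∀ k → Extensional (Z k)
      Z-branching     : ∀ k {λs} → Decreasing λs → (∀ i → λs i ≤ ν i) →
                        Z (suc k) λs ≈ Strip n λs (λ i j → x (suc k) ⊕ y (suc k ℕ.+ j ∸ i)) (Z k)
      Z-zero          : ∀ {λs} → (∀ i → λs i ≡ 0) → Z 0 λs ≈ 1#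
      Z-zero-vanishes : ∀ {λs} → (∀ i → λs i ≤ ν i) → 0 < λs 0 → Z 0 λs ≈ 0#

  module Comparison (R : CommutativeRing 0ℓ 0ℓ) (A : GrothendieckAlgebra R) {n : ℕ} {ν : ℕ → ℕ}
    {Z : ℕ → (ℕ → ℕ) → CommutativeRing.Carrier R} (family : BranchingFamily R A n ν Z) where

    open Branching R A
    open BranchingFamily family
    open CommutativeRing R hiding (zero)
    open import Relation.Binary.Reasoning.Setoid setoid

    interlaces-decreasing : ∀ {r λs μ} → Interlaces r λs μ → Decreasing μ
    interlaces-decreasing {r} {λs} {μ} (interlacing lower upper null) i with suc i <? r
    ... | yes p = ℕₚ.≤-trans (upper (suc i) p) (lower i (ℕₚ.<-trans (ℕₚ.n<1+n i) p))
    ... | no ¬p = ℕₚ.≤-trans (ℕₚ.≤-reflexive (null (suc i) (ℕₚ.≮⇒≥ ¬p))) z≤n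

    interlaces-inside : ∀ {r λs μ} → (∀ i → λs i ≤ ν i) → Interlaces r λs μ → ∀ i → μ i ≤ ν i
    interlaces-inside {r} inside (interlacing lower upper null) i with i <? r
    ... | yes p = ℕₚ.≤-trans (upper i p) (inside i)
    ... | no ¬p = ℕₚ.≤-trans (ℕₚ.≤-reflexive (null i (ℕₚ.≮⇒≥ ¬p))) z≤n

    inside-null : ∀ (λs : ℕ → ℕ) → (∀ i → λs i ≤ ν i) → ∀ i → n ≤ i → λs i ≡ 0
    inside-null λs inside i p = ℕₚ.n≤0⇒n≡0 (ℕₚ.≤-trans (inside i) (ℕₚ.≤-reflexive (ν-null i p)))

    decreasing-null : ∀ {λs k} → Decreasing λs → λs k ≡ 0 → ∀ i → k ≤ i → λs i ≡ 0
    decreasing-null {λs} {k} dec e i p = subst (λ j → λs j ≡ 0) (ℕₚ.m+[n∸m]≡n p) (go (i ∸ k))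
      where
      go : ∀ d → λs (k ℕ.+ d) ≡ 0
      go zero    = ≡.trans (cong λs (ℕₚ.+-identityʳ k)) e
      go (suc d) = ℕₚ.n≤0⇒n≡0 (ℕₚ.≤-trans (ℕₚ.≤-reflexive (cong λs (ℕₚ.+-suc k d)))
                     (ℕₚ.≤-trans (dec (k ℕ.+ d)) (ℕₚ.≤-reflexive (go d))))

    -- By interlacing, each removal of a largest entry deletes at most one row, so more than k rows
    -- cannot be exhausted by k entries.
    Z-vanishes : ∀ k {λs} → Decreasing λs → (∀ i → λs i ≤ ν i) → 0 < λs k → Z k λs ≈ 0#
    Z-vanishes zero    dec inside pos = Z-zero-vanishes inside pos
    Z-vanishes (suc k) {λs} dec inside pos = trans (Z-branching k dec inside)
      (trans (Strip-cong n dec (λ _ _ _ → refl) (λ μ int →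
                Z-vanishes k (interlaces-decreasing int) (interlaces-inside inside int)
                  (ℕₚ.<-≤-trans pos (Interlaces.lower int k k<n))))
             (Strip-zero n))
      where
      k<n : k < n
      k<n with k <? n
      ... | yes p = p
      ... | no ¬p = contradiction (subst (0 <_) (inside-null λs inside (suc k) (ℕₚ.m≤n⇒m≤1+n (ℕₚ.≮⇒≥ ¬p))) pos) λ ()

    -- Induction on k. The strip for Z has n rows, that for Φ only k rows and a separate factorial
    -- power. `Z-vanishes` excludes every μ with a part in row `k`, and `Strip-last` then rewrites
    -- the first sum as the second.
    Z-Φ : ∀ k {λs} → Decreasing λs → (∀ i → λs i ≤ ν i) → λs k ≡ 0 → Z k λs ≈ Φ k λs
    Z-Φ zero    dec inside null = Z-zero (λ i → decreasing-null dec null i z≤n)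
    Z-Φ (suc k) {λs} dec inside null = begin
      Z (suc k) λs
        ≈⟨ Z-branching k dec inside ⟩
      Strip n λs u (Z k)
        ≈⟨ Strip-cong n dec (λ _ _ _ → refl) (λ μ int → truncated μ (interlaces-decreasing int) (interlaces-inside inside int)) ⟩
      Strip n λs u Z′
        ≈⟨ Strip-last n k dec Z′-ext (inside-null λs inside) (decreasing-null dec null) Z′-vanishes ⟩
      Strip k λs u Z′ * ∏ (λs k) (u k)
        ≈⟨ *-cong (Strip-cong k dec (λ _ _ _ → refl) (λ μ int →
             let dec′ = interlaces-decreasing int ; inside′ = interlaces-inside inside int in
             trans (sym (truncated μ dec′ inside′)) (Z-Φ k dec′ inside′ (Interlaces.null int k ℕₚ.≤-refl))))
           (∏-cong (λs k) (λ j _ → reflexive (cong (λ r → x (suc k) ⊕ y r)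
             (≡.trans (cong (_∸ k) (≡.sym (ℕₚ.+-suc k j))) (ℕₚ.m+n∸m≡n k (suc j)))))) ⟩
      Strip k λs u (Φ k) * pw (λs k) (x (suc k))
        ≈⟨ branching k λs dec ⟨
      Φ (suc k) λs ∎
      where
      u : ℕ → ℕ → Carrier
      u i j = x (suc k) ⊕ y (suc k ℕ.+ j ∸ i)
      -- Strip-last asks for vanishing at all μ, not only at partitions.
      Z′ : (ℕ → ℕ) → Carrier
      Z′ μ = if does (0 <? μ k) then 0# else Z k μ
      Z′-vanishes : ∀ μ → 0 < μ k → Z′ μ ≈ 0#
      Z′-vanishes μ pos = reflexive (cong (if_then 0# else Z k μ) (dec-true (0 <? μ k) pos))
      truncated : ∀ μ → Decreasing μ → (∀ i → μ i ≤ ν i) → Z k μ ≈ Z′ μ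
      truncated μ dec′ inside′ = by-cases (0 <? μ k)
        where
        by-cases : (d : Dec (0 < μ k)) → Z k μ ≈ (if does d then 0# else Z k μ)
        by-cases (yes pos) = Z-vanishes k dec′ inside′ pos
        by-cases (no _)    = refl
      Z′-ext : Extensional Z′
      Z′-ext {μ} {μ′} e = trans (select (does (0 <? μ k)) (Z-ext k e))
        (reflexive (cong (λ c → if does (0 <? c) then 0# else Z k μ′) (e k)))
        where
        select : ∀ b → Z k μ ≈ Z k μ′ → (if b then 0# else Z k μ) ≈ (if b then 0# else Z k μ′)
        select true  _  = refl
        select false eq = eq

-- Stabilization and the common limit.

open import Data.Product using (Σ-syntax; _×_)
open import Defs
open PolynomialRing using (_≋_; commutativeRing; module Truncated; ≋-refl; coeff-≋; index)
open import Algebra.Bundles using (CommutativeRing)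
open StripSums using (Decreasing)
open GrothendieckRecursion using (polynomialAlgebra; module B; 𝒢-cong; module Polynomials)
open GrassmannianPermutations
open TableauFormulas using (part-lookup; module TableauFormula)
open BranchingFamilies using (BranchingFamily; module Comparison)
open import Data.Fin using (Fin; zero; suc; toℕ; fromℕ<)
open import Data.Fin.Properties using (toℕ<n; toℕ-fromℕ<)
open import Data.List using (List; []; _∷_; length; lookup)
open import Data.List.Relation.Unary.All as All using (All; []; _∷_)
open import Data.List.Relation.Unary.Linked as Linked using (Linked)
open import Data.Nat
open import Data.Nat.Properties
open import Data.Product using (_,_; proj₂)
open import Relation.Nullary using (¬_; yes; no; contradiction)
open import Relation.Nullary.Decidable using (dec-true; dec-false)
open import Relation.Binary.PropositionalEquality as ≡ using (_≡_; refl; sym; trans; cong; cong₂; subst; subst₂)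

-- Prepending m fixed points amounts to appending m zero parts to the partition.
shift-permutation : ∀ μ {p} → length μ ≤ p → ∀ m i → (1^ m ×ₛ permutation μ p) i ≡ permutation μ (m + p) i
shift-permutation μ {p} len m i with i ≤? m
... | yes i≤m = sym (begin
  permutation μ (m + p) i             ≡⟨ permutation-≤ μ (≤-trans i≤m (m≤m+n m p)) ⟩
  i + part μ (suc (m + p) ∸ i)        ≡⟨ cong (λ r → i + part μ r) (+-∸-assoc 1 (≤-trans i≤m (m≤m+n m p))) ⟩
  i + part μ (suc (m + p ∸ i))
    ≡⟨ cong (i +_) (part-beyond μ (≤-trans len (≤-trans (m≤n+m p (m ∸ i)) (≤-reflexive (sym (+-∸-comm p i≤m)))))) ⟩
  i + 0                               ≡⟨ +-identityʳ i ⟩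
  i                                   ∎)
  where open ≡.≡-Reasoning
... | no i≰m with i ∸ m ≤? p
...   | yes q = sym (begin
  permutation μ (m + p) i             ≡⟨ permutation-≤ μ i≤m+p ⟩
  i + part μ (suc (m + p) ∸ i)        ≡⟨ cong₂ _+_ (sym i≡) (cong (part μ) index-eq) ⟩
  m + (i ∸ m) + part μ (suc p ∸ (i ∸ m)) ≡⟨ +-assoc m (i ∸ m) _ ⟩
  m + (i ∸ m + part μ (suc p ∸ (i ∸ m))) ∎)
  where
  open ≡.≡-Reasoning
  m≤i = <⇒≤ (≰⇒> i≰m)
  i≡ : m + (i ∸ m) ≡ i
  i≡ = m+[n∸m]≡n m≤i
  i≤m+p : i ≤ m + p
  i≤m+p = ≤-trans (≤-reflexive (sym i≡)) (+-monoʳ-≤ m q)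
  index-eq : suc (m + p) ∸ i ≡ suc p ∸ (i ∸ m)
  index-eq = trans (cong₂ _∸_ (sym (+-suc m p)) (sym i≡)) ([m+n]∸[m+o]≡n∸o m (suc p) (i ∸ m))
...   | no ¬q = sym (begin
  permutation μ (m + p) i             ≡⟨ permutation-> μ m+p<i ⟩
  i ∸ conjPart μ (i ∸ (m + p))        ≡⟨ cong₂ _∸_ (sym i≡) (cong (conjPart μ) (sym (∸-+-assoc i m p))) ⟩
  m + (i ∸ m) ∸ conjPart μ (i ∸ m ∸ p)
    ≡⟨ +-∸-assoc m (≤-trans (conjPart-length μ (i ∸ m ∸ p)) (≤-trans len (<⇒≤ (≰⇒> ¬q)))) ⟩
  m + (i ∸ m ∸ conjPart μ (i ∸ m ∸ p)) ∎)
  where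
  open ≡.≡-Reasoning
  i≡ : m + (i ∸ m) ≡ i
  i≡ = m+[n∸m]≡n (<⇒≤ (≰⇒> i≰m))
  m+p<i : m + p < i
  m+p<i = <-≤-trans (+-monoʳ-< m (≰⇒> ¬q)) (≤-reflexive i≡)

∸-< : ∀ {i c} → 1 ≤ i → 1 ≤ c → i ∸ c < i
∸-< {suc i} {suc c} _ _ = s≤s (m∸n≤m i c)

-- The position i = p + μ₁ is not fixed: its value is i minus the length of column μ₁, which is at
-- least 1. The empty partition gives the identity and no bound on N.
fits-in : ∀ {μ} → Linked _≥_ μ → ∀ {p N} → (∀ i → i > suc N → permutation μ p i ≡ i) →
          1 ≤ part μ 1 → p + part μ 1 ≤ suc N
fits-in {μ} sorted {p} {N} fixes pos = ≮⇒≥ λ big →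
  <-irrefl (trans (sym (permutation-> μ p<i)) (fixes i big))
    (∸-< (≤-trans pos (m≤n+m _ p)) (conjPart-> sorted 0 (subst (1 ≤_) (sym i∸p) pos) (≤-reflexive i∸p)))
  where
  i = p + part μ 1
  i∸p : i ∸ p ≡ part μ 1
  i∸p = m+n∸m≡n p _
  p<i : p < i
  p<i = ≤-trans (≤-reflexive (sym (+-comm p 1))) (+-monoʳ-≤ p pos)

module Limit (μ : Partition) where

  ps : List ℕ
  ps = parts μ

  n : ℕ
  n = length ps

  ν : ℕ → ℕ
  ν i = part ps (suc i)

  ν-decreasing : Decreasing ν
  ν-decreasing i = part-decreasing (sorted μ) i

  ν-null : ∀ i → n ≤ i → ν i ≡ 0
  ν-null i = part-beyond ps

  ν-fits : ∀ i → ν (toℕ i) ≤ lookup ps i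
  ν-fits i = ≤-reflexive (part-lookup ps i)

  β^-homo : ∀ a b → β^ (a + b) ≋ β^ a *ᵖ β^ b
  β^-homo a b = ≋-refl

  module T = TableauFormula commutativeRing β^ ≋-refl β^-homo X Y

  Z : ℕ → (ℕ → ℕ) → Poly
  Z k λs = T.Z (lookup ps) k (T.shape (lookup ps) λs)

  inside-fits : ∀ {λs : ℕ → ℕ} → (∀ i → λs i ≤ ν i) → ∀ i → λs (toℕ i) ≤ lookup ps i
  inside-fits inside i = ≤-trans (inside (toℕ i)) (ν-fits i)

  inside-null : ∀ {λs : ℕ → ℕ} → (∀ i → λs i ≤ ν i) → ∀ i → n ≤ i → λs i ≡ 0
  inside-null inside i p = n≤0⇒n≡0 (≤-trans (inside i) (≤-reflexive (ν-null i p)))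

  Z-ext : ∀ k {μ μ′ : ℕ → ℕ} → (∀ i → μ i ≡ μ′ i) → Z k μ ≋ Z k μ′
  Z-ext k e = T.Z-ext (lookup ps) k (λ i j → cong (λ c → T.bar c j) (e (toℕ i)))

  Z-zero-vanishes : ∀ {λs : ℕ → ℕ} → (∀ i → λs i ≤ ν i) → 0 < λs 0 → Z 0 λs ≋ 0ᵖ
  Z-zero-vanishes {λs} inside pos = T.Z-zero-vanishes (lookup ps) (T.shape (lookup ps) λs) i j
    (dec-true (toℕ j <? λs (toℕ i)) (subst₂ (λ a c → a < λs c) (sym (toℕ-fromℕ< 0<lookup)) (sym i≡0) pos))
    where
    0<n : 0 < n
    0<n = ≰⇒> λ n≤0 → <⇒≱ (≤-trans pos (inside 0)) (≤-reflexive (ν-null 0 n≤0))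
    i : Fin n
    i = fromℕ< 0<n
    i≡0 = toℕ-fromℕ< 0<n
    0<lookup : 0 < lookup ps i
    0<lookup = ≤-trans (≤-trans pos (inside 0))
      (≤-trans (≤-reflexive (cong ν (sym i≡0))) (ν-fits i))
    j : Fin (lookup ps i)
    j = fromℕ< 0<lookup

  family : BranchingFamily commutativeRing polynomialAlgebra n ν Z
  family = record
    { ν-null = ν-null
    ; Z-ext = λ k → Z-ext k
    ; Z-branching = λ k dec inside → T.Z-branching (lookup ps) dec (inside-fits inside) (inside-null inside) k
    ; Z-zero = λ {λs} e → T.Z-zero (lookup ps) (T.shape (lookup ps) λs)
        (λ i j → dec-false (toℕ j <? λs (toℕ i)) (λ q → n≮0 (subst (toℕ j <_) (e (toℕ i)) q)))
    ; Z-zero-vanishes = Z-zero-vanishes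
    }

  module C = Comparison commutativeRing polynomialAlgebra family

  factorial-Φ : ∀ k → n ≤ k → factorialGrothendieck μ k ≋ B.Φ k ν
  factorial-Φ k n≤k = Polynomials.trans (T.factorial-shape ps k) (C.Z-Φ k ν-decreasing (λ _ → ≤-refl) (ν-null k n≤k))

  -- A new entry k + 1 in a box of 0-based row i < n contributes x_{k+1} and y_{k+1+j-i}. Once k ≥ M
  -- + n both indices exceed M, so the weight of this entry is zero in the truncated ring.
  factorial-stable : ∀ m {M} → All (λ v → index v ≤ M) m → ∀ d b →
    coeff (factorialGrothendieck μ (M + n + d)) m b ≡ coeff (factorialGrothendieck μ (M + n)) m b
  factorial-stable m {M} bound zero    b = cong (λ k → coeff (factorialGrothendieck μ k) m b) (+-identityʳ (M + n))
  factorial-stable m {M} bound (suc d) b = trans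
    (cong (λ k → coeff (factorialGrothendieck μ k) m b) (+-suc (M + n) d))
    (trans (step (M + n + d) (m≤m+n (M + n) d)) (factorial-stable m bound d b))
    where
    module Q = Truncated M
    module QR = CommutativeRing Q.commutativeRing
    β^-homoQ : ∀ a b → β^ (a + b) Q.≋ β^ a *ᵖ β^ b
    β^-homoQ a b = Q.≋-refl
    module TQ = TableauFormula Q.commutativeRing β^ Q.≋-refl β^-homoQ X Y
    step : ∀ k → M + n ≤ k → coeff (factorialGrothendieck μ (suc k)) m b ≡ coeff (factorialGrothendieck μ k) m b
    step k big = Q.coeff-cong {factorialGrothendieck μ (suc k)} {factorialGrothendieck μ k} m bound
      (Q.≋-trans (TQ.factorial-shape ps (suc k)) (Q.≋-trans
        (TQ.Z-stable (lookup ps) ν-decreasing ν-fits ν-null {k} small) (QR.sym (TQ.factorial-shape ps k)))) b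
      where
      small : ∀ i j → i < n → TQ.factor (suc k) i j Q.≋ 0ᵖ
      small i j i<n = TQ.factor-small {suc k} {i} {j} (Q.var-small x[ suc k ] (s≤s (≤-trans (m≤m+n M n) big)))
        (Q.var-small y[ suc k + j ∸ i ] (m+n≤o⇒m≤o∸n (suc M) (begin
          suc M + i    ≤⟨ +-monoʳ-≤ (suc M) (<⇒≤ i<n) ⟩
          suc M + n    ≤⟨ s≤s big ⟩
          suc k        ≤⟨ m≤m+n (suc k) j ⟩
          suc k + j    ∎)))
        where open ≤-Reasoning

  degreeBound : Mono → ℕ
  degreeBound []      = 0
  degreeBound (v ∷ m) = index v + degreeBound m

  index≤degreeBound : ∀ m → All (λ v → index v ≤ degreeBound m) m
  index≤degreeBound []      = []
  index≤degreeBound (v ∷ m) = m≤m+n (index v) _ ∷ All.map (λ p → ≤-trans p (m≤n+m _ (index v))) (index≤degreeBound m)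

  threshold : Mono → ℕ
  threshold m = degreeBound m + n

  G : Series
  G m b = coeff (factorialGrothendieck μ (threshold m)) m b

  factorial⟶G : factorialGrothendieck μ ⟶ G
  factorial⟶G m = threshold m , λ k k≥K b → trans
    (cong (λ k → coeff (factorialGrothendieck μ k) m b) (sym (m+[n∸m]≡n k≥K)))
    (factorial-stable m (index≤degreeBound m) (k ∸ threshold m) b)

  -- In general k is m + p. For the empty partition N may be too small for that; the permutation is
  -- then the identity, which does not depend on p, and k = m is taken.
  stable-𝒢 : ∀ {p N} → n ≤ p → (∀ i → i > suc N → permutation ps p i ≡ i) → ∀ m →
    Σ[ k ∈ ℕ ] (k ≥ m × (n ≤ k) × (𝒢 (m + N) (1^ m ×ₛ permutation ps p) ≋ B.Φ k ν))
  stable-𝒢 {p} {N} len fixes m with 1 ≤? ν 0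
  ... | yes pos = m + p , m≤m+n m p , ≤-trans len (m≤n+m p m) ,
    Polynomials.trans (Polynomials.reflexive (𝒢-cong (m + N) (shift-permutation ps len m)))
      (Grassmannian.grassmannian-𝒢 (sorted μ) (≤-trans len (m≤n+m p m)) (begin
        m + p + ν 0     ≡⟨ +-assoc m p (ν 0) ⟩
        m + (p + ν 0)   ≤⟨ +-monoʳ-≤ m (fits-in (sorted μ) fixes pos) ⟩
        m + suc N       ≡⟨ +-suc m N ⟩
        suc (m + N)     ∎))
    where open ≤-Reasoning
  ... | no ¬pos = m , ≤-refl , ≤-trans (≤-reflexive n≡0) z≤n ,
    Polynomials.trans (Polynomials.reflexive (𝒢-cong (m + N) (λ i → trans (shift-permutation ps len m i) (trivial i))))
      (Grassmannian.grassmannian-𝒢 (sorted μ) {m} (≤-trans (≤-reflexive n≡0) z≤n) (begin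
        m + ν 0         ≡⟨ cong (m +_) (n≤0⇒n≡0 (s≤s⁻¹ (≰⇒> ¬pos))) ⟩
        m + 0           ≡⟨ +-identityʳ m ⟩
        m               ≤⟨ m≤n⇒m≤1+n (m≤m+n m N) ⟩
        suc (m + N)     ∎))
    where
    open ≤-Reasoning
    empty : ∀ {as} → All (_> 0) as → ¬ 1 ≤ part as 1 → as ≡ []
    empty []       ¬p = refl
    empty (q ∷ _) ¬p = contradiction q ¬p
    ps≡[] = empty (positive μ) ¬pos
    n≡0 : n ≡ 0
    n≡0 = cong length ps≡[]
    trivial-[] : ∀ k i → permutation [] k i ≡ i
    trivial-[] k i with i ≤? k
    ... | yes _ = +-identityʳ i
    ... | no _  = refl
    trivial : ∀ i → permutation ps (m + p) i ≡ permutation ps m i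
    trivial i = subst (λ as → permutation as (m + p) i ≡ permutation as m i) (sym ps≡[])
      (trans (trivial-[] (m + p) i) (sym (trivial-[] m i)))

  -- The number l of variables on the factorial side is at least the shift k, so one threshold
  -- serves both limits.
  stable⟶G : IsStableGrothendieckOf μ G
  stable⟶G p p≥n N fixes m = threshold m , λ k k≥K b →
    let (l , l≥k , n≤l , e) = stable-𝒢 p≥n fixes k in
    trans (coeff-≋ (Polynomials.trans e (Polynomials.sym (factorial-Φ l n≤l))) m b)
          (proj₂ (factorial⟶G m) l (≤-trans k≥K l≥k) b)

theorem8p7 : (μ : Partition) → Σ[ G ∈ Series ] (IsStableGrothendieckOf μ G × (factorialGrothendieck μ ⟶ G))
theorem8p7 μ = G , stable⟶G , factorial⟶G
  where open Limit μ
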